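{- Let $\mathsf{M}=(E,\operatorname{rk})$ be a nonempty loopless polymatroid and $\mathcal{G}$ a building set on $\mathcal{L}(\mathsf{M})$. Then \[ \mathrm{H}_\mathsf{M}^{\mathcal{G}}(x) = \sum_{ S } \prod_{F\in S} \overline{\chi}_{\mathsf{M}|_{F}/\sup(S,F)}(x), \] where the sum runs over all spanning $\mathcal{G}$-nested sets $S$.
   Context: A polymatroid $\mathsf{M}=(E,\operatorname{rk})$: finite $E$, $\operatorname{rk}:2^E\to\mathbb{Z}_{\ge0}$ with $\operatorname{rk}(\varnothing)=0$, monotone and submodular. Flats: $F$ with $\operatorname{rk}(F\cup\{e\})>\operatorname{rk}(F)$ for all $e\notin F$; they form the lattice $\mathcal L(\mathsf{M})$ with join $\vee$; loopless means $\varnothing$ is a flat. $f(\mathcal{G})$ = inclusion-maximal elements of a set $\mathcal{G}$ of flats; $\mathcal{G}_{\le F}=\{G\in\mathcal{G}:G\subseteq F\}$. A building set is $\mathcal{G}\subseteq\mathcal L(\mathsf{M})\setminus\{\varnothing\}$ such that for every flat $F$ the map $\prod_{G\in f(\mathcal{G}_{\le F})}[\varnothing,G]\to[\varnothing,F]$, $(F_G)\mapsto\bigvee F_G$, is a lattice isomorphism and $\operatorname{rk}(F)=\sum_{G\in f(\mathcal{G}_{\le F})}\operatorname{rk}(G)$. A subset $S\subseteq\mathcal{G}$ is $\mathcal{G}$-nested if for every set $\{F_1,\dots,F_m\}\subseteq S$ of pairwise incomparable flats with $m\ge2$, the join $F_1\vee\cdots\vee F_m$ is not in $\mathcal{G}$;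 it is spanning if the join of all its elements is $E$. For $S\subseteq\mathcal{G}$ and $F\in\mathcal{G}$, $\sup(S,F)=\bigvee_{G\in S,\,G\subsetneq F}G$ (empty join $=\varnothing$). For flats $F\subsetneq G$, $\mathsf{M}|_G/F$ is the polymatroid on $G\setminus F$ with rank $A\mapsto\operatorname{rk}(A\cup F)-\operatorname{rk}(F)$. The characteristic polynomial is $\chi_\mathsf{M}(x)=\sum_{F\in\mathcal L(\mathsf{M})}\mu(\varnothing,F)x^{\operatorname{rk}(E)-\operatorname{rk}(F)}$ ($\mu$ the Möbius function), and for nonempty $\mathsf{M}$ the reduced characteristic polynomial is $\overline\chi_\mathsf{M}(x)=\chi_\mathsf{M}(x)/(x-1)$. The Chow ring $D(\mathsf{M},\mathcal{G})$ is $\mathbb{Q}[x_G:G\in\mathcal{G}]$ (degree-1 generators) modulo the ideal generated by $\big(\prod_{i=1}^m x_{G_i}\big)\big(\sum_{H\in\mathcal{G},H\supseteq G}x_H\big)^{\operatorname{rk}(G)-\operatorname{rk}(\sup(S,G))}$ for each subset $S=\{G_1,\dots,G_m\}\subseteq\mathcal{G}$ and $G\in\mathcal{G}$; $\mathrm{H}_\mathsf{M}^{\mathcal{G}}(x)=\sum_i\dim D^i(\mathsf{M},\mathcal{G})x^i$ is its Hilbert series. -}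

module Defs where

open import Data.Nat as ℕ using (ℕ; zero; suc; _∸_; _≤_; _<_; _<ᵇ_; _≡ᵇ_; _≤ᵇ_)
open import Data.Integer as ℤ using (ℤ; +_)
open import Data.Rational as ℚ using (ℚ; 0ℚ; 1ℚ)
open import Data.Bool as B using (Bool; true; false; _∧_; _∨_; not; if_then_else_; T)
open import Data.List as L using (List; []; _∷_; _++_; filterᵇ; allFin; length; concatMap)
open import Data.Bool.ListAction using (all; any)
open import Data.Nat.ListAction using (sum)
open import Data.Vec as V using (Vec; []; _∷_)
open import Data.Vec.Properties using (≡-dec)
open import Data.Fin as Fin using (Fin; zero; suc)
open import Data.Fin.Subset using (Subset; ⊥; ⊤; ⁅_⁆; _∪_; _∩_; _─_; _∈_; _∉_; _⊆_; ⋃; ∣_∣; inside; outside)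
open import Data.Fin.Subset.Properties using (_⊆?_)
open import Data.Product using (Σ; ∃; _×_; _,_)
open import Function.Bundles using (_⇔_)
open import Data.List.Membership.Propositional using () renaming (_∈_ to _∈ₗ_)
open import Data.List.Relation.Unary.Unique.Propositional using (Unique)
open import Relation.Nullary.Decidable using (⌊_⌋)
open import Relation.Binary.PropositionalEquality using (_≡_; _≢_)

private variable n : ℕ

allSubsets : ∀ n → List (Subset n)
allSubsets zero = [] ∷ []
allSubsets (suc n) = L.map (inside ∷_) (allSubsets n) ++ L.map (outside ∷_) (allSubsets n)

_⊆ᵇ_ : Subset n → Subset n → Bool
A ⊆ᵇ B = ⌊ A ⊆? B ⌋

_==_ : Subset n → Subset n → Bool
A == B = ⌊ ≡-dec B._≟_ A B ⌋

_⊂ᵇ_ : Subset n → Subset n → Bool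
A ⊂ᵇ B = (A ⊆ᵇ B) ∧ not (A == B)

elemᵇ : Fin n → Subset n → Bool
elemᵇ e A = V.lookup A e

memberᵇ : Subset n → List (Subset n) → Bool
memberᵇ X xs = any (X ==_) xs

record IsPolymatroid {n : ℕ} (rk : Subset n → ℕ) : Set where
  field
    rk-∅       : rk ⊥ ≡ 0
    monotone   : ∀ A B → A ⊆ B → rk A ≤ rk B
    submodular : ∀ A B → rk (A ∪ B) ℕ.+ rk (A ∩ B) ≤ rk A ℕ.+ rk B

IsFlat : (Subset n → ℕ) → Subset n → Set
IsFlat rk F = ∀ e → e ∉ F → rk F < rk (F ∪ ⁅ e ⁆)

Loopless : (Subset n → ℕ) → Set
Loopless rk = IsFlat rk ⊥

closure : (Subset n → ℕ) → Subset n → Subset n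
closure rk A = V.tabulate (λ e → rk (A ∪ ⁅ e ⁆) ≡ᵇ rk A)

join : (Subset n → ℕ) → List (Subset n) → Subset n
join rk Fs = closure rk (⋃ Fs)

-- Set functions with ground set E ⊆ Fin n (used for minors M|_G/F),
-- their flats, Möbius function and characteristic polynomials.

isFlatIn : Subset n → (Subset n → ℕ) → Subset n → Bool
isFlatIn {n} E r A =
  (A ⊆ᵇ E) ∧ all (λ e → not (elemᵇ e E) ∨ elemᵇ e A ∨ (r A <ᵇ r (A ∪ ⁅ e ⁆))) (allFin n)

flatsOf : Subset n → (Subset n → ℕ) → List (Subset n)
flatsOf {n} E r = filterᵇ (isFlatIn E r) (allSubsets n)

sumℤ : List ℤ → ℤ
sumℤ = L.foldr ℤ._+_ (+ 0)

mobiusFuel : ℕ → List (Subset n) → Subset n → ℤ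
mobiusFuel zero FL A = + 0
mobiusFuel (suc k) FL A =
  if A == ⊥ then + 1
  else ℤ.- sumℤ (L.map (mobiusFuel k FL) (filterᵇ (_⊂ᵇ A) FL))

-- fuel n+1 suffices: chains of proper subsets of Fin n have length ≤ n+1
mobius : Subset n → (Subset n → ℕ) → Subset n → ℤ
mobius {n} E r A = mobiusFuel (suc n) (flatsOf E r) A

-- univariate integer polynomials as coefficient lists (constant term first)
Polyℤ : Set
Polyℤ = List ℤ

_⊕_ : Polyℤ → Polyℤ → Polyℤ
[] ⊕ q = q
(a ∷ p) ⊕ [] = a ∷ p
(a ∷ p) ⊕ (b ∷ q) = (a ℤ.+ b) ∷ (p ⊕ q)

_⊛_ : Polyℤ → Polyℤ → Polyℤ
[] ⊛ q = []
(a ∷ p) ⊛ q = L.map (a ℤ.*_) q ⊕ (+ 0 ∷ (p ⊛ q))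

monoℤ : ℤ → ℕ → Polyℤ
monoℤ c k = L.replicate k (+ 0) ++ (c ∷ [])

sumPolyℤ : List Polyℤ → Polyℤ
sumPolyℤ = L.foldr _⊕_ []

prodPolyℤ : List Polyℤ → Polyℤ
prodPolyℤ = L.foldr _⊛_ (+ 1 ∷ [])

coeffℤ : Polyℤ → ℕ → ℤ
coeffℤ [] i = + 0
coeffℤ (a ∷ p) zero = a
coeffℤ (a ∷ p) (suc i) = coeffℤ p i

-- quotient of p by (x - 1) (exact when p(1) = 0):
-- q_k = Σ_{j > k} a_j
divXm1 : Polyℤ → Polyℤ
divXm1 [] = []
divXm1 (a ∷ p) = suffixSums p
  where
  suffixSums : Polyℤ → Polyℤ
  suffixSums [] = []
  suffixSums (b ∷ bs) = (b ℤ.+ sumℤ bs) ∷ suffixSums bs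

charPoly : Subset n → (Subset n → ℕ) → Polyℤ
charPoly E r = sumPolyℤ (L.map (λ A → monoℤ (mobius E r A) (r E ∸ r A)) (flatsOf E r))

redCharPoly : Subset n → (Subset n → ℕ) → Polyℤ
redCharPoly E r = divXm1 (charPoly E r)

minorGround : Subset n → Subset n → Subset n
minorGround G F = G ─ F

minorRk : (Subset n → ℕ) → Subset n → Subset n → ℕ
minorRk rk F A = rk (A ∪ F) ∸ rk F

maxBelow : List (Subset n) → Subset n → List (Subset n)
maxBelow 𝒢 F = filterᵇ (λ G → (G ⊆ᵇ F) ∧ not (any (λ G' → (G ⊂ᵇ G') ∧ (G' ⊆ᵇ F)) 𝒢)) 𝒢

record IsBuildingSet {n : ℕ} (rk : Subset n → ℕ) (𝒢 : List (Subset n)) : Set where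
  field
    distinct  : Unique 𝒢
    flats     : ∀ G → G ∈ₗ 𝒢 → IsFlat rk G
    nonempty  : ∀ G → G ∈ₗ 𝒢 → G ≢ ⊥
    rank-sum  : ∀ F → IsFlat rk F → rk F ≡ sum (L.map rk (maxBelow 𝒢 F))
    -- the join map ∏_{G ∈ f(𝒢≤F)} [∅,G] → [∅,F] is surjective ...
    join-surj : ∀ F → IsFlat rk F →
      let Ms = maxBelow 𝒢 F in
      ∀ H → IsFlat rk H → H ⊆ F →
      ∃ λ (t : Fin (length Ms) → Subset n) →
        (∀ i → IsFlat rk (t i) × t i ⊆ L.lookup Ms i) ×
        join rk (L.tabulate t) ≡ H
    -- ... and an order embedding (product order ↔ inclusion), hence a
    -- lattice isomorphism
    join-order : ∀ F → IsFlat rk F →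
      let Ms = maxBelow 𝒢 F in
      ∀ (t t' : Fin (length Ms) → Subset n) →
        (∀ i → IsFlat rk (t i) × t i ⊆ L.lookup Ms i) →
        (∀ i → IsFlat rk (t' i) × t' i ⊆ L.lookup Ms i) →
        (∀ i → t i ⊆ t' i) ⇔ (join rk (L.tabulate t) ⊆ join rk (L.tabulate t'))

-- Subsets S of 𝒢 are encoded as S : Subset (length 𝒢) (i ∈ S ↔ 𝒢[i] ∈ S).

module _ {n : ℕ} (rk : Subset n → ℕ) (𝒢 : List (Subset n)) where

  m : ℕ
  m = length 𝒢

  Gᵢ : Fin m → Subset n
  Gᵢ = L.lookup 𝒢

  members : Subset m → List (Fin m)
  members S = filterᵇ (λ i → elemᵇ i S) (allFin m)

  elems : Subset m → List (Subset n)
  elems S = L.map Gᵢ (members S)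

  supS : Subset m → Subset n → Subset n
  supS S F = join rk (filterᵇ (_⊂ᵇ F) (elems S))

  pairwiseIncomp : Subset m → Bool
  pairwiseIncomp T =
    all (λ i → all (λ j → not (elemᵇ i T ∧ elemᵇ j T ∧ not ⌊ i Fin.≟ j ⌋)
                          ∨ not (Gᵢ i ⊆ᵇ Gᵢ j)) (allFin m)) (allFin m)

  isNested : Subset m → Bool
  isNested S =
    all (λ T → not ((T ⊆ᵇ S) ∧ (2 ≤ᵇ ∣ T ∣) ∧ pairwiseIncomp T)
               ∨ not (memberᵇ (join rk (elems T)) 𝒢)) (allSubsets m)

  isSpanning : Subset m → Bool
  isSpanning S = join rk (elems S) == ⊤

  nestedSum : Polyℤ
  nestedSum =
    sumPolyℤ (L.map (λ S → prodPolyℤ (L.map (λ i →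
                 redCharPoly (minorGround (Gᵢ i) (supS S (Gᵢ i)))
                             (minorRk rk (supS S (Gᵢ i)))) (members S)))
              (filterᵇ (λ S → isNested S ∧ isSpanning S) (allSubsets m)))

  -- Polynomial ring ℚ[x_G : G ∈ 𝒢] : finite lists of terms (c, exponent vector),
  -- compared coefficientwise.

  Mono : Set
  Mono = Vec ℕ m

  Poly : Set
  Poly = List (ℚ × Mono)

  coeff : Poly → Mono → ℚ
  coeff p μ = L.foldr (λ { (c , ν) acc → if ⌊ ≡-dec ℕ._≟_ ν μ ⌋ then c ℚ.+ acc else acc }) 0ℚ p

  _≈P_ : Poly → Poly → Set
  p ≈P q = ∀ μ → coeff p μ ≡ coeff q μ

  _+P_ : Poly → Poly → Poly
  p +P q = p ++ q

  _*P_ : Poly → Poly → Poly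
  p *P q = concatMap (λ { (c , a) → L.map (λ { (d , b) → (c ℚ.* d , V.zipWith ℕ._+_ a b) }) q }) p

  scaleP : ℚ → Poly → Poly
  scaleP c p = L.map (λ { (d , b) → (c ℚ.* d , b) }) p

  negP : Poly → Poly
  negP = scaleP (ℚ.- 1ℚ)

  oneP : Poly
  oneP = (1ℚ , V.replicate m 0) ∷ []

  var : Fin m → Poly
  var i = (1ℚ , (V.replicate m 0 V.[ i ]≔ 1)) ∷ []

  powP : Poly → ℕ → Poly
  powP p zero = oneP
  powP p (suc k) = p *P powP p k

  sumP : List Poly → Poly
  sumP = L.foldr _+P_ []

  prodP : List Poly → Poly
  prodP = L.foldr _*P_ oneP

  degree : Mono → ℕ
  degree = V.sum

  gen : Subset m → Fin m → Poly
  gen S j =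
    prodP (L.map var (members S)) *P
    powP (sumP (L.map var (filterᵇ (λ j' → Gᵢ j ⊆ᵇ Gᵢ j') (allFin m))))
         (rk (Gᵢ j) ∸ rk (supS S (Gᵢ j)))

  InIdeal : Poly → Set
  InIdeal p = ∃ λ (Ls : List (Poly × Subset m × Fin m)) →
    p ≈P sumP (L.map (λ { (q , S , j) → q *P gen S j }) Ls)

  Homogeneous : ℕ → Poly → Set
  Homogeneous i p = ∀ μ → coeff p μ ≢ 0ℚ → degree μ ≡ i

  lincomb : {d : ℕ} → (Fin d → ℚ) → (Fin d → Poly) → Poly
  lincomb {d} c b = sumP (L.map (λ k → scaleP (c k) (b k)) (allFin d))

  -- dim_ℚ D^i(M,𝒢) = d : the images of b_1..b_d form a ℚ-basis of the degree-i
  -- part of ℚ[x_G]/I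
  ChowDim : ℕ → ℕ → Set
  ChowDim i d = ∃ λ (b : Fin d → Poly) →
    (∀ k → Homogeneous i (b k)) ×
    (∀ p → Homogeneous i p → ∃ λ (c : Fin d → ℚ) → InIdeal (p +P negP (lincomb c b))) ×
    (∀ (c : Fin d → ℚ) → InIdeal (lincomb c b) → ∀ k → c k ≡ 0ℚ)

{-# OPTIONS --safe #-}

-- Let y_G be the sum of the variables x_H with H ⊇ G. The Chow ideal is spanned by the
-- products x^ν y_G^e with e ≥ rk G − rk sup(supp ν, G). Giving x_G the weight n − |G|, the
-- leading term of such a product is x^ν x_G^e, so the standard monomials, those whose
-- exponent at each G is less than rk G − rk sup(support, G), span the quotient. They are
-- independent because each is dual to a linear functional killing the ideal, defined by
-- recursion on the weight; that it respects all relations is a confluence statement, whose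
-- only hard case is a pair F ⊊ G, settled by submodularity and the fact that overlapping
-- members of 𝒢 have their join in 𝒢.
--
-- The Hilbert series is therefore the sum over nested N of ∏_{G ∈ N} (x + … + x^(d−1)) with
-- d = rk G − rk sup(N, G). For a flat F restrict this sum to the N consisting of subsets of
-- F, and the sum of the theorem to the S with join F. Both restrictions are multiplicative
-- over the 𝒢-factors of F and, for F ∈ 𝒢, satisfy Φ(F) = Σ χ̄(M|F / F') Φ(F') over the
-- flats F' ⊊ F, because 1 + … + x^(r−1) is the sum of all χ̄(M|F / F') when rk F = r.
module Submission where

-- Independence is the obstacle: ideal membership allows arbitrary combinations of generators, and
-- no normal form is at hand. A functional is just a function on monomials, so killing the ideal
-- becomes a family of equations between its values. Each nonstandard monomial fixes its value by
-- one violated relation; the other relations with the same leading monomial must then follow. For F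
-- ⊊ G this is not automatic: once x_F has been expanded into y_F, F is lost from the support and
-- the exponent demanded at G grows. It grows by at most the exponent demanded at F, and that many
-- factors y_F are available for conversion into y_G.
--
-- A standard monomial has nested support by itself: if G lay below sup(support, G), its exponent at
-- G would have to be less than 0. Hence nestedness is used in the form `Nest`, over all of 𝒢.
--
-- Flats outside 𝒢 enter because the recursion for F ∈ 𝒢 runs over all flats below F. In the Hilbert
-- sum F may be left out (factor 1) or put in (factor x + ... + x^(d-1)); in the other sum,
-- nestedness and join F force F into S.

open import Defs
open import Level using (Level; 0ℓ)
open import Algebra.Bundles using (CommutativeMonoid; CommutativeRing)
open import Data.Bool as B using (Bool; true; false; _∧_; _∨_; not; T; T?)
open import Data.Bool.ListAction using (all; any)
open import Data.Bool.Properties using (T-∧; T-≡)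
open import Data.Empty using (⊥-elim) renaming (⊥ to Absurd)
open import Data.Fin as Fin using (Fin; zero; suc)
open import Data.Fin.Properties as FinP using (any?)
open import Data.Fin.Subset using (Subset; ⊥; ⊤; ⁅_⁆; _∪_; _∩_; _─_; _-_; _∈_; _∉_; _⊆_; ⋃; ∣_∣; inside; outside; Nonempty)
open import Data.Fin.Subset.Properties
open import Data.Integer as ℤ using (ℤ)
open import Data.Integer.Properties as ℤP using ()
import Data.Integer.Tactic.RingSolver as ℤRing
open import Data.List as L using (List; []; _∷_; _++_; allFin; filterᵇ; length)
open import Data.List.Membership.Propositional using () renaming (_∈_ to _∈ₗ_)
open import Data.List.Membership.Propositional.Properties using (∈-allFin; ∈-cartesianProductWith⁺; ∈-deduplicate⁺; ∈-filter⁺; ∈-filter⁻; ∈-lookup; ∈-map⁺; ∈-map⁻; ∈-tabulate⁻; ∈-++⁺ˡ; ∈-++⁺ʳ)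
open import Data.List.Properties as LP using ()
open import Data.List.Relation.Unary.All as All using ([]; _∷_)
import Data.List.Relation.Unary.All.Properties as AllP
open import Data.List.Relation.Unary.AllPairs using ([]; _∷_)
open import Data.List.Relation.Unary.Any as Any using (here; there)
open import Data.List.Relation.Unary.Any.Properties using (any⁺; any⁻; lookup-index)
import Data.List.Relation.Unary.Unique.DecPropositional.Properties as UniqueDec
open import Data.List.Relation.Unary.Unique.Propositional using (Unique)
open import Data.List.Relation.Unary.Unique.Propositional.Properties as UniqueP using ()
open import Data.Nat as ℕ using (ℕ; zero; suc; _∸_; _≤_; _<_; z≤n; s≤s; _<ᵇ_; _≡ᵇ_; _≤ᵇ_)
open import Data.Nat.ListAction using (sum)
open import Data.Nat.Properties as ℕP using (module ≤-Reasoning)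
open import Data.Nat.Tactic.RingSolver using (solve-∀)
open import Data.Product using (∃; _×_; _,_; proj₁; proj₂)
open import Data.Rational as ℚ using (ℚ; 0ℚ; 1ℚ)
open import Data.Rational.Properties as ℚP using ()
open import Data.Rational.Solver using (module +-*-Solver)
open import Data.Sum using (_⊎_; inj₁; inj₂; [_,_]′)
open import Data.Vec as V using (Vec; []; _∷_; here; there)
open import Data.Vec.Properties as VP using (≡-dec; []=⇒lookup; lookup⇒[]=; lookup∘tabulate)
open import Function using (_∘_; id)
open import Function.Bundles using (Equivalence)
open import Relation.Binary.PropositionalEquality as ≡ using (_≡_; _≢_; refl; sym; trans; cong; cong₂; subst; ≢-sym; module ≡-Reasoning)
open import Relation.Nullary using (¬_; Dec; yes; no)
open import Relation.Nullary.Decidable using (_×-dec_; _→-dec_; ¬?; ⌊_⌋; toWitness; fromWitness; decidable-stable)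

-- Finite sums

module MonoidSum {c ℓ : Level} (M : CommutativeMonoid c ℓ) where
  open CommutativeMonoid M public renaming (refl to ≈-refl; sym to ≈-sym; trans to ≈-trans; reflexive to ≈-reflexive)
  open import Relation.Binary.Reasoning.Setoid setoid public

  infix 6 _▹_

  -- The condition is a decision rather than a Boolean so that a summand may be rewritten under a
  -- proof of its condition. The monoid is left general because the same lemmas serve numbers,
  -- polynomials and polynomials modulo the ideal.
  _▹_ : ∀ {p} {P : Set p} → Dec P → Carrier → Carrier
  yes _ ▹ x = x
  no _ ▹ x = ε

  ▹-yes : ∀ {p} {P : Set p} (d : Dec P) {x} → P → d ▹ x ≈ x
  ▹-yes (yes _) _ = ≈-refl
  ▹-yes (no ¬p) p = ⊥-elim (¬p p)

  ▹-no : ∀ {p} {P : Set p} (d : Dec P) {x} → ¬ P → d ▹ x ≈ ε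
  ▹-no (yes p) ¬p = ⊥-elim (¬p p)
  ▹-no (no _) _ = ≈-refl

  ▹-cong : ∀ {p q} {P : Set p} {Q : Set q} (d : Dec P) (e : Dec Q) {x y} →
           (P → Q) → (Q → P) → (P → x ≈ y) → d ▹ x ≈ e ▹ y
  ▹-cong (yes p) e f g h = ≈-trans (h p) (≈-sym (▹-yes e (f p)))
  ▹-cong (no ¬p) e f g h = ≈-sym (▹-no e (¬p ∘ g))

  ▹-congʳ : ∀ {p} {P : Set p} (d : Dec P) {x y} → (P → x ≈ y) → d ▹ x ≈ d ▹ y
  ▹-congʳ d = ▹-cong d d (λ z → z) (λ z → z)

  ▹-ε : ∀ {p} {P : Set p} (d : Dec P) {x} → (P → x ≈ ε) → d ▹ x ≈ ε
  ▹-ε (yes p) h = h p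
  ▹-ε (no _) h = ≈-refl

  ▹-× : ∀ {p q} {P : Set p} {Q : Set q} (d : Dec P) (e : Dec Q) {x} →
        (d ×-dec e) ▹ x ≈ d ▹ (e ▹ x)
  ▹-× (yes _) (yes _) = ≈-refl
  ▹-× (yes _) (no _) = ≈-refl
  ▹-× (no _) _ = ≈-refl

  ▹-swap : ∀ {p q} {P : Set p} {Q : Set q} (d : Dec P) (e : Dec Q) {x} → d ▹ (e ▹ x) ≈ e ▹ (d ▹ x)
  ▹-swap (yes _) e = ≈-refl
  ▹-swap (no _) e = ≈-sym (▹-ε e λ _ → ≈-refl)

  ▹-∙ : ∀ {p} {P : Set p} (d : Dec P) {x y} → d ▹ (x ∙ y) ≈ (d ▹ x) ∙ (d ▹ y)
  ▹-∙ (yes _) = ≈-refl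
  ▹-∙ (no _) = ≈-sym (identityˡ ε)

  interchange : ∀ w x y z → (w ∙ x) ∙ (y ∙ z) ≈ (w ∙ y) ∙ (x ∙ z)
  interchange w x y z = begin
    (w ∙ x) ∙ (y ∙ z)  ≈⟨ assoc w x (y ∙ z) ⟩
    w ∙ (x ∙ (y ∙ z))  ≈⟨ ∙-congˡ (assoc x y z) ⟨
    w ∙ ((x ∙ y) ∙ z)  ≈⟨ ∙-congˡ (∙-congʳ (comm x y)) ⟩
    w ∙ ((y ∙ x) ∙ z)  ≈⟨ ∙-congˡ (assoc y x z) ⟩
    w ∙ (y ∙ (x ∙ z))  ≈⟨ assoc w y (x ∙ z) ⟨
    (w ∙ y) ∙ (x ∙ z)  ∎

  module _ {a} {A : Set a} where
    Σ : List A → (A → Carrier) → Carrier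
    Σ [] f = ε
    Σ (x ∷ xs) f = f x ∙ Σ xs f

    Σ-cong∈ : ∀ xs {f g} → (∀ x → x ∈ₗ xs → f x ≈ g x) → Σ xs f ≈ Σ xs g
    Σ-cong∈ [] h = ≈-refl
    Σ-cong∈ (x ∷ xs) h = ∙-cong (h x (here refl)) (Σ-cong∈ xs λ y y∈ → h y (there y∈))

    Σ-cong : ∀ xs {f g} → (∀ x → f x ≈ g x) → Σ xs f ≈ Σ xs g
    Σ-cong xs h = Σ-cong∈ xs λ x _ → h x

    Σ-ε : ∀ xs {f} → (∀ x → x ∈ₗ xs → f x ≈ ε) → Σ xs f ≈ ε
    Σ-ε [] h = ≈-refl
    Σ-ε (x ∷ xs) h = ≈-trans (∙-cong (h x (here refl)) (Σ-ε xs λ y y∈ → h y (there y∈))) (identityˡ ε)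

    Σ-++ : ∀ xs ys {f} → Σ (xs ++ ys) f ≈ Σ xs f ∙ Σ ys f
    Σ-++ [] ys = ≈-sym (identityˡ _)
    Σ-++ (x ∷ xs) ys = ≈-trans (∙-congˡ (Σ-++ xs ys)) (≈-sym (assoc _ _ _))

    Σ-∙ : ∀ xs {f g} → Σ xs (λ x → f x ∙ g x) ≈ Σ xs f ∙ Σ xs g
    Σ-∙ [] = ≈-sym (identityˡ ε)
    Σ-∙ (x ∷ xs) = ≈-trans (∙-congˡ (Σ-∙ xs)) (interchange _ _ _ _)

    Σ-▹ : ∀ {p} {P : Set p} (d : Dec P) xs {f} → d ▹ Σ xs f ≈ Σ xs (λ x → d ▹ f x)
    Σ-▹ (yes _) xs = ≈-refl
    Σ-▹ (no _) xs = ≈-sym (Σ-ε xs λ _ _ → ≈-refl)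

    Σ-single : ∀ xs {f} x → Unique xs → x ∈ₗ xs → (∀ y → y ≢ x → f y ≈ ε) → Σ xs f ≈ f x
    Σ-single (x ∷ xs) .x (x∉ ∷ u) (here refl) h =
      ≈-trans (∙-congˡ (Σ-ε xs λ y y∈ → h y λ { refl → All.lookup x∉ y∈ refl })) (identityʳ _)
    Σ-single (z ∷ xs) x (z∉ ∷ u) (there x∈) h =
      ≈-trans (∙-cong (h z λ { refl → All.lookup z∉ x∈ refl }) (Σ-single xs x u x∈ h)) (identityˡ _)

    Σ-filterᵇ : ∀ b xs {f} → Σ (filterᵇ b xs) f ≈ Σ xs (λ x → T? (b x) ▹ f x)
    Σ-filterᵇ b [] = ≈-refl
    Σ-filterᵇ b (x ∷ xs) with b x
    ... | true = ∙-congˡ (Σ-filterᵇ b xs)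
    ... | false = ≈-trans (Σ-filterᵇ b xs) (≈-sym (identityˡ _))

  Σ-map : ∀ {a b} {A : Set a} {B : Set b} (h : A → B) xs {f} → Σ (L.map h xs) f ≈ Σ xs (f ∘ h)
  Σ-map h [] = ≈-refl
  Σ-map h (x ∷ xs) = ∙-congˡ (Σ-map h xs)

  Σ-swap : ∀ {a b} {A : Set a} {B : Set b} (xs : List A) (ys : List B) {f : A → B → Carrier} →
           Σ xs (λ x → Σ ys (f x)) ≈ Σ ys (λ y → Σ xs (λ x → f x y))
  Σ-swap [] ys = ≈-sym (Σ-ε ys λ _ _ → ≈-refl)
  Σ-swap (x ∷ xs) ys = ≈-trans (∙-congˡ (Σ-swap xs ys)) (≈-sym (Σ-∙ ys))

module RingSum {c ℓ : Level} (R : CommutativeRing c ℓ) where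
  open CommutativeRing R
    using (Carrier; _≈_; _+_; _*_; 0#; 1#; zeroˡ; zeroʳ; distribˡ; distribʳ; *-comm; *-cong; *-congˡ; *-congʳ; +-cong; +-congˡ; +-congʳ; *-identityˡ; *-identityʳ; +-identityˡ; +-identityʳ) public
  open MonoidSum (CommutativeRing.+-commutativeMonoid R)
    hiding (Carrier; _≈_; _∙_; ε) public
  open MonoidSum (CommutativeRing.*-commutativeMonoid R) public
    using () renaming (Σ to Π; _▹_ to _▸_; Σ-cong to Π-cong; Σ-∙ to Π-*; Σ-map to Π-map;
                       Σ-filterᵇ to Π-filterᵇ; ▹-yes to ▸-yes; ▹-no to ▸-no; ▹-cong to ▸-cong; Σ-single to Π-single)

  ▹-*ˡ : ∀ {p} {P : Set p} (d : Dec P) {x y} → (d ▹ x) * y ≈ d ▹ (x * y)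
  ▹-*ˡ (yes _) = ≈-refl
  ▹-*ˡ (no _) = zeroˡ _

  ▹-*ʳ : ∀ {p} {P : Set p} (d : Dec P) {x y} → x * (d ▹ y) ≈ d ▹ (x * y)
  ▹-*ʳ (yes _) = ≈-refl
  ▹-*ʳ (no _) = zeroʳ _

  module _ {a} {A : Set a} where
    Σ-*ˡ : ∀ (xs : List A) {f} r → r * Σ xs f ≈ Σ xs (λ x → r * f x)
    Σ-*ˡ [] r = zeroʳ r
    Σ-*ˡ (x ∷ xs) r = ≈-trans (distribˡ _ _ _) (+-congˡ (Σ-*ˡ xs r))

    Σ-*ʳ : ∀ (xs : List A) {f} r → Σ xs f * r ≈ Σ xs (λ x → f x * r)
    Σ-*ʳ xs r = ≈-trans (*-comm _ _) (≈-trans (Σ-*ˡ xs r) (Σ-cong xs λ x → *-comm _ _))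

    Π-zero : ∀ (xs : List A) {f} x → x ∈ₗ xs → f x ≈ 0# → Π xs f ≈ 0#
    Π-zero (x ∷ xs) .x (here refl) h = ≈-trans (*-congʳ h) (zeroˡ _)
    Π-zero (z ∷ xs) x (there x∈) h = ≈-trans (*-congˡ (Π-zero xs x x∈ h)) (zeroʳ _)

open import Data.Nat using (_+_; _*_)

-- Subsets, closures and flats

T-not⁻ : ∀ {b} → T (not b) → ¬ T b
T-not⁻ {false} _ ()

T-not⁺ : ∀ {b} → ¬ T b → T (not b)
T-not⁺ {false} _ = _
T-not⁺ {true} h = h _

T-∧⁻ : ∀ {a b} → T (a ∧ b) → T a × T b
T-∧⁻ = Equivalence.to T-∧

T-∧⁺ : ∀ {a b} → T a → T b → T (a ∧ b)
T-∧⁺ p q = Equivalence.from T-∧ (p , q)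

T-imp⁻ : ∀ {a b} → T (not a ∨ b) → T a → T b
T-imp⁻ {true} h _ = h

T-imp⁺ : ∀ {a b} → (T a → T b) → T (not a ∨ b)
T-imp⁺ {true} h = h _
T-imp⁺ {false} h = _

all-elim : ∀ {A : Set} (p : A → Bool) xs {x} → T (all p xs) → x ∈ₗ xs → T (p x)
all-elim p (x ∷ xs) h (here refl) = proj₁ (T-∧⁻ h)
all-elim p (x ∷ xs) h (there q) = all-elim p xs (proj₂ (T-∧⁻ {p x} h)) q

all-intro : ∀ {A : Set} (p : A → Bool) xs → (∀ x → x ∈ₗ xs → T (p x)) → T (all p xs)
all-intro p [] h = _
all-intro p (x ∷ xs) h = T-∧⁺ (h x (here refl)) (all-intro p xs λ y q → h y (there q))

∈-filterᵇ⁺ : ∀ {A : Set} (p : A → Bool) {xs x} → x ∈ₗ xs → T (p x) → x ∈ₗ filterᵇ p xs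
∈-filterᵇ⁺ p = ∈-filter⁺ (T? ∘ p)

∈-filterᵇ⁻ : ∀ {A : Set} (p : A → Bool) {xs x} → x ∈ₗ filterᵇ p xs → x ∈ₗ xs × T (p x)
∈-filterᵇ⁻ p = ∈-filter⁻ (T? ∘ p)

allSubsets-complete : ∀ {n} (A : Subset n) → A ∈ₗ allSubsets n
allSubsets-complete [] = here refl
allSubsets-complete (inside ∷ A) = ∈-++⁺ˡ (∈-map⁺ (inside ∷_) (allSubsets-complete A))
allSubsets-complete {suc n} (outside ∷ A) =
  ∈-++⁺ʳ (L.map (inside ∷_) (allSubsets n)) (∈-map⁺ (outside ∷_) (allSubsets-complete A))

allSubsets-unique : ∀ n → Unique (allSubsets n)
allSubsets-unique zero = [] ∷ []
allSubsets-unique (suc n) =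
  UniqueP.++⁺ (UniqueP.map⁺ (λ { refl → refl }) (allSubsets-unique n))
              (UniqueP.map⁺ (λ { refl → refl }) (allSubsets-unique n)) disj
  where
  disj : ∀ {v} → ¬ (v ∈ₗ L.map (inside ∷_) (allSubsets n) × v ∈ₗ L.map (outside ∷_) (allSubsets n))
  disj (p , q) with ∈-map⁻ (inside ∷_) p | ∈-map⁻ (outside ∷_) q
  ... | _ , _ , refl | _ , _ , ()

elem⁺ : ∀ {n} {A : Subset n} {e} → e ∈ A → T (elemᵇ e A)
elem⁺ {A = A} {e} p rewrite []=⇒lookup p = _

elem⁻ : ∀ {n} {A : Subset n} {e} → T (elemᵇ e A) → e ∈ A
elem⁻ {A = A} {e} t = lookup⇒[]= e A (Equivalence.to T-≡ t)

∈-tabulateᵇ⁺ : ∀ {n} (p : Fin n → Bool) {e} → T (p e) → e ∈ V.tabulate p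
∈-tabulateᵇ⁺ p {e} t = lookup⇒[]= e _ (trans (lookup∘tabulate p e) (Equivalence.to T-≡ t))

∈-tabulateᵇ⁻ : ∀ {n} (p : Fin n → Bool) {e} → e ∈ V.tabulate p → T (p e)
∈-tabulateᵇ⁻ p {e} h = Equivalence.from T-≡ (trans (sym (lookup∘tabulate p e)) ([]=⇒lookup h))

infix 4 _⊏_ _≟ₛ_ _⊏?_

_≟ₛ_ : ∀ {n} (A B : Subset n) → Dec (A ≡ B)
_≟ₛ_ = ≡-dec B._≟_

_⊏_ : ∀ {n} → Subset n → Subset n → Set
A ⊏ B = A ⊆ B × A ≢ B

_⊏?_ : ∀ {n} (A B : Subset n) → Dec (A ⊏ B)
A ⊏? B = (A ⊆? B) ×-dec ¬? (A ≟ₛ B)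

⊆ᵇ⁺ : ∀ {n} {A B : Subset n} → A ⊆ B → T (A ⊆ᵇ B)
⊆ᵇ⁺ {A = A} {B} h = fromWitness {a? = A ⊆? B} h

⊆ᵇ⁻ : ∀ {n} {A B : Subset n} → T (A ⊆ᵇ B) → A ⊆ B
⊆ᵇ⁻ {A = A} {B} h = toWitness {a? = A ⊆? B} h

==⁺ : ∀ {n} {A B : Subset n} → A ≡ B → T (A == B)
==⁺ {A = A} {B} h = fromWitness {a? = A ≟ₛ B} h

==⁻ : ∀ {n} {A B : Subset n} → T (A == B) → A ≡ B
==⁻ {A = A} {B} h = toWitness {a? = A ≟ₛ B} h

⊂ᵇ⁺ : ∀ {n} {A B : Subset n} → A ⊏ B → T (A ⊂ᵇ B)
⊂ᵇ⁺ {A = A} {B} (h , k) = T-∧⁺ (⊆ᵇ⁺ {A = A} {B} h) (T-not⁺ λ t → k (==⁻ {A = A} {B} t))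

⊂ᵇ⁻ : ∀ {n} {A B : Subset n} → T (A ⊂ᵇ B) → A ⊏ B
⊂ᵇ⁻ {A = A} {B} t =
  ⊆ᵇ⁻ {A = A} {B} (proj₁ (T-∧⁻ t)) , λ e → T-not⁻ (proj₂ (T-∧⁻ {A ⊆ᵇ B} t)) (==⁺ {A = A} {B} e)

⊈⇒∃ : ∀ {n} {A B : Subset n} → ¬ (A ⊆ B) → ∃ λ e → e ∈ A × e ∉ B
⊈⇒∃ {A = A} {B} h with any? (λ e → (e ∈? A) ×-dec ¬? (e ∈? B))
... | yes p = p
... | no ¬p = ⊥-elim (h λ {e} e∈A → decidable-stable (e ∈? B) λ e∉B → ¬p (e , e∈A , e∉B))

⊏⇒∣<∣ : ∀ {n} {A B : Subset n} → A ⊏ B → ∣ A ∣ < ∣ B ∣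
⊏⇒∣<∣ {A = A} {B} (h , k) = p⊂q⇒∣p∣<∣q∣ (h , ⊈⇒∃ λ B⊆A → k (⊆-antisym h B⊆A))

∪-least : ∀ {n} {A B C : Subset n} → A ⊆ C → B ⊆ C → A ∪ B ⊆ C
∪-least {A = A} {B} h k e = [ h , k ]′ (x∈p∪q⁻ A B e)

⁅⁆⊆ : ∀ {n} {e : Fin n} {A} → e ∈ A → ⁅ e ⁆ ⊆ A
⁅⁆⊆ {e = e} {A} h {x} x∈ = subst (_∈ A) (sym (x∈⁅y⁆⇒x≡y e x∈)) h

∈⋃⁻ : ∀ {n} (As : List (Subset n)) {e} → e ∈ ⋃ As → ∃ λ A → A ∈ₗ As × e ∈ A
∈⋃⁻ [] h = ⊥-elim (∉⊥ h)
∈⋃⁻ (A ∷ As) h with x∈p∪q⁻ A (⋃ As) h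
... | inj₁ p = A , here refl , p
... | inj₂ q with ∈⋃⁻ As q
... | B , B∈ , e∈ = B , there B∈ , e∈

⊆⋃ : ∀ {n} (As : List (Subset n)) {A} → A ∈ₗ As → A ⊆ ⋃ As
⊆⋃ (A ∷ As) (here refl) = p⊆p∪q (⋃ As)
⊆⋃ (B ∷ As) (there h) = q⊆p∪q B (⋃ As) ∘ ⊆⋃ As h

≢⊥⇒nonempty : ∀ {n} {A : Subset n} → A ≢ ⊥ → Nonempty A
≢⊥⇒nonempty {A = A} h with ⊈⇒∃ {A = A} {⊥} (λ A⊆⊥ → h (⊆-antisym A⊆⊥ (⊆-min _)))
... | e , e∈A , _ = e , e∈A

maximal-above : ∀ {n k} (G : Fin k → Subset n) {P : Fin k → Set} → (∀ i → Dec (P i)) →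
                ∀ i → P i → ∃ λ j → P j × G i ⊆ G j × (∀ h → P h → ¬ (G j ⊏ G h))
maximal-above {n} G {P} P? i p = go n i p (ℕP.m∸n≤m n ∣ G i ∣)
  where
  go : ∀ f i → P i → n ∸ ∣ G i ∣ ≤ f → ∃ λ j → P j × G i ⊆ G j × (∀ h → P h → ¬ (G j ⊏ G h))
  go f i p le with any? (λ h → P? h ×-dec (G i ⊏? G h))
  ... | no ¬q = i , p , id , λ h ph lt → ¬q (h , ph , lt)
  ... | yes (h , ph , lt) with f | ℕP.<-≤-trans (ℕP.∸-monoʳ-< {n} (⊏⇒∣<∣ lt) (∣p∣≤n (G h))) le
  ... | suc f' | s≤s le' with go f' h ph le'
  ... | j , pj , sub , mx = j , pj , sub ∘ proj₁ lt , mx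

lookup-inj : ∀ {A : Set} {xs : List A} → Unique xs → ∀ i j → L.lookup xs i ≡ L.lookup xs j → i ≡ j
lookup-inj (_ ∷ _) zero zero _ = refl
lookup-inj {xs = x ∷ xs} (x∉ ∷ _) zero (suc j) e = ⊥-elim (All.lookup x∉ (∈-lookup {xs = xs} j) e)
lookup-inj {xs = x ∷ xs} (x∉ ∷ _) (suc i) zero e = ⊥-elim (All.lookup x∉ (∈-lookup {xs = xs} i) (sym e))
lookup-inj (_ ∷ u) (suc i) (suc j) e = cong suc (lookup-inj u i j e)

module Polymatroid {n : ℕ} (rk : Subset n → ℕ) (pm : IsPolymatroid rk) (loopless : Loopless rk) where
  open IsPolymatroid pm
  open ≤-Reasoning

  cl : Subset n → Subset n
  cl = closure rk

  Flat : Subset n → Set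
  Flat = IsFlat rk

  flat? : ∀ F → Dec (Flat F)
  flat? F = FinP.all? λ e → ¬? (e ∈? F) →-dec (rk F ℕP.<? rk (F ∪ ⁅ e ⁆))

  -- U and I are free below the union and the intersection, so that uses need only inclusions and no
  -- equations between sets.
  submod : ∀ {A B U I} → U ⊆ A ∪ B → I ⊆ A → I ⊆ B → rk U + rk I ≤ rk A + rk B
  submod {A} {B} {U} {I} hU hA hB = ℕP.≤-trans
    (ℕP.+-mono-≤ (monotone U _ hU) (monotone I (A ∩ B) λ e → x∈p∩q⁺ (hA e , hB e)))
    (submodular A B)

  subadd : ∀ {A B U} → U ⊆ A ∪ B → rk U ≤ rk A + rk B
  subadd {A} {B} {U} h = ℕP.≤-trans (ℕP.m≤m+n _ _) (submod {A} {B} {U} {⊥} h (⊆-min _) (⊆-min _))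

  ∈cl⁺ : ∀ {A e} → rk (A ∪ ⁅ e ⁆) ≡ rk A → e ∈ cl A
  ∈cl⁺ {A} h = ∈-tabulateᵇ⁺ _ (ℕP.≡⇒≡ᵇ _ _ h)

  ∈cl⁻ : ∀ {A e} → e ∈ cl A → rk (A ∪ ⁅ e ⁆) ≡ rk A
  ∈cl⁻ {A} h = ℕP.≡ᵇ⇒≡ _ _ (∈-tabulateᵇ⁻ (λ e → rk (A ∪ ⁅ e ⁆) ≡ᵇ rk A) h)

  cl-ext : ∀ {A} → A ⊆ cl A
  cl-ext {A} {e} e∈A = ∈cl⁺ {A} (cong rk (⊆-antisym (∪-least id (⁅⁆⊆ e∈A)) (p⊆p∪q ⁅ e ⁆)))

  -- Induction on the size of B, removing one e: the sets A ∪ (B - e) and A ∪ ⁅ e ⁆ cover A ∪ B and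
  -- both contain A, so by submodularity no rank is gained. Thus `closure`, which tests single
  -- elements, preserves rank as a whole.
  absorb : ∀ {A} k B → ∣ B ∣ ≤ k → B ⊆ cl A → rk (A ∪ B) ≤ rk A
  absorb {A} k B le h with nonempty? B
  ... | no ¬ne = monotone _ _ (∪-least id λ e → ⊥-elim (¬ne (_ , e)))
  absorb {A} zero B le h | yes (e , e∈B) = ⊥-elim (ℕP.n≮0 (ℕP.<-≤-trans (x∈p⇒∣p-x∣<∣p∣ e∈B) le))
  absorb {A} (suc k) B le h | yes (e , e∈B) = ℕP.+-cancelʳ-≤ (rk A) _ _ (begin
    rk (A ∪ B) + rk A                    ≤⟨ submod cover (p⊆p∪q (B - e)) (p⊆p∪q ⁅ e ⁆) ⟩
    rk (A ∪ (B - e)) + rk (A ∪ ⁅ e ⁆)    ≤⟨ ℕP.+-mono-≤ ih (ℕP.≤-reflexive (∈cl⁻ {A} (h e∈B))) ⟩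
    rk A + rk A                          ∎)
    where
    ih = absorb {A} k (B - e) (ℕP.≤-pred (ℕP.<-≤-trans (x∈p⇒∣p-x∣<∣p∣ e∈B) le)) (h ∘ p─q⊆p B ⁅ e ⁆)
    cover : A ∪ B ⊆ (A ∪ (B - e)) ∪ (A ∪ ⁅ e ⁆)
    cover = ∪-least (p⊆p∪q (A ∪ ⁅ e ⁆) ∘ p⊆p∪q (B - e)) λ {x} x∈B → case-x x x∈B
      where
      case-x : ∀ x → x ∈ B → x ∈ (A ∪ (B - e)) ∪ (A ∪ ⁅ e ⁆)
      case-x x x∈B with x Fin.≟ e
      ... | yes refl = q⊆p∪q (A ∪ (B - e)) (A ∪ ⁅ e ⁆) (q⊆p∪q A ⁅ e ⁆ (x∈⁅x⁆ e))
      ... | no x≢e = p⊆p∪q (A ∪ ⁅ e ⁆) (q⊆p∪q A (B - e) (x∈p∧x≢y⇒x∈p-y x∈B x≢e))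

  rk-cl≤ : ∀ A → rk (cl A) ≤ rk A
  rk-cl≤ A = ℕP.≤-trans (monotone _ _ (q⊆p∪q A (cl A))) (absorb {A} ∣ cl A ∣ (cl A) ℕP.≤-refl id)

  cl-flat : ∀ A → Flat (cl A)
  cl-flat A e e∉ = begin-strict
    rk (cl A)          ≤⟨ rk-cl≤ A ⟩
    rk A               <⟨ ℕP.≤∧≢⇒< (monotone _ _ (p⊆p∪q ⁅ e ⁆)) (λ eq → e∉ (∈cl⁺ {A} (sym eq))) ⟩
    rk (A ∪ ⁅ e ⁆)     ≤⟨ monotone _ _ (∪-least (p⊆p∪q ⁅ e ⁆ ∘ cl-ext) (q⊆p∪q (cl A) ⁅ e ⁆)) ⟩
    rk (cl A ∪ ⁅ e ⁆)  ∎

  -- An element outside F raises the rank of F strictly; by submodularity it then raises the rank of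
  -- the smaller set A as well, so it is not in cl A.
  cl-least : ∀ {A F} → Flat F → A ⊆ F → cl A ⊆ F
  cl-least {A} {F} fl A⊆F {e} e∈ = decidable-stable (e ∈? F) λ e∉F → ℕP.<-irrefl refl (begin-strict
    rk F + rk A            <⟨ ℕP.+-monoˡ-< (rk A) (fl e e∉F) ⟩
    rk (F ∪ ⁅ e ⁆) + rk A  ≤⟨ submod (∪-least (p⊆p∪q _) (q⊆p∪q F _ ∘ q⊆p∪q A ⁅ e ⁆)) A⊆F (p⊆p∪q ⁅ e ⁆) ⟩
    rk F + rk (A ∪ ⁅ e ⁆)  ≡⟨ cong (rk F +_) (∈cl⁻ {A} e∈) ⟩
    rk F + rk A            ∎)

  flat-rk : ∀ {F H} → Flat F → F ⊆ H → rk H ≤ rk F → H ⊆ F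
  flat-rk {F} {H} fl F⊆H le {e} e∈H = decidable-stable (e ∈? F) λ e∉F → ℕP.<-irrefl refl (begin-strict
    rk F            <⟨ fl e e∉F ⟩
    rk (F ∪ ⁅ e ⁆)  ≤⟨ monotone _ _ (∪-least F⊆H (⁅⁆⊆ e∈H)) ⟩
    rk H            ≤⟨ le ⟩
    rk F            ∎)

  -- Looplessness enters here: `⊥` is a flat, so `flat-rk` applies to it.
  rk≡0 : ∀ {A} → rk A ≤ 0 → A ⊆ ⊥
  rk≡0 {A} le = flat-rk loopless (⊆-min _) (ℕP.≤-trans le z≤n)

  join-upper : ∀ As {A} → A ∈ₗ As → A ⊆ join rk As
  join-upper As h = cl-ext ∘ ⊆⋃ As h

  join-least : ∀ As {F} → Flat F → (∀ {A} → A ∈ₗ As → A ⊆ F) → join rk As ⊆ F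
  join-least As fl h = cl-least fl λ e∈ → let (A , A∈ , e∈A) = ∈⋃⁻ As e∈ in h A∈ e∈A

  join-flat : ∀ As → Flat (join rk As)
  join-flat As = cl-flat (⋃ As)

  rk-join : ∀ As → rk (join rk As) ≤ sum (L.map rk As)
  rk-join As = ℕP.≤-trans (rk-cl≤ (⋃ As)) (go As)
    where
    go : ∀ As → rk (⋃ As) ≤ sum (L.map rk As)
    go [] = ℕP.≤-reflexive rk-∅
    go (A ∷ As) = ℕP.≤-trans (subadd {A} {⋃ As} id) (ℕP.+-monoʳ-≤ (rk A) (go As))

-- Building sets and nested sets

module BuildingSet {n : ℕ} (rk : Subset n → ℕ) (pm : IsPolymatroid rk) (loopless : Loopless rk)
                   (𝒢 : List (Subset n)) (bs : IsBuildingSet rk 𝒢) where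
  open IsPolymatroid pm
  open IsBuildingSet bs
  open Polymatroid rk pm loopless public
  open ≤-Reasoning

  M : ℕ
  M = length 𝒢

  G : Fin M → Subset n
  G = L.lookup 𝒢

  G-flat : ∀ i → Flat (G i)
  G-flat i = flats (G i) (∈-lookup i)

  G-nonempty : ∀ i → Nonempty (G i)
  G-nonempty i = ≢⊥⇒nonempty (nonempty (G i) (∈-lookup i))

  G-inj : ∀ {i j} → G i ≡ G j → i ≡ j
  G-inj = lookup-inj distinct _ _

  ⊆⇒⊏ : ∀ {i j} → i ≢ j → G i ⊆ G j → G i ⊏ G j
  ⊆⇒⊏ ne h = h , ne ∘ G-inj

  ∈𝒢⇒index : ∀ {X} → X ∈ₗ 𝒢 → ∃ λ i → G i ≡ X
  ∈𝒢⇒index h = Any.index h , sym (lookup-index h)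

  maxBelow⁻ : ∀ {F X} → X ∈ₗ maxBelow 𝒢 F → (∃ λ i → G i ≡ X) × X ⊆ F
  maxBelow⁻ {F} {X} h with ∈-filterᵇ⁻ _ h
  ... | X∈ , t = ∈𝒢⇒index X∈ , ⊆ᵇ⁻ {A = X} {F} (proj₁ (T-∧⁻ t))

  maxBelow-cover : ∀ F {i} → G i ⊆ F → ∃ λ X → X ∈ₗ maxBelow 𝒢 F × G i ⊆ X
  maxBelow-cover F {i} h with maximal-above G {λ j → G j ⊆ F} (λ j → G j ⊆? F) i h
  ... | j , Gj⊆F , sub , mx = G j , ∈-filterᵇ⁺ (λ X → (X ⊆ᵇ F) ∧ not (any (λ Y → (X ⊂ᵇ Y) ∧ (Y ⊆ᵇ F)) 𝒢)) (∈-lookup {xs = 𝒢} j) (T-∧⁺ (⊆ᵇ⁺ {A = G j} {F} Gj⊆F) (T-not⁺ nomore)) , sub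
    where
    nomore : ¬ T (any (λ X → (G j ⊂ᵇ X) ∧ (X ⊆ᵇ F)) 𝒢)
    nomore t = let a = any⁻ _ 𝒢 t in mx (Any.index a)
      (⊆ᵇ⁻ {A = G (Any.index a)} {F} (proj₂ (T-∧⁻ {G j ⊂ᵇ G (Any.index a)} (lookup-index a))))
      (⊂ᵇ⁻ {A = G j} {G (Any.index a)} (proj₁ (T-∧⁻ (lookup-index a))))

  -- Surjectivity of the join map at F itself: F is a join of flats lying below the maximal members.
  ⊆join-maxBelow : ∀ {F} → Flat F → F ⊆ join rk (maxBelow 𝒢 F)
  ⊆join-maxBelow {F} fl with join-surj F fl F fl id
  ... | t , ht , eq = subst (_⊆ join rk Ms) eq (join-least (L.tabulate t) (join-flat Ms) below)
    where
    Ms = maxBelow 𝒢 F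
    below : ∀ {A} → A ∈ₗ L.tabulate t → A ⊆ join rk Ms
    below A∈ with ∈-tabulate⁻ A∈
    ... | i , refl = join-upper Ms (∈-lookup i) ∘ proj₂ (ht i)

  -- F is the join of a maximal member G g of 𝒢 below it and of the join F' of the others;
  -- rank additivity makes this decomposition behave like a direct product.
  record Split (F : Subset n) : Set where
    field
      g         : Fin M
      F'        : Subset n
      F'-flat   : Flat F'
      g⊆F       : G g ⊆ F
      F'⊆F      : F' ⊆ F
      covers    : ∀ {l} → G l ⊆ F → G l ⊆ G g ⊎ G l ⊆ F'
      disjoint  : ∀ {e} → e ∈ G g → e ∉ F'
      generates : ∀ {K} → Flat K → G g ⊆ K → F' ⊆ K → F ⊆ K
      tight     : ∀ {A B} → Flat A → Flat B → A ⊆ G g → B ⊆ F' → F ⊆ cl (A ∪ B) →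
                  G g ⊆ A × F' ⊆ B

  -- G g is the first entry of `maxBelow 𝒢 F` and F' the join of the others. Surjectivity of the
  -- join map yields `generates`; additivity of rank yields `disjoint` and `tight`.
  split : ∀ {F} → Flat F → F ≢ ⊥ → Split F
  split {F} fl ne = go (maxBelow 𝒢 F) refl
    where
    go : ∀ Ms → Ms ≡ maxBelow 𝒢 F → Split F
    go [] eq with ≢⊥⇒nonempty ne
    ... | e , e∈F = ⊥-elim (∉⊥ (join-least [] loopless (λ ()) (subst (λ Ms → F ⊆ join rk Ms) (sym eq) (⊆join-maxBelow fl) e∈F)))
    go (X ∷ Xs) eq = record
      { g = g ; F' = F' ; F'-flat = join-flat Xs ; g⊆F = g⊆F ; F'⊆F = F'⊆F ; covers = covers
      ; disjoint = λ {e} e∈g e∈F' → ∉⊥ (rk≡0 {G g ∩ F'} meet≤0 (x∈p∩q⁺ (e∈g , e∈F')))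
      ; generates = generates ; tight = tight }
      where
      Gg = proj₁ (maxBelow⁻ {F} {X} (subst (X ∈ₗ_) eq (here refl)))
      g = proj₁ Gg
      F' = join rk Xs
      toMax : ∀ {Y} → Y ∈ₗ X ∷ Xs → Y ∈ₗ maxBelow 𝒢 F
      toMax {Y} = subst (Y ∈ₗ_) eq
      g⊆F : G g ⊆ F
      g⊆F = subst (_⊆ F) (sym (proj₂ Gg)) (proj₂ (maxBelow⁻ (toMax (here refl))))
      F'⊆F : F' ⊆ F
      F'⊆F = join-least Xs fl λ A∈ → proj₂ (maxBelow⁻ (toMax (there A∈)))
      covers : ∀ {l} → G l ⊆ F → G l ⊆ G g ⊎ G l ⊆ F'
      covers {l} h with maxBelow-cover F {l} h
      ... | Y , Y∈ , sub with subst (Y ∈ₗ_) (sym eq) Y∈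
      ... | here refl = inj₁ (subst (G l ⊆_) (sym (proj₂ Gg)) sub)
      ... | there Y∈' = inj₂ (join-upper Xs Y∈' ∘ sub)
      generates : ∀ {K} → Flat K → G g ⊆ K → F' ⊆ K → F ⊆ K
      generates {K} flK g⊆K F'⊆K = join-least (X ∷ Xs) flK below ∘ subst (λ Ms → F ⊆ join rk Ms) (sym eq) (⊆join-maxBelow fl)
        where
        below : ∀ {A} → A ∈ₗ X ∷ Xs → A ⊆ K
        below (here refl) = subst (_⊆ K) (proj₂ Gg) g⊆K
        below (there A∈) = F'⊆K ∘ join-upper Xs A∈
      s = sum (L.map rk Xs)
      rkF : rk F ≡ rk (G g) + s
      rkF = trans (rank-sum F fl) (trans (cong (sum ∘ L.map rk) (sym eq)) (cong (λ Y → rk Y + s) (sym (proj₂ Gg))))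
      -- The union of the two parts has at least the rank of F, and additivity leaves nothing over
      -- for the intersection.
      meet≤0 : rk (G g ∩ F') ≤ 0
      meet≤0 = ℕP.+-cancelˡ-≤ (rk F) _ _ (begin
        rk F + rk (G g ∩ F')         ≤⟨ ℕP.+-monoˡ-≤ _ (ℕP.≤-trans (monotone _ _ F⊆cl) (rk-cl≤ (G g ∪ F'))) ⟩
        rk (G g ∪ F') + rk (G g ∩ F') ≤⟨ submodular (G g) F' ⟩
        rk (G g) + rk F'             ≤⟨ ℕP.+-monoʳ-≤ _ (rk-join Xs) ⟩
        rk (G g) + s                 ≡⟨ rkF ⟨
        rk F                         ≡⟨ ℕP.+-identityʳ _ ⟨
        rk F + 0                     ∎)
        where
        F⊆cl : F ⊆ cl (G g ∪ F')
        F⊆cl = generates (cl-flat _) (cl-ext ∘ p⊆p∪q F') (cl-ext ∘ q⊆p∪q (G g) F')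
      -- The ranks of A and B are at most rk (G g) and s and add up to at least rk F, so both bounds
      -- are attained and `flat-rk` applies.
      tight : ∀ {A B} → Flat A → Flat B → A ⊆ G g → B ⊆ F' → F ⊆ cl (A ∪ B) → G g ⊆ A × F' ⊆ B
      tight {A} {B} flA flB A⊆ B⊆ F⊆ =
        flat-rk flA A⊆ (ℕP.+-cancelʳ-≤ s _ _ (ℕP.≤-trans bound (ℕP.+-monoʳ-≤ (rk A) rkB≤s))) ,
        flat-rk flB B⊆ (ℕP.≤-trans (rk-join Xs)
          (ℕP.+-cancelˡ-≤ (rk (G g)) _ _ (ℕP.≤-trans bound (ℕP.+-monoˡ-≤ (rk B) (monotone _ _ A⊆)))))
        where
        rkB≤s : rk B ≤ s
        rkB≤s = ℕP.≤-trans (monotone _ _ B⊆) (rk-join Xs)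
        bound : rk (G g) + s ≤ rk A + rk B
        bound = begin
          rk (G g) + s   ≡⟨ rkF ⟨
          rk F           ≤⟨ monotone _ _ F⊆ ⟩
          rk (cl (A ∪ B)) ≤⟨ rk-cl≤ (A ∪ B) ⟩
          rk (A ∪ B)     ≤⟨ subadd {A} {B} id ⟩
          rk A + rk B    ∎

  -- Split the join F. Each of G i and G j lies in one of the two disjoint parts, and the common
  -- element puts both into the same one, which then contains F. It cannot be F', since G g is
  -- nonempty and disjoint from F'; so F is G g.
  overlapping-join : ∀ i j {e} → e ∈ G i → e ∈ G j → ∃ λ l → G l ≡ cl (G i ∪ G j)
  overlapping-join i j {e} e∈i e∈j with any? (λ l → G l ≟ₛ cl (G i ∪ G j))
  ... | yes p = p
  ... | no ¬p = ⊥-elim (absurd (covers i⊆F) (covers j⊆F))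
    where
    F = cl (G i ∪ G j)
    i⊆F : G i ⊆ F
    i⊆F = cl-ext ∘ p⊆p∪q (G j)
    j⊆F : G j ⊆ F
    j⊆F = cl-ext ∘ q⊆p∪q (G i) (G j)
    open Split (split (cl-flat (G i ∪ G j)) (λ eq → ∉⊥ (subst (e ∈_) eq (i⊆F e∈i))))
    absurd : G i ⊆ G g ⊎ G i ⊆ F' → G j ⊆ G g ⊎ G j ⊆ F' → Absurd
    absurd (inj₁ a) (inj₁ b) = ¬p (g , ⊆-antisym g⊆F (cl-least (G-flat g) (∪-least a b)))
    absurd (inj₁ a) (inj₂ b) = disjoint (a e∈i) (b e∈j)
    absurd (inj₂ a) (inj₁ b) = disjoint (b e∈j) (a e∈i)
    absurd (inj₂ a) (inj₂ b) with G-nonempty g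
    ... | x , x∈g = disjoint x∈g (cl-least F'-flat (∪-least a b) (g⊆F x∈g))

  -- Suprema and nested sets.

  sup : Subset M → Fin M → Subset n
  sup S j = supS rk 𝒢 S (G j)

  ⋁ : Subset M → Subset n
  ⋁ S = join rk (elems rk 𝒢 S)

  elems⁺ : ∀ {S i} → i ∈ S → G i ∈ₗ elems rk 𝒢 S
  elems⁺ {S} {i} h = ∈-map⁺ G (∈-filterᵇ⁺ (λ i → elemᵇ i S) (∈-allFin i) (elem⁺ h))

  elems⁻ : ∀ {S X} → X ∈ₗ elems rk 𝒢 S → ∃ λ i → i ∈ S × X ≡ G i
  elems⁻ {S} h with ∈-map⁻ G h
  ... | i , i∈ , eq = i , elem⁻ (proj₂ (∈-filterᵇ⁻ (λ k → elemᵇ k S) {allFin M} i∈)) , eq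

  ⋁-upper : ∀ {S i} → i ∈ S → G i ⊆ ⋁ S
  ⋁-upper {S} h = join-upper (elems rk 𝒢 S) (elems⁺ h)

  ⋁-least : ∀ {S F} → Flat F → (∀ i → i ∈ S → G i ⊆ F) → ⋁ S ⊆ F
  ⋁-least {S} {F} fl h = join-least (elems rk 𝒢 S) fl below
    where
    below : ∀ {A} → A ∈ₗ elems rk 𝒢 S → A ⊆ F
    below A∈ with elems⁻ {S} A∈
    ... | i , i∈ , refl = h i i∈

  ⋁-flat : ∀ S → Flat (⋁ S)
  ⋁-flat S = join-flat (elems rk 𝒢 S)

  sup-upper : ∀ {S i j} → i ∈ S → G i ⊏ G j → G i ⊆ sup S j
  sup-upper {S} {i} {j} h lt = join-upper (filterᵇ (_⊂ᵇ G j) (elems rk 𝒢 S)) (∈-filterᵇ⁺ _ (elems⁺ h) (⊂ᵇ⁺ {A = G i} {G j} lt))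

  sup-least : ∀ {S j F} → Flat F → (∀ i → i ∈ S → G i ⊏ G j → G i ⊆ F) → sup S j ⊆ F
  sup-least {S} {j} {F} fl h = join-least (filterᵇ (_⊂ᵇ G j) (elems rk 𝒢 S)) fl below
    where
    below : ∀ {A} → A ∈ₗ filterᵇ (_⊂ᵇ G j) (elems rk 𝒢 S) → A ⊆ F
    below {A} A∈ with ∈-filterᵇ⁻ (_⊂ᵇ G j) A∈
    ... | A∈' , t with elems⁻ {S} A∈'
    ... | i , i∈ , refl = h i i∈ (⊂ᵇ⁻ {A = G i} {G j} t)

  sup-flat : ∀ S j → Flat (sup S j)
  sup-flat S j = join-flat (filterᵇ (_⊂ᵇ G j) (elems rk 𝒢 S))

  sup⊆ : ∀ {S j} → sup S j ⊆ G j
  sup⊆ {S} {j} = sup-least {S} {j} (G-flat j) λ _ _ → proj₁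

  -- Nestedness through `sup`, tested at every member of 𝒢 whether or not it is in S. It says that
  -- all differences rk (G j) - rk (sup S j) are positive, which is how it meets the standard
  -- monomials. The next lemmas show that it is equivalent to `isNested`.
  Nest : Subset M → Set
  Nest S = ∀ j → ¬ (G j ⊆ sup S j)

  nest? : ∀ S → Dec (Nest S)
  nest? S = FinP.all? λ j → ¬? (G j ⊆? sup S j)

  incomp⁺ : ∀ {T'} → (∀ {i j} → i ∈ T' → j ∈ T' → i ≢ j → ¬ (G i ⊆ G j)) → T (pairwiseIncomp rk 𝒢 T')
  incomp⁺ {T'} h = all-intro _ (allFin M) λ i _ → all-intro _ (allFin M) λ j _ → T-imp⁺ λ t →
    let (a , b) = T-∧⁻ {elemᵇ i T'} t ; (b , c) = T-∧⁻ {elemᵇ j T'} b in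
    T-not⁺ λ s → h (elem⁻ a) (elem⁻ b) (λ e → T-not⁻ c (fromWitness {a? = i Fin.≟ j} e)) (⊆ᵇ⁻ {A = G i} {G j} s)

  incomp⁻ : ∀ {T'} → T (pairwiseIncomp rk 𝒢 T') → ∀ {i j} → i ∈ T' → j ∈ T' → i ≢ j → ¬ (G i ⊆ G j)
  incomp⁻ {T'} t {i} {j} i∈ j∈ ne s =
    T-not⁻ (T-imp⁻ (all-elim _ _ (all-elim _ _ t (∈-allFin i)) (∈-allFin j))
      (T-∧⁺ (elem⁺ i∈) (T-∧⁺ (elem⁺ j∈) (T-not⁺ λ w → ne (toWitness {a? = i Fin.≟ j} w)))))
      (⊆ᵇ⁺ {A = G i} {G j} s)

  member⁺ : ∀ j → T (memberᵇ (G j) 𝒢)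
  member⁺ j = any⁺ _ (Any.map (λ { refl → ==⁺ {A = G j} refl }) (∈-lookup {xs = 𝒢} j))

  member⁻ : ∀ {X} → T (memberᵇ X 𝒢) → ∃ λ j → G j ≡ X
  member⁻ {X} t = let a = any⁻ _ 𝒢 t in Any.index a , sym (==⁻ {A = X} {G (Any.index a)} (lookup-index a))

  -- Suppose G j ⊆ sup S j. The maximal elements of S strictly below G j form an antichain A with
  -- join G j. Two or more of them contradict nestedness, a single one would equal G j, and none at
  -- all would make G j empty.
  isNested⇒Nest : ∀ S → T (isNested rk 𝒢 S) → Nest S
  isNested⇒Nest S t j Gj⊆sup = finish
    where
    Below : Fin M → Set
    Below i = i ∈ S × G i ⊏ G j
    below? : ∀ i → Dec (Below i)
    below? i = (i ∈? S) ×-dec (G i ⊏? G j)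
    Top : Fin M → Set
    Top i = Below i × (∀ h → Below h → ¬ (G i ⊏ G h))
    top? : ∀ i → Dec (Top i)
    top? i = below? i ×-dec FinP.all? λ h → below? h →-dec ¬? (G i ⊏? G h)
    A : Subset M
    A = V.tabulate (λ i → ⌊ top? i ⌋)
    A⁺ : ∀ {i} → Top i → i ∈ A
    A⁺ {i} p = ∈-tabulateᵇ⁺ _ (fromWitness {a? = top? i} p)
    A⁻ : ∀ {i} → i ∈ A → Top i
    A⁻ {i} p = toWitness {a? = top? i} (∈-tabulateᵇ⁻ (λ i → ⌊ top? i ⌋) p)
    above : ∀ i → Below i → ∃ λ k → Top k × G i ⊆ G k
    above i b with maximal-above G below? i b
    ... | k , bk , sub , mx = k , (bk , mx) , sub
    join≡ : ⋁ A ≡ G j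
    join≡ = ⊆-antisym (⋁-least {A} (G-flat j) λ i i∈ → proj₁ (proj₂ (proj₁ (A⁻ i∈))))
      (sup-least {S} {j} (⋁-flat A) (λ i i∈ lt → let (k , tk , sub) = above i (i∈ , lt) in ⋁-upper {A} (A⁺ tk) ∘ sub) ∘ Gj⊆sup)
    incA : ∀ {i k} → i ∈ A → k ∈ A → i ≢ k → ¬ (G i ⊆ G k)
    incA i∈ k∈ ne sub = proj₂ (A⁻ i∈) _ (proj₁ (A⁻ k∈)) (⊆⇒⊏ ne sub)
    bad : T (2 ≤ᵇ ∣ A ∣) → Absurd
    bad two = T-not⁻ (T-imp⁻ (all-elim _ _ t (allSubsets-complete A))
        (T-∧⁺ (⊆ᵇ⁺ {A = A} {S} (proj₁ ∘ proj₁ ∘ A⁻)) (T-∧⁺ two (incomp⁺ {A} incA))))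
      (subst (λ X → T (memberᵇ X 𝒢)) (sym join≡) (member⁺ j))
    big : ∀ {k h} → k ∈ A → h ∈ A → h ≢ k → T (2 ≤ᵇ ∣ A ∣)
    big {k} {h} k∈ h∈ ne = ℕP.≤⇒≤ᵇ (subst (_< ∣ A ∣) (∣⁅x⁆∣≡1 k)
      (p⊂q⇒∣p∣<∣q∣ (⁅⁆⊆ k∈ , h , h∈ , λ h∈k → ne (x∈⁅y⁆⇒x≡y k h∈k))))
    finish : Absurd
    finish with any? below?
    ... | no ¬b with G-nonempty j
    ... | e , e∈ = ∉⊥ (sup-least {S} {j} loopless (λ i i∈ lt → ⊥-elim (¬b (i , i∈ , lt))) (Gj⊆sup e∈))
    finish | yes (i , bi) with above i bi
    ... | k , tk , _ with any? (λ h → top? h ×-dec ¬? (h Fin.≟ k))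
    ... | yes (h , th , ne) = bad (big (A⁺ tk) (A⁺ th) ne)
    ... | no ¬h = proj₂ (proj₂ (proj₁ tk)) (⊆-antisym (proj₁ (proj₂ (proj₁ tk)))
      (sup-least {S} {j} (G-flat k) (λ i i∈ lt → let (h , th , sub) = above i (i∈ , lt) in
        subst (λ z → G i ⊆ G z) (decidable-stable (h Fin.≟ k) (λ ne → ¬h (h , th , ne))) sub) ∘ Gj⊆sup))

  -- Let an antichain with at least two elements have join G j. None of them equals G j, since it
  -- would contain the others, so all lie strictly below G j and G j ⊆ sup S j.
  Nest⇒isNested : ∀ S → Nest S → T (isNested rk 𝒢 S)
  Nest⇒isNested S nest = all-intro _ (allSubsets M) λ A _ → T-imp⁺ λ t →
    let (A⊆S , t) = T-∧⁻ {A ⊆ᵇ S} t ; (two , inc) = T-∧⁻ {2 ≤ᵇ ∣ A ∣} t in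
    T-not⁺ λ mem → absurd A (⊆ᵇ⁻ {A = A} {S} A⊆S) (ℕP.≤ᵇ⇒≤ 2 _ two) (incomp⁻ {A} inc) (member⁻ mem)
    where
    absurd : ∀ A → A ⊆ S → 2 ≤ ∣ A ∣ → (∀ {i k} → i ∈ A → k ∈ A → i ≢ k → ¬ (G i ⊆ G k)) →
             (∃ λ j → G j ≡ ⋁ A) → Absurd
    absurd A A⊆S two inc (j , eq) = nest j λ e → ⋁-least {A} (sup-flat S j) (λ i i∈ → sup-upper {S} (A⊆S i∈) (proper i i∈)) (subst (_ ∈_) eq e)
      where
      other : ∀ i → i ∈ A → ∃ λ k → k ∈ A × k ≢ i
      other i i∈ with any? (λ k → (k ∈? A) ×-dec ¬? (k Fin.≟ i))
      ... | yes p = p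
      ... | no ¬p = ⊥-elim (ℕP.<⇒≱ two (ℕP.≤-trans (p⊆q⇒∣p∣≤∣q∣ {p = A} {q = ⁅ i ⁆} λ {k} k∈ →
          subst (_∈ ⁅ i ⁆) (sym (decidable-stable (k Fin.≟ i) λ ne → ¬p (k , k∈ , ne))) (x∈⁅x⁆ i))
        (ℕP.≤-reflexive (∣⁅x⁆∣≡1 i))))
      le : ∀ i → i ∈ A → G i ⊆ G j
      le i i∈ = subst (G i ⊆_) (sym eq) (⋁-upper {A} i∈)
      proper : ∀ i → i ∈ A → G i ⊏ G j
      proper i i∈ = le i i∈ , λ e → let (k , k∈ , ne) = other i i∈ in
        inc k∈ i∈ ne (subst (G k ⊆_) (sym e) (le k k∈))

-- Monomials

infixl 6 _⊞_

_⊞_ : ∀ {m} → Vec ℕ m → Vec ℕ m → Vec ℕ m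
_⊞_ = V.zipWith _+_

𝟎 : ∀ {m} → Vec ℕ m
𝟎 {m} = V.replicate m 0

unit : ∀ {m} → Fin m → ℕ → Vec ℕ m
unit h c = 𝟎 V.[ h ]≔ c

drop : ∀ {m} → Fin m → Vec ℕ m → Vec ℕ m
drop j ν = ν V.[ j ]≔ 0

vec-ext : ∀ {A : Set} {m} {a b : Vec A m} → (∀ i → V.lookup a i ≡ V.lookup b i) → a ≡ b
vec-ext {a = a} {b} h = trans (sym (VP.tabulate∘lookup a)) (trans (VP.tabulate-cong h) (VP.tabulate∘lookup b))

lookup-⊞ : ∀ {m} (a b : Vec ℕ m) i → V.lookup (a ⊞ b) i ≡ V.lookup a i + V.lookup b i
lookup-⊞ a b i = VP.lookup-zipWith _+_ i a b

lookup-unit-≡ : ∀ {m} (h : Fin m) c → V.lookup (unit h c) h ≡ c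
lookup-unit-≡ h c = VP.lookup∘update h 𝟎 c

lookup-unit-≢ : ∀ {m} {h i : Fin m} c → i ≢ h → V.lookup (unit h c) i ≡ 0
lookup-unit-≢ {h = h} {i} c ne = trans (VP.lookup∘update′ ne 𝟎 c) (VP.lookup-replicate i 0)

lookup-drop-≡ : ∀ {m} (j : Fin m) ν → V.lookup (drop j ν) j ≡ 0
lookup-drop-≡ j ν = VP.lookup∘update j ν 0

lookup-drop-≢ : ∀ {m} {i j : Fin m} ν → i ≢ j → V.lookup (drop j ν) i ≡ V.lookup ν i
lookup-drop-≢ ν ne = VP.lookup∘update′ ne ν 0

⊞-assoc : ∀ {m} (a b c : Vec ℕ m) → (a ⊞ b) ⊞ c ≡ a ⊞ (b ⊞ c)
⊞-assoc = VP.zipWith-assoc ℕP.+-assoc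

⊞-comm : ∀ {m} (a b : Vec ℕ m) → a ⊞ b ≡ b ⊞ a
⊞-comm = VP.zipWith-comm ℕP.+-comm

⊞-identityʳ : ∀ {m} (a : Vec ℕ m) → a ⊞ 𝟎 ≡ a
⊞-identityʳ = VP.zipWith-identityʳ ℕP.+-identityʳ

⊞-identityˡ : ∀ {m} (a : Vec ℕ m) → 𝟎 ⊞ a ≡ a
⊞-identityˡ = VP.zipWith-identityˡ ℕP.+-identityˡ

⊞-swap : ∀ {m} (a b c : Vec ℕ m) → (a ⊞ b) ⊞ c ≡ (a ⊞ c) ⊞ b
⊞-swap a b c = trans (⊞-assoc a b c) (trans (cong (a ⊞_) (⊞-comm b c)) (sym (⊞-assoc a c b)))

unit-+ : ∀ {m} (h : Fin m) a b → unit h a ⊞ unit h b ≡ unit h (a + b)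
unit-+ h a b = vec-ext λ i → trans (lookup-⊞ (unit h a) (unit h b) i) (go i)
  where
  go : ∀ i → V.lookup (unit h a) i + V.lookup (unit h b) i ≡ V.lookup (unit h (a + b)) i
  go i with i Fin.≟ h
  ... | yes refl = trans (cong₂ _+_ (lookup-unit-≡ h a) (lookup-unit-≡ h b)) (sym (lookup-unit-≡ h (a + b)))
  ... | no ne = trans (cong₂ _+_ (lookup-unit-≢ a ne) (lookup-unit-≢ b ne)) (sym (lookup-unit-≢ (a + b) ne))

unit-0 : ∀ {m} (h : Fin m) → unit h 0 ≡ 𝟎
unit-0 h = trans (cong (𝟎 V.[ h ]≔_) (sym (VP.lookup-replicate h 0))) (VP.[]≔-lookup 𝟎 h)

drop-⊞-unit : ∀ {m} (j : Fin m) ν → drop j ν ⊞ unit j (V.lookup ν j) ≡ ν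
drop-⊞-unit j ν = vec-ext λ i → trans (lookup-⊞ (drop j ν) _ i) (go i)
  where
  go : ∀ i → V.lookup (drop j ν) i + V.lookup (unit j (V.lookup ν j)) i ≡ V.lookup ν i
  go i with i Fin.≟ j
  ... | yes refl = cong₂ _+_ (lookup-drop-≡ j ν) (lookup-unit-≡ j _)
  ... | no ne = trans (cong₂ _+_ (lookup-drop-≢ ν ne) (lookup-unit-≢ _ ne)) (ℕP.+-identityʳ _)

drop-unit : ∀ {m} (j : Fin m) ν c → drop j (ν ⊞ unit j c) ≡ drop j ν
drop-unit j ν c = vec-ext go
  where
  go : ∀ i → V.lookup (drop j (ν ⊞ unit j c)) i ≡ V.lookup (drop j ν) i
  go i with i Fin.≟ j
  ... | yes refl = trans (lookup-drop-≡ j (ν ⊞ unit j c)) (sym (lookup-drop-≡ j ν))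
  ... | no ne = trans (lookup-drop-≢ (ν ⊞ unit j c) ne) (trans (lookup-⊞ ν (unit j c) i)
    (trans (cong (V.lookup ν i +_) (lookup-unit-≢ c ne)) (trans (ℕP.+-identityʳ _) (sym (lookup-drop-≢ ν ne)))))

drop-drop : ∀ {m} {j k : Fin m} ν → j ≢ k → drop k (drop j ν) ≡ drop j (drop k ν)
drop-drop {j = j} {k} ν ne = VP.[]≔-commutes ν j k ne

wsum : ∀ {m} → (Fin m → ℕ) → Vec ℕ m → ℕ
wsum w [] = 0
wsum w (x ∷ ν) = x * w zero + wsum (w ∘ suc) ν

wsum-⊞ : ∀ {m} (w : Fin m → ℕ) a b → wsum w (a ⊞ b) ≡ wsum w a + wsum w b
wsum-⊞ w [] [] = refl
wsum-⊞ w (x ∷ a) (y ∷ b) rewrite wsum-⊞ (w ∘ suc) a b = lemma x y (w zero) (wsum (w ∘ suc) a) (wsum (w ∘ suc) b)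
  where
  lemma : ∀ x y w s t → (x + y) * w + (s + t) ≡ x * w + s + (y * w + t)
  lemma = solve-∀

wsum-𝟎 : ∀ {m} (w : Fin m → ℕ) → wsum w 𝟎 ≡ 0
wsum-𝟎 {zero} w = refl
wsum-𝟎 {suc m} w = wsum-𝟎 (w ∘ suc)

wsum-unit : ∀ {m} (w : Fin m → ℕ) h c → wsum w (unit h c) ≡ c * w h
wsum-unit w zero c = trans (cong (c * w zero +_) (wsum-𝟎 (w ∘ suc))) (ℕP.+-identityʳ _)
wsum-unit w (suc h) c = wsum-unit (w ∘ suc) h c

sum≡wsum : ∀ {m} (ν : Vec ℕ m) → V.sum ν ≡ wsum (λ _ → 1) ν
sum≡wsum [] = refl
sum≡wsum (x ∷ ν) = cong₂ _+_ (sym (ℕP.*-identityʳ x)) (sum≡wsum ν)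

sum-⊞ : ∀ {m} (a b : Vec ℕ m) → V.sum (a ⊞ b) ≡ V.sum a + V.sum b
sum-⊞ a b rewrite sum≡wsum (a ⊞ b) | sum≡wsum a | sum≡wsum b = wsum-⊞ _ a b

sum-unit : ∀ {m} (h : Fin m) c → V.sum (unit h c) ≡ c
sum-unit h c = trans (sum≡wsum (unit h c)) (trans (wsum-unit _ h c) (ℕP.*-identityʳ c))

supp : ∀ {m} → Vec ℕ m → Subset m
supp ν = V.tabulate (λ i → 0 <ᵇ V.lookup ν i)

supp⁺ : ∀ {m} (ν : Vec ℕ m) {i} → 0 < V.lookup ν i → i ∈ supp ν
supp⁺ ν h = ∈-tabulateᵇ⁺ (λ i → 0 <ᵇ V.lookup ν i) (ℕP.<⇒<ᵇ h)

supp⁻ : ∀ {m} (ν : Vec ℕ m) {i} → i ∈ supp ν → 0 < V.lookup ν i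
supp⁻ ν h = ℕP.<ᵇ⇒< _ _ (∈-tabulateᵇ⁻ (λ i → 0 <ᵇ V.lookup ν i) h)

supp-⊞ˡ : ∀ {m} (a b : Vec ℕ m) {i} → i ∈ supp a → i ∈ supp (a ⊞ b)
supp-⊞ˡ a b {i} h = supp⁺ (a ⊞ b) (subst (0 <_) (sym (lookup-⊞ a b i)) (ℕP.<-≤-trans (supp⁻ a h) (ℕP.m≤m+n _ _)))

supp-⊞ʳ : ∀ {m} (a b : Vec ℕ m) {i} → i ∈ supp b → i ∈ supp (a ⊞ b)
supp-⊞ʳ a b {i} h = subst (λ z → i ∈ supp z) (⊞-comm b a) (supp-⊞ˡ b a h)

supp-⊞⁻ : ∀ {m} (a b : Vec ℕ m) {i} → i ∈ supp (a ⊞ b) → i ∈ supp a ⊎ i ∈ supp b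
supp-⊞⁻ a b {i} h with V.lookup a i in eq | subst (0 <_) (lookup-⊞ a b i) (supp⁻ (a ⊞ b) h)
... | zero | p = inj₂ (supp⁺ b p)
... | suc x | _ = inj₁ (supp⁺ a (subst (0 <_) (sym eq) (s≤s z≤n)))

supp-unit⁺ : ∀ {m} (h : Fin m) {c} → 0 < c → h ∈ supp (unit h c)
supp-unit⁺ h {c} p = supp⁺ (unit h c) (subst (0 <_) (sym (lookup-unit-≡ h c)) p)

supp-unit⁻ : ∀ {m} (h : Fin m) c {i} → i ∈ supp (unit h c) → i ≡ h × 0 < c
supp-unit⁻ h c {i} p with i Fin.≟ h
... | yes refl = refl , subst (0 <_) (lookup-unit-≡ h c) (supp⁻ (unit h c) p)
... | no ne = ⊥-elim (ℕP.<-irrefl refl (subst (0 <_) (lookup-unit-≢ c ne) (supp⁻ (unit h c) p)))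

-- The sums y j of the variables x h with G j ⊆ G h act on functions of monomials by
-- f ↦ (ν ↦ Σ f (x h · ν)); Y j e is the e-th power.
module Shifts {n : ℕ} {m : ℕ} (G : Fin m → Subset n) (G-inj : ∀ {i j} → G i ≡ G j → i ≡ j) where

  wt : Fin m → ℕ
  wt h = n ∸ ∣ G h ∣

  W : Vec ℕ m → ℕ
  W = wsum wt

  W-⊞ : ∀ a b → W (a ⊞ b) ≡ W a + W b
  W-⊞ = wsum-⊞ wt

  W-unit : ∀ h c → W (unit h c) ≡ c * wt h
  W-unit = wsum-unit wt

  W-unit₁ : ∀ h → W (unit h 1) ≡ wt h
  W-unit₁ h = trans (W-unit h 1) (ℕP.*-identityˡ _)

  W-drop : ∀ j ν → W (drop j ν) + V.lookup ν j * wt j ≡ W ν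
  W-drop j ν = trans (cong (W (drop j ν) +_) (sym (W-unit j (V.lookup ν j)))) (trans (sym (W-⊞ (drop j ν) _)) (cong W (drop-⊞-unit j ν)))

  wt-≤ : ∀ {j h} → G j ⊆ G h → wt h ≤ wt j
  wt-≤ {j} {h} s = ℕP.∸-monoʳ-≤ n (p⊆q⇒∣p∣≤∣q∣ s)

  wt-< : ∀ {j h} → G j ⊏ G h → wt h < wt j
  wt-< {j} {h} lt = ℕP.∸-monoʳ-< {n} (⊏⇒∣<∣ lt) (∣p∣≤n (G h))

  -- The value monoid stays open. With values in ℚ, `Y j e f ν` is the value of the functional f on
  -- x^ν y_j^e; with values in polynomials modulo the ideal and f the inclusion of monomials, it is
  -- that product itself.
  module Values {c ℓ} (V : CommutativeMonoid c ℓ) where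
    open MonoidSum V

    Y : Fin m → ℕ → (Vec ℕ m → Carrier) → Vec ℕ m → Carrier
    Y j zero f ν = f ν
    Y j (suc e) f ν = Σ (allFin m) (λ h → (G j ⊆? G h) ▹ Y j e f (ν ⊞ unit h 1))

    private
      step : ∀ {j h e} (ν τ : Vec ℕ m) → G j ⊆ G h → V.sum τ ≡ e → W τ ≤ e * wt j →
             V.sum (unit h 1 ⊞ τ) ≡ suc e × W (unit h 1 ⊞ τ) ≤ suc e * wt j
      step {j} {h} ν τ s d le =
        trans (sum-⊞ (unit h 1) τ) (cong₂ _+_ (sum-unit h 1) d) ,
        ℕP.≤-trans (ℕP.≤-reflexive (trans (W-⊞ (unit h 1) τ) (cong (_+ W τ) (W-unit₁ h)))) (ℕP.+-mono-≤ (wt-≤ s) le)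

    -- Expanding y_j^e produces only monomials τ of degree e and weight at most e * wt j, so f and g
    -- need to agree only on these multiples of ν.
    Y-cong-≤ : ∀ j e {f g} ν → (∀ τ → V.sum τ ≡ e → W τ ≤ e * wt j → f (ν ⊞ τ) ≈ g (ν ⊞ τ)) → Y j e f ν ≈ Y j e g ν
    Y-cong-≤ j zero {f} {g} ν h = subst (λ z → f z ≈ g z) (⊞-identityʳ ν)
      (h 𝟎 (trans (sum≡wsum {m} 𝟎) (wsum-𝟎 {m} (λ _ → 1))) (ℕP.≤-reflexive (wsum-𝟎 wt)))
    Y-cong-≤ j (suc e) {f} {g} ν h = Σ-cong (allFin m) λ i → ▹-congʳ (G j ⊆? G i) λ s →
      Y-cong-≤ j e (ν ⊞ unit i 1) λ τ d le → let (d' , le') = step {e = e} ν τ s d le in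
        subst (λ z → f z ≈ g z) (sym (⊞-assoc ν (unit i 1) τ)) (h (unit i 1 ⊞ τ) d' le')

    Y-cong : ∀ j e {f g} ν → (∀ τ → f τ ≈ g τ) → Y j e f ν ≈ Y j e g ν
    Y-cong j e ν h = Y-cong-≤ j e ν λ τ _ _ → h (ν ⊞ τ)

    Y-const-ε : ∀ j e ν → Y j e (λ _ → ε) ν ≈ ε
    Y-const-ε j zero ν = ≈-refl
    Y-const-ε j (suc e) ν = Σ-ε (allFin m) λ h _ → ▹-ε (G j ⊆? G h) λ _ → Y-const-ε j e _

    Y-zero : ∀ j e {f} ν → (∀ τ → V.sum τ ≡ e → W τ ≤ e * wt j → f (ν ⊞ τ) ≈ ε) → Y j e f ν ≈ ε
    Y-zero j e ν h = ≈-trans (Y-cong-≤ j e ν h) (Y-const-ε j e ν)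

    -- x_j is the only variable of y_j of weight wt j and all others are strictly lighter, so x_j^e
    -- is the only term of full weight in y_j^e.
    Y-lead : ∀ j e {f} ν → (∀ τ → V.sum τ ≡ e → W τ < e * wt j → f (ν ⊞ τ) ≈ ε) →
             Y j e f ν ≈ f (ν ⊞ unit j e)
    Y-lead j zero {f} ν h = ≈-reflexive (cong f (sym (trans (cong (ν ⊞_) (unit-0 j)) (⊞-identityʳ ν))))
    Y-lead j (suc e) {f} ν h = ≈-trans (Σ-single (allFin m) j (UniqueP.allFin⁺ m) (∈-allFin j) others)
      (≈-trans (▹-yes (G j ⊆? G j) id)
      (≈-trans (Y-lead j e (ν ⊞ unit j 1) λ τ d lt →
          subst (λ z → f z ≈ ε) (sym (⊞-assoc ν (unit j 1) τ))
            (h (unit j 1 ⊞ τ) (trans (sum-⊞ (unit j 1) τ) (cong₂ _+_ (sum-unit j 1) d))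
              (ℕP.≤-<-trans (ℕP.≤-reflexive (trans (W-⊞ (unit j 1) τ) (cong (_+ W τ) (W-unit₁ j)))) (ℕP.+-monoʳ-< (wt j) lt))))
        (≈-reflexive (cong f (trans (⊞-assoc ν _ _) (cong (ν ⊞_) (unit-+ j 1 e)))))))
      where
      others : ∀ i → i ≢ j → (G j ⊆? G i) ▹ Y j e f (ν ⊞ unit i 1) ≈ ε
      others i ne = ▹-ε (G j ⊆? G i) λ s → Y-zero j e (ν ⊞ unit i 1) λ τ d le →
        subst (λ z → f z ≈ ε) (sym (⊞-assoc ν (unit i 1) τ))
          (h (unit i 1 ⊞ τ) (trans (sum-⊞ (unit i 1) τ) (cong₂ _+_ (sum-unit i 1) d))
            (ℕP.≤-<-trans (ℕP.≤-reflexive (trans (W-⊞ (unit i 1) τ) (cong (_+ W τ) (W-unit₁ i))))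
              (ℕP.+-mono-<-≤ (wt-< (s , λ e → ne (sym (G-inj e)))) le)))

    Y₁-Y : ∀ l j e f ν → Σ (allFin m) (λ h → (G l ⊆? G h) ▹ Y j e f (ν ⊞ unit h 1)) ≈ Y j e (Y l 1 f) ν
    Y₁-Y l j zero f ν = ≈-refl
    Y₁-Y l j (suc e) f ν = begin
      Σ (allFin m) (λ h → (G l ⊆? G h) ▹ Σ (allFin m) (λ i → (G j ⊆? G i) ▹ Y j e f (ν ⊞ unit h 1 ⊞ unit i 1)))
        ≈⟨ Σ-cong (allFin m) (λ h → Σ-▹ (G l ⊆? G h) (allFin m)) ⟩
      Σ (allFin m) (λ h → Σ (allFin m) (λ i → (G l ⊆? G h) ▹ ((G j ⊆? G i) ▹ Y j e f (ν ⊞ unit h 1 ⊞ unit i 1))))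
        ≈⟨ Σ-swap (allFin m) (allFin m) ⟩
      Σ (allFin m) (λ i → Σ (allFin m) (λ h → (G l ⊆? G h) ▹ ((G j ⊆? G i) ▹ Y j e f (ν ⊞ unit h 1 ⊞ unit i 1))))
        ≈⟨ Σ-cong (allFin m) (λ i → ≈-trans (Σ-cong (allFin m) (λ h → ≈-trans (▹-swap (G l ⊆? G h) (G j ⊆? G i))
             (▹-congʳ (G j ⊆? G i) λ _ → ▹-congʳ (G l ⊆? G h) λ _ → ≈-reflexive (cong (Y j e f) (⊞-swap ν (unit h 1) (unit i 1))))))
             (≈-sym (Σ-▹ (G j ⊆? G i) (allFin m)))) ⟩
      Σ (allFin m) (λ i → (G j ⊆? G i) ▹ Σ (allFin m) (λ h → (G l ⊆? G h) ▹ Y j e f (ν ⊞ unit i 1 ⊞ unit h 1)))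
        ≈⟨ Σ-cong (allFin m) (λ i → ▹-congʳ (G j ⊆? G i) λ _ → Y₁-Y l j e f (ν ⊞ unit i 1)) ⟩
      Y j (suc e) (Y l 1 f) ν ∎

    Y-comm : ∀ l a j b f ν → Y l a (Y j b f) ν ≈ Y j b (Y l a f) ν
    Y-comm l zero j b f ν = ≈-refl
    Y-comm l (suc a) j b f ν = begin
      Y l (suc a) (Y j b f) ν
        ≈⟨ Σ-cong (allFin m) (λ h → ▹-congʳ (G l ⊆? G h) λ _ → Y-comm l a j b f (ν ⊞ unit h 1)) ⟩
      Σ (allFin m) (λ h → (G l ⊆? G h) ▹ Y j b (Y l a f) (ν ⊞ unit h 1))
        ≈⟨ Y₁-Y l j b (Y l a f) ν ⟩
      Y j b (Y l 1 (Y l a f)) ν ∎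

    Y-+ : ∀ j a b f ν → Y j a (Y j b f) ν ≈ Y j (a + b) f ν
    Y-+ j zero b f ν = ≈-refl
    Y-+ j (suc a) b f ν = Σ-cong (allFin m) (λ h → ▹-congʳ (G j ⊆? G h) λ _ → Y-+ j a b f (ν ⊞ unit h 1))

    -- For G j ⊆ G l one factor y_j is y_l plus the x_h with G h above G j but not above G l. This
    -- is the basic move of the vanishing arguments.
    Y-split : ∀ j l i f ν → G j ⊆ G l → Y j (suc i) f ν ≈
              Y j i (Y l 1 f) ν ∙ Σ (allFin m) (λ h → (G j ⊆? G h) ▹ (¬? (G l ⊆? G h) ▹ Y j i f (ν ⊞ unit h 1)))
    Y-split j l i f ν s = ≈-trans (Σ-cong (allFin m) λ h → part (G j ⊆? G h) (G l ⊆? G h) (λ t → t ∘ s))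
      (≈-trans (Σ-∙ (allFin m)) (∙-congʳ (Y₁-Y l j i f ν)))
      where
      part : ∀ {P Q : Set} (p : Dec P) (q : Dec Q) {x} → (Q → P) → p ▹ x ≈ (q ▹ x) ∙ (p ▹ (¬? q ▹ x))
      part (yes _) (yes _) h = ≈-sym (identityʳ _)
      part (yes _) (no _) h = ≈-sym (identityˡ _)
      part (no ¬p) (yes q) h = ⊥-elim (¬p (h q))
      part (no _) (no _) h = ≈-sym (identityˡ ε)

    Y-∙ : ∀ j e f g ν → Y j e (λ τ → f τ ∙ g τ) ν ≈ Y j e f ν ∙ Y j e g ν
    Y-∙ j zero f g ν = ≈-refl
    Y-∙ j (suc e) f g ν = ≈-trans (Σ-cong (allFin m) λ h → ≈-trans (▹-congʳ (G j ⊆? G h) λ _ → Y-∙ j e f g (ν ⊞ unit h 1)) (▹-∙ (G j ⊆? G h))) (Σ-∙ (allFin m))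

-- Functionals vanishing on the Chow ideal

∸-bound : ∀ {a b c d} → a + d ≤ c + b → a ∸ b ≤ c ∸ d
∸-bound {a} {b} {c} {d} h = ℕP.m≤n+o⇒m∸n≤o a b (ℕP.+-cancelʳ-≤ d _ _ (begin
  a + d            ≤⟨ h ⟩
  c + b            ≡⟨ ℕP.+-comm c b ⟩
  b + c            ≤⟨ ℕP.+-monoʳ-≤ b (ℕP.≤-trans (ℕP.m≤n+m∸n c d) (ℕP.≤-reflexive (ℕP.+-comm d (c ∸ d)))) ⟩
  b + (c ∸ d + d)  ≡⟨ ℕP.+-assoc b (c ∸ d) d ⟨
  b + (c ∸ d) + d  ∎))
  where open ≤-Reasoning

module Functionals {n : ℕ} (rk : Subset n → ℕ) (pm : IsPolymatroid rk) (loopless : Loopless rk)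
                   (𝒢 : List (Subset n)) (bs : IsBuildingSet rk 𝒢) where
  open IsPolymatroid pm
  open BuildingSet rk pm loopless 𝒢 bs
  open Shifts G G-inj
  open ≤-Reasoning
  module QS = RingSum ℚP.+-*-commutativeRing
  open Values (CommutativeRing.+-commutativeMonoid ℚP.+-*-commutativeRing)

  -- The least e for which x^ν y_j^e is a multiple of a generator for j. It comes from taking S to
  -- be the whole support of ν, since a larger S has a larger sup and a smaller exponent.
  dd : Fin M → Vec ℕ M → ℕ
  dd j ν = rk (G j) ∸ rk (sup (supp ν) j)

  -- Includes nestedness of the support: where G j ⊆ sup the bound `dd j ν` is 0 and cannot be met.
  Std : Vec ℕ M → Set
  Std ν = ∀ j → V.lookup ν j < dd j ν

  dd-anti : ∀ {j ν τ} → sup (supp ν) j ⊆ sup (supp τ) j → dd j τ ≤ dd j ν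
  dd-anti {j} s = ℕP.∸-monoʳ-≤ (rk (G j)) (monotone _ _ s)

  dd-anti-supp : ∀ {j ν τ} → (∀ i → i ∈ supp ν → G i ⊏ G j → i ∈ supp τ) → dd j τ ≤ dd j ν
  dd-anti-supp {j} {ν} {τ} h = dd-anti {j} {ν} {τ} (sup-least {supp ν} {j} (sup-flat (supp τ) j) λ i i∈ lt →
    sup-upper {supp τ} (h i i∈ lt) lt)

  dd-⊞ : ∀ {j} (ν τ : Vec ℕ M) → dd j (ν ⊞ τ) ≤ dd j ν
  dd-⊞ {j} ν τ = dd-anti-supp {j} {ν} {ν ⊞ τ} λ i i∈ _ → supp-⊞ˡ ν τ i∈

  supp-drop : ∀ {j i : Fin M} (ν : Vec ℕ M) → i ≢ j → i ∈ supp ν → i ∈ supp (drop j ν)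
  supp-drop {j} ν ne i∈ = supp⁺ (drop j ν) (subst (0 <_) (sym (lookup-drop-≢ ν ne)) (supp⁻ ν i∈))

  dd-drop : ∀ j ν → dd j (drop j ν) ≤ dd j ν
  dd-drop j ν = dd-anti-supp {j} {ν} {drop j ν} λ i i∈ lt → supp-drop {j} {i} ν (λ { refl → proj₂ lt refl }) i∈

  dd-dominated : ∀ j τ → G j ⊆ sup (supp τ) j → dd j τ ≡ 0
  dd-dominated j τ s = ℕP.m≤n⇒m∸n≡0 (monotone _ _ s)

  violation? : ∀ ν → Dec (∃ λ j → dd j ν ≤ V.lookup ν j)
  violation? ν = any? λ j → dd j ν ℕP.≤? V.lookup ν j

  -- W ν + c * wt j is the weight of the leading monomial x^ν x_j^c, so this collects all relations
  -- with leading weight below w.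
  Vanishing : (Vec ℕ M → ℚ) → ℕ → Set
  Vanishing ℓ w = ∀ ν j c → dd j ν ≤ c → W ν + c * wt j < w → Y j c ℓ ν ≡ 0ℚ

  module Step (ℓ : Vec ℕ M → ℚ) (w : ℕ) (IH : Vanishing ℓ w) where

    -- The join G p of the two flats is in 𝒢 and lies below sup (supp μ) p. Hence `dd p μ` is 0, and
    -- μ alone, with power 0 of y_p, is one of the relations.
    vanish-incomparable : ∀ μ g h {e} → e ∈ G g → e ∈ G h → g ∈ supp μ → h ∈ supp μ →
                          ¬ (G g ⊆ G h) → ¬ (G h ⊆ G g) → W μ < w → ℓ μ ≡ 0ℚ
    vanish-incomparable μ g h e∈g e∈h g∈ h∈ g⊈h h⊈g lt with overlapping-join g h e∈g e∈h
    ... | p , eq = IH μ p 0 (ℕP.≤-reflexive (dd-dominated p μ dom)) (subst (_< w) (sym (ℕP.+-identityʳ _)) lt)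
      where
      g⊆p : G g ⊆ G p
      g⊆p = subst (G g ⊆_) (sym eq) (cl-ext ∘ p⊆p∪q (G h))
      h⊆p : G h ⊆ G p
      h⊆p = subst (G h ⊆_) (sym eq) (cl-ext ∘ q⊆p∪q (G g) (G h))
      dom : G p ⊆ sup (supp μ) p
      dom = cl-least (sup-flat (supp μ) p) (∪-least
        (sup-upper {supp μ} g∈ (g⊆p , λ e → h⊈g (subst (G h ⊆_) (sym e) h⊆p)))
        (sup-upper {supp μ} h∈ (h⊆p , λ e → g⊈h (subst (G g ⊆_) (sym e) g⊆p)))) ∘ subst (_ ∈_) eq

    -- All elements of supp μ below G j lie in supp τ, except possibly k.
    Covers : Vec ℕ M → Fin M → Fin M → Vec ℕ M → Set
    Covers μ j k τ = ∀ i → i ∈ supp μ → G i ⊏ G j → i ∈ supp τ ⊎ i ≡ k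

    -- Here x h takes over the role of x k. If G h and G j are incomparable, let G l be
    -- their join: modulo the vanishing products x g · x h of incomparable overlapping flats,
    -- y j may be replaced by y l, and submodularity bounds dd l τ by dd j μ.
    vanish-above : ∀ μ j k h c τ → Covers μ j k τ → dd j μ ≤ c → G k ⊆ G j → G k ⊆ G h → ¬ (G j ⊆ G h) →
                   h ∈ supp τ → W τ + c * wt j < w → Y j c ℓ τ ≡ 0ℚ
    vanish-above μ j k h c τ cov d≤c k⊆j k⊆h j⊈h h∈ lt with G h ⊆? G j
    ... | yes h⊆j = IH τ j c (ℕP.≤-trans (dd-anti {j} {μ} {τ} sup≤) d≤c) lt
      where
      h⊏j : G h ⊏ G j
      h⊏j = h⊆j , λ e → j⊈h (subst (_⊆ G h) e id)
      sup≤ : sup (supp μ) j ⊆ sup (supp τ) j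
      sup≤ = sup-least {supp μ} (sup-flat (supp τ) j) λ i i∈ i⊏j →
        [ (λ i∈τ → sup-upper {supp τ} i∈τ i⊏j) , (λ { refl → sup-upper {supp τ} h∈ h⊏j ∘ k⊆h }) ]′ (cov i i∈ i⊏j)
    ... | no h⊈j with G-nonempty k
    ... | e , e∈k with overlapping-join h j (k⊆h e∈k) (k⊆j e∈k)
    ... | l , eq = replace c 0 (ℕP.≤-trans d≤c (ℕP.≤-reflexive (sym (ℕP.+-identityʳ c))))
                     (subst (λ z → W τ + z * wt j < w) (sym (ℕP.+-identityʳ c)) lt)
      where
      h⊆l : G h ⊆ G l
      h⊆l = subst (G h ⊆_) (sym eq) (cl-ext ∘ p⊆p∪q (G j))
      j⊆l : G j ⊆ G l
      j⊆l = subst (G j ⊆_) (sym eq) (cl-ext ∘ q⊆p∪q (G h) (G j))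
      h⊏l : G h ⊏ G l
      h⊏l = h⊆l , λ e → j⊈h (subst (G j ⊆_) (sym e) j⊆l)
      s = sup (supp μ) j
      t = sup (supp τ) l
      s⊆t : s ⊆ t
      s⊆t = sup-least {supp μ} (sup-flat (supp τ) l) λ i i∈ i⊏j →
        [ (λ i∈τ → sup-upper {supp τ} i∈τ (j⊆l ∘ proj₁ i⊏j , λ e → proj₂ i⊏j (⊆-antisym (proj₁ i⊏j) (subst (G j ⊆_) (sym e) j⊆l))))
        , (λ { refl → sup-upper {supp τ} h∈ h⊏l ∘ k⊆h }) ]′ (cov i i∈ i⊏j)
      dd-l : dd l τ ≤ dd j μ
      dd-l = ∸-bound {rk (G l)} {rk t} {rk (G j)} {rk s} (begin
        rk (G l) + rk s          ≡⟨ cong (λ z → rk z + rk s) eq ⟩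
        rk (cl (G h ∪ G j)) + rk s ≤⟨ ℕP.+-monoˡ-≤ (rk s) (rk-cl≤ (G h ∪ G j)) ⟩
        rk (G h ∪ G j) + rk s    ≤⟨ submod {G j} {t} (∪-least (q⊆p∪q (G j) t ∘ sup-upper {supp τ} h∈ h⊏l) (p⊆p∪q t)) (sup⊆ {supp μ} {j}) s⊆t ⟩
        rk (G j) + rk t          ∎)
      -- i counts the factors y_j still to be exchanged for y_l. A leftover x_g has G g above G j
      -- but not above G l, so G g and G h are incomparable; they overlap in G k.
      replace : ∀ i c' → dd j μ ≤ i + c' → W τ + (i + c') * wt j < w → Y j i (Y l c' ℓ) τ ≡ 0ℚ
      replace zero c' d≤ lt = IH τ l c' (ℕP.≤-trans dd-l d≤)
        (ℕP.≤-<-trans (ℕP.+-monoʳ-≤ (W τ) (ℕP.*-monoʳ-≤ c' (wt-≤ j⊆l))) lt)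
      replace (suc i) c' d≤ lt = trans (Y-split j l i (Y l c' ℓ) τ j⊆l) (trans (cong₂ ℚ._+_ upper other) (ℚP.+-identityˡ 0ℚ))
        where
        upper : Y j i (Y l 1 (Y l c' ℓ)) τ ≡ 0ℚ
        upper = replace i (suc c') (ℕP.≤-trans d≤ (ℕP.≤-reflexive (sym (ℕP.+-suc i c'))))
          (subst (λ z → W τ + z * wt j < w) (sym (ℕP.+-suc i c')) lt)
        other : QS.Σ (allFin M) (λ g → (G j ⊆? G g) QS.▹ (¬? (G l ⊆? G g) QS.▹ Y j i (Y l c' ℓ) (τ ⊞ unit g 1))) ≡ 0ℚ
        other = QS.Σ-ε (allFin M) λ g _ → QS.▹-ε (G j ⊆? G g) λ j⊆g → QS.▹-ε (¬? (G l ⊆? G g)) λ l⊈g →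
          Y-zero j i (τ ⊞ unit g 1) λ τ₁ _ le₁ → Y-zero l c' (τ ⊞ unit g 1 ⊞ τ₁) λ τ₂ _ le₂ →
            vanish-incomparable (τ ⊞ unit g 1 ⊞ τ₁ ⊞ τ₂) g h (j⊆g (k⊆j e∈k)) (k⊆h e∈k)
              (supp-⊞ˡ (τ ⊞ unit g 1 ⊞ τ₁) τ₂ (supp-⊞ˡ (τ ⊞ unit g 1) τ₁ (supp-⊞ʳ τ (unit g 1) (supp-unit⁺ g (s≤s z≤n)))))
              (supp-⊞ˡ (τ ⊞ unit g 1 ⊞ τ₁) τ₂ (supp-⊞ˡ (τ ⊞ unit g 1) τ₁ (supp-⊞ˡ τ (unit g 1) h∈)))
              (λ g⊆h → j⊈h (g⊆h ∘ j⊆g))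
              (λ h⊆g → l⊈g (cl-least (G-flat g) (∪-least h⊆g j⊆g) ∘ subst (_ ∈_) eq))
              (begin-strict
                W (τ ⊞ unit g 1 ⊞ τ₁ ⊞ τ₂)          ≡⟨ W-⊞ (τ ⊞ unit g 1 ⊞ τ₁) τ₂ ⟩
                W (τ ⊞ unit g 1 ⊞ τ₁) + W τ₂        ≡⟨ cong (_+ W τ₂) (W-⊞ (τ ⊞ unit g 1) τ₁) ⟩
                W (τ ⊞ unit g 1) + W τ₁ + W τ₂      ≡⟨ cong (λ z → z + W τ₁ + W τ₂) (trans (W-⊞ τ (unit g 1)) (cong (W τ +_) (W-unit₁ g))) ⟩
                W τ + wt g + W τ₁ + W τ₂            ≤⟨ ℕP.+-mono-≤ (ℕP.+-mono-≤ (ℕP.+-monoʳ-≤ (W τ) (wt-≤ j⊆g)) le₁) (ℕP.≤-trans le₂ (ℕP.*-monoʳ-≤ c' (wt-≤ j⊆l))) ⟩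
                W τ + wt j + i * wt j + c' * wt j   ≡⟨ arith (W τ) (wt j) i c' ⟩
                W τ + (suc i + c') * wt j           <⟨ lt ⟩
                w                                   ∎)
          where
          arith : ∀ x y i c → x + y + i * y + c * y ≡ x + (suc i + c) * y
          arith = solve-∀

    W₃ : ∀ ρ h τ → W (ρ ⊞ unit h 1 ⊞ τ) ≡ W ρ + wt h + W τ
    W₃ ρ h τ = trans (W-⊞ (ρ ⊞ unit h 1) τ) (cong (_+ W τ) (trans (W-⊞ ρ (unit h 1)) (cong (W ρ +_) (W-unit₁ h))))

    module Below (μ ρ : Vec ℕ M) (j k : Fin M) (k⊏j : G k ⊏ G j) (cov : Covers μ j k ρ) where

      cov-⊞ : ∀ τ → Covers μ j k (ρ ⊞ τ)
      cov-⊞ τ i i∈ lt = [ (λ p → inj₁ (supp-⊞ˡ ρ τ p)) , inj₂ ]′ (cov i i∈ lt)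

      k⊆j = proj₁ k⊏j

      -- Splits y k = y j + (the x h with G h ⊇ G k, G h ⊉ G j); the second part is handled by
      -- vanish-above, and the pure power of y j is high enough by dd≤ below.
      vanish-power : ∀ i c → dd j ρ ≤ i + c → dd j μ ≤ c → W ρ + i * wt k + c * wt j < w →
                     Y k i (Y j c ℓ) ρ ≡ 0ℚ
      vanish-power zero c d d' lt = IH ρ j c d (subst (λ z → z + c * wt j < w) (ℕP.+-identityʳ (W ρ)) lt)
      vanish-power (suc i) c d d' lt = trans (Y-split k j i (Y j c ℓ) ρ k⊆j) (trans (cong₂ ℚ._+_ upper other) (ℚP.+-identityˡ 0ℚ))
        where
        upper : Y k i (Y j 1 (Y j c ℓ)) ρ ≡ 0ℚ
        upper = vanish-power i (suc c) (ℕP.≤-trans d (ℕP.≤-reflexive (sym (ℕP.+-suc i c)))) (ℕP.m≤n⇒m≤1+n d')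
          (begin-strict
            W ρ + i * wt k + suc c * wt j        ≤⟨ ℕP.+-monoʳ-≤ (W ρ + i * wt k) (ℕP.+-monoˡ-≤ (c * wt j) (wt-≤ k⊆j)) ⟩
            W ρ + i * wt k + (wt k + c * wt j)   ≡⟨ arith (W ρ) (wt k) (c * wt j) i ⟩
            W ρ + suc i * wt k + c * wt j        <⟨ lt ⟩
            w                                    ∎)
          where
          arith : ∀ x y z i → x + i * y + (y + z) ≡ x + suc i * y + z
          arith = solve-∀
        other : QS.Σ (allFin M) (λ g → (G k ⊆? G g) QS.▹ (¬? (G j ⊆? G g) QS.▹ Y k i (Y j c ℓ) (ρ ⊞ unit g 1))) ≡ 0ℚ
        other = QS.Σ-ε (allFin M) λ g _ → QS.▹-ε (G k ⊆? G g) λ k⊆g → QS.▹-ε (¬? (G j ⊆? G g)) λ j⊈g →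
          Y-zero k i (ρ ⊞ unit g 1) λ τ _ le →
            vanish-above μ j k g c (ρ ⊞ unit g 1 ⊞ τ) (λ x x∈ lt → [ (λ p → inj₁ (supp-⊞ˡ (ρ ⊞ unit g 1) τ p)) , inj₂ ]′ (cov-⊞ (unit g 1) x x∈ lt))
              d' k⊆j k⊆g j⊈g (supp-⊞ˡ (ρ ⊞ unit g 1) τ (supp-⊞ʳ ρ (unit g 1) (supp-unit⁺ g (s≤s z≤n))))
              (begin-strict
                W (ρ ⊞ unit g 1 ⊞ τ) + c * wt j      ≡⟨ cong (_+ c * wt j) (W₃ ρ g τ) ⟩
                W ρ + wt g + W τ + c * wt j          ≤⟨ ℕP.+-monoˡ-≤ (c * wt j) (ℕP.+-mono-≤ (ℕP.+-monoʳ-≤ (W ρ) (wt-≤ k⊆g)) le) ⟩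
                W ρ + wt k + i * wt k + c * wt j     ≡⟨ cong (_+ c * wt j) (ℕP.+-assoc (W ρ) (wt k) (i * wt k)) ⟩
                W ρ + suc i * wt k + c * wt j        <⟨ lt ⟩
                w                                    ∎)

      -- Trades the i remaining factors y_k for x_k one at a time, now at total weight up to w
      -- itself. In y_k = y_j + x_k + (other x_g), the y_j term and the x_g terms have strictly
      -- smaller total weight and vanish, so only x_k survives.
      lead-power : ∀ a i s → dd j ρ ≤ (s + i) + a → dd j μ ≤ a → W ρ + (s + i) * wt k + a * wt j ≤ w → 0 < s + i →
                   Y k i (Y j a ℓ) (ρ ⊞ unit k s) ≡ Y j a ℓ (ρ ⊞ unit k (s + i))
      lead-power a zero s d d' le pos = cong (λ z → Y j a ℓ (ρ ⊞ unit k z)) (sym (ℕP.+-identityʳ s))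
      lead-power a (suc i) s d d' le pos = trans (Y-split k j i (Y j a ℓ) (ρ ⊞ unit k s) k⊆j)
          (trans (cong₂ ℚ._+_ (upper s refl) other) (trans (ℚP.+-identityˡ _)
          (trans (cong (Y k i (Y j a ℓ)) (trans (⊞-assoc ρ _ _) (cong (ρ ⊞_) (trans (unit-+ k s 1) (cong (unit k) (ℕP.+-comm s 1))))))
          (trans (lead-power a i (suc s) (subst (λ z → dd j ρ ≤ z + a) (ℕP.+-suc s i) d) d' (subst (λ z → W ρ + z * wt k + a * wt j ≤ w) (ℕP.+-suc s i) le) (s≤s z≤n))
            (cong (λ z → Y j a ℓ (ρ ⊞ unit k z)) (sym (ℕP.+-suc s i)))))))
        where
        bound : W ρ + (s + i) * wt k + suc a * wt j < w
        bound = begin-strict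
          W ρ + (s + i) * wt k + suc a * wt j        <⟨ ℕP.+-monoʳ-< (W ρ + (s + i) * wt k) (ℕP.+-monoˡ-< (a * wt j) (wt-< k⊏j)) ⟩
          W ρ + (s + i) * wt k + (wt k + a * wt j)   ≡⟨ arith (W ρ) (wt k) (a * wt j) s i ⟩
          W ρ + (s + suc i) * wt k + a * wt j        ≤⟨ le ⟩
          w                                          ∎
          where
          arith : ∀ x y z s i → x + (s + i) * y + (y + z) ≡ x + (s + suc i) * y + z
          arith = solve-∀
        -- For s = 0 nothing stands in for x_k and the bound on `dd j ρ` is needed. Once s > 0, the
        -- factor x_k itself keeps G k in the support below G j.
        upper : ∀ s' → s' ≡ s → Y k i (Y j 1 (Y j a ℓ)) (ρ ⊞ unit k s) ≡ 0ℚ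
        upper zero refl = trans (cong (Y k i (Y j (suc a) ℓ)) (trans (cong (ρ ⊞_) (unit-0 k)) (⊞-identityʳ ρ)))
          (vanish-power i (suc a) (ℕP.≤-trans d (ℕP.≤-reflexive (sym (ℕP.+-suc i a)))) (ℕP.m≤n⇒m≤1+n d') bound)
        upper (suc s') refl = Y-zero k i (ρ ⊞ unit k s) λ τ _ le₁ →
          vanish-above μ j k k (suc a) (ρ ⊞ unit k s ⊞ τ) (λ x x∈ lt → [ (λ p → inj₁ (supp-⊞ˡ (ρ ⊞ unit k s) τ p)) , inj₂ ]′ (cov-⊞ (unit k s) x x∈ lt))
            (ℕP.m≤n⇒m≤1+n d') k⊆j id (λ j⊆k → proj₂ k⊏j (⊆-antisym k⊆j j⊆k))
            (supp-⊞ˡ (ρ ⊞ unit k s) τ (supp-⊞ʳ ρ (unit k s) (supp-unit⁺ k (s≤s z≤n))))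
            (begin-strict
              W (ρ ⊞ unit k s ⊞ τ) + suc a * wt j        ≡⟨ cong (_+ suc a * wt j) (trans (W-⊞ (ρ ⊞ unit k s) τ) (cong (_+ W τ) (trans (W-⊞ ρ (unit k s)) (cong (W ρ +_) (W-unit k s))))) ⟩
              W ρ + s * wt k + W τ + suc a * wt j        ≤⟨ ℕP.+-monoˡ-≤ (suc a * wt j) (ℕP.+-monoʳ-≤ (W ρ + s * wt k) le₁) ⟩
              W ρ + s * wt k + i * wt k + suc a * wt j   ≡⟨ arith (W ρ) (wt k) (suc a * wt j) s i ⟩
              W ρ + (s + i) * wt k + suc a * wt j        <⟨ bound ⟩
              w                                          ∎)
          where
          arith : ∀ x y z s i → x + s * y + i * y + z ≡ x + (s + i) * y + z
          arith = solve-∀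
        other : QS.Σ (allFin M) (λ g → (G k ⊆? G g) QS.▹ (¬? (G j ⊆? G g) QS.▹ Y k i (Y j a ℓ) (ρ ⊞ unit k s ⊞ unit g 1)))
                ≡ Y k i (Y j a ℓ) (ρ ⊞ unit k s ⊞ unit k 1)
        other = trans (QS.Σ-single (allFin M) k (UniqueP.allFin⁺ M) (∈-allFin k) off)
                  (trans (QS.▹-yes (G k ⊆? G k) id) (QS.▹-yes (¬? (G j ⊆? G k)) (λ j⊆k → proj₂ k⊏j (⊆-antisym k⊆j j⊆k))))
          where
          off : ∀ g → g ≢ k → (G k ⊆? G g) QS.▹ (¬? (G j ⊆? G g) QS.▹ Y k i (Y j a ℓ) (ρ ⊞ unit k s ⊞ unit g 1)) ≡ 0ℚ
          off g ne = QS.▹-ε (G k ⊆? G g) λ k⊆g → QS.▹-ε (¬? (G j ⊆? G g)) λ j⊈g →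
            Y-zero k i (ρ ⊞ unit k s ⊞ unit g 1) λ τ _ le₁ →
              vanish-above μ j k g a (ρ ⊞ unit k s ⊞ unit g 1 ⊞ τ)
                (λ x x∈ lt → [ (λ p → inj₁ (supp-⊞ˡ (ρ ⊞ unit k s ⊞ unit g 1) τ (supp-⊞ˡ (ρ ⊞ unit k s) (unit g 1) p))) , inj₂ ]′ (cov-⊞ (unit k s) x x∈ lt))
                d' k⊆j k⊆g j⊈g (supp-⊞ˡ (ρ ⊞ unit k s ⊞ unit g 1) τ (supp-⊞ʳ (ρ ⊞ unit k s) (unit g 1) (supp-unit⁺ g (s≤s z≤n))))
                (begin-strict
                  W (ρ ⊞ unit k s ⊞ unit g 1 ⊞ τ) + a * wt j      ≡⟨ cong (_+ a * wt j) (trans (W₃ (ρ ⊞ unit k s) g τ) (cong (λ z → z + wt g + W τ) (trans (W-⊞ ρ (unit k s)) (cong (W ρ +_) (W-unit k s))))) ⟩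
                  W ρ + s * wt k + wt g + W τ + a * wt j          <⟨ ℕP.+-monoˡ-< (a * wt j) (ℕP.+-mono-<-≤ (ℕP.+-monoʳ-< (W ρ + s * wt k) (wt-< (⊆⇒⊏ (≢-sym ne) k⊆g))) le₁) ⟩
                  W ρ + s * wt k + wt k + i * wt k + a * wt j     ≡⟨ arith (W ρ) (wt k) (a * wt j) s i ⟩
                  W ρ + (s + suc i) * wt k + a * wt j             ≤⟨ le ⟩
                  w                                               ∎)
            where
            arith : ∀ x y z s i → x + s * y + y + i * y + z ≡ x + (s + suc i) * y + z
            arith = solve-∀

    -- Both relations violated at μ are compared with the product of the two powers of
    -- y j and y k; this lemma is one side of that comparison.
    half : ∀ μ ρ j k a b → j ≢ k → μ ≡ ρ ⊞ unit k b ⊞ unit j a → dd j μ ≤ a → dd k μ ≤ b → W μ ≡ w →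
           Y j a ℓ (ρ ⊞ unit k b) ≡ Y k b (Y j a ℓ) ρ
    half μ ρ j k a b ne refl dj dk Wμ = go (G k ⊏? G j) (0 ℕP.<? b)
      where
      Wμ' : W ρ + b * wt k + a * wt j ≡ w
      Wμ' = trans (sym (trans (W-⊞ (ρ ⊞ unit k b) (unit j a)) (cong₂ _+_ (trans (W-⊞ ρ (unit k b)) (cong (W ρ +_) (W-unit k b))) (W-unit j a)))) Wμ
      supp-μ : ∀ i → i ∈ supp μ → i ≢ j → i ∈ supp ρ ⊎ (i ≡ k × 0 < b)
      supp-μ i i∈ i≢j with supp-⊞⁻ (ρ ⊞ unit k b) (unit j a) i∈
      ... | inj₂ q = ⊥-elim (i≢j (proj₁ (supp-unit⁻ j a q)))
      ... | inj₁ p with supp-⊞⁻ ρ (unit k b) p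
      ... | inj₁ p' = inj₁ p'
      ... | inj₂ q = inj₂ (supp-unit⁻ k b q)
      -- If x_k does not matter for sup at j, the exponent demanded at ρ is still at most a. The
      -- lower terms of x^ρ y_k^b y_j^a then vanish by induction, leaving x_k^b.
      simple : (∀ i → i ∈ supp μ → G i ⊏ G j → i ∈ supp ρ) → Y j a ℓ (ρ ⊞ unit k b) ≡ Y k b (Y j a ℓ) ρ
      simple h = sym (Y-lead k b ρ λ τ _ lt → IH (ρ ⊞ τ) j a
        (ℕP.≤-trans (dd-⊞ ρ τ) (ℕP.≤-trans (dd-anti-supp {j} {μ} {ρ} h) dj))
        (begin-strict
          W (ρ ⊞ τ) + a * wt j        ≡⟨ cong (_+ a * wt j) (W-⊞ ρ τ) ⟩
          W ρ + W τ + a * wt j        <⟨ ℕP.+-monoˡ-< (a * wt j) (ℕP.+-monoʳ-< (W ρ) lt) ⟩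
          W ρ + b * wt k + a * wt j   ≡⟨ Wμ' ⟩
          w                           ∎))
      go : Dec (G k ⊏ G j) → Dec (0 < b) → Y j a ℓ (ρ ⊞ unit k b) ≡ Y k b (Y j a ℓ) ρ
      go (no k⊏̸j) _ = simple λ i i∈ lt → [ id , (λ { (refl , _) → ⊥-elim (k⊏̸j lt) }) ]′ (supp-μ i i∈ (λ { refl → proj₂ lt refl }))
      go (yes _) (no b≯0) = simple λ i i∈ lt → [ id , (λ { (_ , b>0) → ⊥-elim (b≯0 b>0) }) ]′ (supp-μ i i∈ (λ { refl → proj₂ lt refl }))
      go (yes k⊏j) (yes b>0) = sym (trans (cong (Y k b (Y j a ℓ)) (sym (trans (cong (ρ ⊞_) (unit-0 k)) (⊞-identityʳ ρ))))
          (Below.lead-power μ ρ j k k⊏j cov a b 0 (ℕP.≤-trans dd≤ (ℕP.≤-trans (ℕP.+-mono-≤ dj dk) (ℕP.≤-reflexive (ℕP.+-comm a b)))) dj (ℕP.≤-reflexive Wμ') b>0))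
        where
        cov : Covers μ j k ρ
        cov i i∈ lt = [ inj₁ , inj₂ ∘ proj₁ ]′ (supp-μ i i∈ (λ { refl → proj₂ lt refl }))
        s = sup (supp ρ) j
        s⊆ : sup (supp μ) j ⊆ cl (s ∪ G k)
        s⊆ = sup-least {supp μ} (cl-flat _) λ i i∈ lt →
          [ (λ p → cl-ext ∘ p⊆p∪q (G k) ∘ sup-upper {supp ρ} p lt) , (λ { refl → cl-ext ∘ q⊆p∪q s (G k) }) ]′ (cov i i∈ lt)
        k-part : sup (supp μ) k ⊆ s
        k-part = sup-least {supp μ} (sup-flat (supp ρ) j) λ i i∈ lt →
          sup-upper {supp ρ} ([ id , (λ { (refl , _) → ⊥-elim (proj₂ lt refl) }) ]′
              (supp-μ i i∈ (λ { refl → proj₂ k⊏j (⊆-antisym (proj₁ k⊏j) (proj₁ lt)) })))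
            (proj₁ k⊏j ∘ proj₁ lt , λ e → proj₂ lt (⊆-antisym (proj₁ lt) (subst (G k ⊆_) (sym e) (proj₁ k⊏j))))
        -- Removing x_k raises the exponent at j by at most the exponent at k: sup at j for μ lies
        -- in cl (s ∪ G k), while sup at k for μ lies in both s and G k, so submodularity bounds the
        -- loss of rank by rk (G k) - rk (sup (supp μ) k).
        dd≤ : dd j ρ ≤ dd j μ + dd k μ
        dd≤ = ℕP.m≤n+o⇒m∸n≤o (rk (G j)) (rk s) (begin
          rk (G j)                                        ≤⟨ ℕP.m≤n+m∸n (rk (G j)) (rk (sup (supp μ) j)) ⟩
          rk (sup (supp μ) j) + dd j μ                    ≤⟨ ℕP.+-monoˡ-≤ (dd j μ) sup-rk ⟩
          rk s + dd k μ + dd j μ                          ≡⟨ trans (ℕP.+-assoc (rk s) _ _) (cong (rk s +_) (ℕP.+-comm (dd k μ) (dd j μ))) ⟩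
          rk s + (dd j μ + dd k μ)                        ∎)
          where
          sup-rk : rk (sup (supp μ) j) ≤ rk s + dd k μ
          sup-rk = ℕP.+-cancelʳ-≤ (rk (sup (supp μ) k)) _ _ (begin
            rk (sup (supp μ) j) + rk (sup (supp μ) k)     ≤⟨ ℕP.+-monoˡ-≤ _ (ℕP.≤-trans (monotone _ _ s⊆) (rk-cl≤ (s ∪ G k))) ⟩
            rk (s ∪ G k) + rk (sup (supp μ) k)            ≤⟨ submod {s} {G k} id k-part (sup⊆ {supp μ} {k}) ⟩
            rk s + rk (G k)                               ≡⟨ cong (rk s +_) (ℕP.m∸n+n≡m (monotone _ _ (sup⊆ {supp μ} {k}))) ⟨
            rk s + (dd k μ + rk (sup (supp μ) k))         ≡⟨ ℕP.+-assoc (rk s) _ _ ⟨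
            rk s + dd k μ + rk (sup (supp μ) k)           ∎)

    -- The relation at j with leading monomial μ. The whole power of x_j is turned into y_j, so each
    -- j has exactly one relation at μ.
    Rule : Vec ℕ M → Fin M → Set
    Rule μ j = Y j (V.lookup μ j) ℓ (drop j μ) ≡ 0ℚ

    -- Confluence: with ρ free of x_j and x_k, both relations take the same value as x^ρ y_j^a
    -- y_k^b.
    rule-transfer : ∀ μ j k → W μ ≡ w → dd j μ ≤ V.lookup μ j → dd k μ ≤ V.lookup μ k → Rule μ k → Rule μ j
    rule-transfer μ j k Wμ dj dk rule with j Fin.≟ k
    ... | yes refl = rule
    ... | no ne = trans (cong (Y j a ℓ) (sym dj≡)) (trans (half μ ρ j k a b ne μ≡ dj dk Wμ)
        (trans (Y-comm k b j a ℓ ρ)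
        (trans (sym (half μ ρ k j b a (≢-sym ne) μ≡' dk dj Wμ)) (trans (cong (Y k b ℓ) dk≡) rule))))
      where
      a = V.lookup μ j
      b = V.lookup μ k
      ρ = drop k (drop j μ)
      dj≡ : ρ ⊞ unit k b ≡ drop j μ
      dj≡ = trans (cong (λ z → ρ ⊞ unit k z) (sym (lookup-drop-≢ μ (≢-sym ne)))) (drop-⊞-unit k (drop j μ))
      dk≡ : ρ ⊞ unit j a ≡ drop k μ
      dk≡ = trans (cong₂ (λ y z → y ⊞ unit j z) (drop-drop μ ne) (sym (lookup-drop-≢ μ ne))) (drop-⊞-unit j (drop k μ))
      μ≡ : μ ≡ ρ ⊞ unit k b ⊞ unit j a
      μ≡ = trans (sym (drop-⊞-unit j μ)) (cong (_⊞ unit j a) (sym dj≡))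
      μ≡' : μ ≡ ρ ⊞ unit j a ⊞ unit k b
      μ≡' = trans (sym (drop-⊞-unit k μ)) (cong (_⊞ unit k b) (sym dk≡))

    -- In a relation x^ν y_j^c the monomial ν may still contain x_j^s. Replacing it by y_j^s changes
    -- the value only by terms covered by `IH` and produces `Rule` at the leading monomial μ, which
    -- `rule-transfer` reaches from the one rule supplied there.
    extend : (∀ μ → W μ ≡ w → (∃ λ j → dd j μ ≤ V.lookup μ j) → ∃ λ j → dd j μ ≤ V.lookup μ j × Rule μ j) →
             ∀ ν j c → dd j ν ≤ c → W ν + c * wt j ≡ w → Y j c ℓ ν ≡ 0ℚ
    extend rules ν j c d Wν = trans (cong (Y j c ℓ) (sym (drop-⊞-unit j ν)))
        (trans (sym (Y-lead j s ρ tail)) (trans (Y-+ j s c ℓ ρ)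
        (subst₂' (sym lookup-μ) (drop-unit j ν c) rule)))
      where
      s = V.lookup ν j
      ρ = drop j ν
      μ = ν ⊞ unit j c
      lookup-μ : V.lookup μ j ≡ s + c
      lookup-μ = trans (lookup-⊞ ν (unit j c) j) (cong (s +_) (lookup-unit-≡ j c))
      subst₂' : ∀ {x y ρ₁ ρ₂} → x ≡ y → ρ₁ ≡ ρ₂ → Y j y ℓ ρ₁ ≡ 0ℚ → Y j x ℓ ρ₂ ≡ 0ℚ
      subst₂' refl refl r = r
      W-μ : W μ ≡ w
      W-μ = trans (W-⊞ ν (unit j c)) (trans (cong (W ν +_) (W-unit j c)) Wν)
      dμ : dd j μ ≤ V.lookup μ j
      dμ = ℕP.≤-trans (dd-⊞ ν (unit j c)) (ℕP.≤-trans d (ℕP.≤-trans (ℕP.m≤n+m c s) (ℕP.≤-reflexive (sym lookup-μ))))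
      rule : Rule μ j
      rule with rules μ W-μ (j , dμ)
      ... | k , dk , r = rule-transfer μ j k W-μ dμ dk r
      tail : ∀ τ → V.sum τ ≡ s → W τ < s * wt j → Y j c ℓ (ρ ⊞ τ) ≡ 0ℚ
      tail τ _ lt = IH (ρ ⊞ τ) j c (ℕP.≤-trans (dd-⊞ ρ τ) (ℕP.≤-trans (dd-drop j ν) d)) (begin-strict
        W (ρ ⊞ τ) + c * wt j       ≡⟨ cong (_+ c * wt j) (W-⊞ ρ τ) ⟩
        W ρ + W τ + c * wt j       <⟨ ℕP.+-monoˡ-< (c * wt j) (ℕP.+-monoʳ-< (W ρ) lt) ⟩
        W ρ + s * wt j + c * wt j  ≡⟨ cong (_+ c * wt j) (W-drop j ν) ⟩
        W ν + c * wt j             ≡⟨ Wν ⟩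
        w                          ∎)

  -- Construction of the dual functionals.

  low : ℕ → (Vec ℕ M → ℚ) → Vec ℕ M → ℚ
  low w f τ = (W τ ℕP.<? w) QS.▹ f τ

  high : ℕ → (Vec ℕ M → ℚ) → Vec ℕ M → ℚ
  high w f τ = ¬? (W τ ℕP.<? w) QS.▹ f τ

  low+high : ∀ w f τ → f τ ≡ low w f τ ℚ.+ high w f τ
  low+high w f τ with W τ ℕP.<? w
  ... | yes _ = sym (ℚP.+-identityʳ _)
  ... | no _ = sym (ℚP.+-identityˡ _)

  -- The functional dual to σ in the monomial basis, with the value on a nonstandard
  -- monomial forced by one violated relation in terms of monomials of smaller weight.
  module Dual (σ : Vec ℕ M) where

    δ : Vec ℕ M → ℚ
    δ μ = VP.≡-dec ℕP._≟_ μ σ QS.▹ 1ℚ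

    reduce : (Vec ℕ M → ℚ) → ∀ μ → Dec (∃ λ j → dd j μ ≤ V.lookup μ j) → ℚ
    reduce f μ (no _) = δ μ
    -- Solves the relation at j for the value at μ: μ is the only term of weight W μ in the
    -- expansion, and `low` keeps the lighter ones.
    reduce f μ (yes (j , _)) = ℚ.- Y j (V.lookup μ j) (low (W μ) f) (drop j μ)

    -- Recursion on weight with bounded depth. `L k` is final on monomials of weight below k, so the
    -- 0 at depth 0 never contributes to `ℓ`.
    L : ℕ → Vec ℕ M → ℚ
    L zero μ = 0ℚ
    L (suc k) μ = reduce (L k) μ (violation? μ)

    ℓ : Vec ℕ M → ℚ
    ℓ μ = L (suc (W μ)) μ

    reduce-cong : ∀ {f g} μ d → (∀ τ → W τ < W μ → f τ ≡ g τ) → reduce f μ d ≡ reduce g μ d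
    reduce-cong μ (no _) h = refl
    reduce-cong μ (yes (j , _)) h = cong ℚ.-_ (Y-cong j (V.lookup μ j) (drop j μ) λ τ → QS.▹-congʳ (W τ ℕP.<? W μ) (h τ))

    L-stable : ∀ k μ → W μ < k → L (suc k) μ ≡ L k μ
    L-stable (suc k) μ (s≤s le) = reduce-cong μ (violation? μ) λ τ lt → L-stable k τ (ℕP.<-≤-trans lt le)

    L≡ℓ : ∀ k μ → W μ < k → L k μ ≡ ℓ μ
    L≡ℓ (suc k) μ lt with W μ ℕP.≟ k
    ... | yes refl = refl
    ... | no ne = let lt' = ℕP.≤∧≢⇒< (ℕP.≤-pred lt) ne in trans (L-stable k μ lt') (L≡ℓ k μ lt')

    ℓ-unfold : ∀ μ → ℓ μ ≡ reduce ℓ μ (violation? μ)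
    ℓ-unfold μ = reduce-cong μ (violation? μ) λ τ lt → L≡ℓ (W μ) τ lt

    ℓ-std : ∀ μ → Std μ → ℓ μ ≡ δ μ
    ℓ-std μ std with violation? μ | ℓ-unfold μ
    ... | no _ | eq = eq
    ... | yes (j , le) | _ = ⊥-elim (ℕP.<⇒≱ (std j) le)

    ℓ-rule : ∀ μ → (∃ λ j → dd j μ ≤ V.lookup μ j) → ∃ λ j → dd j μ ≤ V.lookup μ j × Y j (V.lookup μ j) ℓ (drop j μ) ≡ 0ℚ
    ℓ-rule μ v = go (violation? μ) (ℓ-unfold μ)
     where
     go : ∀ d → ℓ μ ≡ reduce ℓ μ d → ∃ λ j → dd j μ ≤ V.lookup μ j × Y j (V.lookup μ j) ℓ (drop j μ) ≡ 0ℚ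
     go (no ¬v) _ = ⊥-elim (¬v v)
     go (yes (j , le)) eq = j , le ,
      trans (Y-cong j a ρ (low+high (W μ) ℓ)) (trans (Y-∙ j a (low (W μ) ℓ) (high (W μ) ℓ) ρ)
      (trans (cong (Y j a (low (W μ) ℓ) ρ ℚ.+_) top) (ℚP.+-inverseʳ (Y j a (low (W μ) ℓ) ρ))))
      where
      a = V.lookup μ j
      ρ = drop j μ
      top : Y j a (high (W μ) ℓ) ρ ≡ ℚ.- Y j a (low (W μ) ℓ) ρ
      top = trans (Y-lead j a ρ λ τ _ lt → QS.▹-no (¬? (W (ρ ⊞ τ) ℕP.<? W μ)) (λ ¬lt → ¬lt (begin-strict
          W (ρ ⊞ τ)       ≡⟨ W-⊞ ρ τ ⟩
          W ρ + W τ       <⟨ ℕP.+-monoʳ-< (W ρ) lt ⟩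
          W ρ + a * wt j  ≡⟨ W-drop j μ ⟩
          W μ             ∎)))
        (trans (cong (high (W μ) ℓ) (drop-⊞-unit j μ)) (trans (QS.▹-yes (¬? (W μ ℕP.<? W μ)) (ℕP.<-irrefl refl)) eq))

    ℓ-vanishing : ∀ w → Vanishing ℓ w
    ℓ-vanishing zero ν j c d ()
    ℓ-vanishing (suc w) ν j c d lt with W ν + c * wt j ℕP.≟ w
    ... | yes eq = Step.extend ℓ w (ℓ-vanishing w) (λ μ _ → ℓ-rule μ) ν j c d eq
    ... | no ne = ℓ-vanishing w ν j c d (ℕP.≤∧≢⇒< (ℕP.≤-pred lt) ne)

    ℓ-annihilates : ∀ ν j c → dd j ν ≤ c → Y j c ℓ ν ≡ 0ℚ
    ℓ-annihilates ν j c d = ℓ-vanishing _ ν j c d (ℕP.n<1+n _)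

-- The monomial basis of the Chow ring

module ChowRing {n : ℕ} (rk : Subset n → ℕ) (pm : IsPolymatroid rk) (loopless : Loopless rk)
                (𝒢 : List (Subset n)) (bs : IsBuildingSet rk 𝒢) where
  open BuildingSet rk pm loopless 𝒢 bs
  open Shifts G G-inj
  open Functionals rk pm loopless 𝒢 bs
  open QS using (Σ; _▹_)
  open Values (CommutativeRing.+-commutativeMonoid ℚP.+-*-commutativeRing)

  Mon : Set
  Mon = Vec ℕ M

  Pol : Set
  Pol = List (ℚ × Mon)

  infixl 7 _⊗_
  _⊗_ : Pol → Pol → Pol
  _⊗_ = _*P_ rk 𝒢

  _≟ᵥ_ : (μ ν : Mon) → Dec (μ ≡ ν)
  _≟ᵥ_ = VP.≡-dec ℕP._≟_

  -- Polynomials are unreduced lists of terms, so identities between them are checked through the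
  -- values of all functionals f. Coefficients are the special case f = `at μ`.
  ev : (Mon → ℚ) → Pol → ℚ
  ev f p = Σ p (λ t → proj₁ t ℚ.* f (proj₂ t))

  mono : Mon → Pol
  mono ν = (1ℚ , ν) ∷ []

  ev-cong : ∀ {f g} p → (∀ ν → f ν ≡ g ν) → ev f p ≡ ev g p
  ev-cong p h = QS.Σ-cong p λ t → cong (proj₁ t ℚ.*_) (h (proj₂ t))

  ev-++ : ∀ f p q → ev f (p ++ q) ≡ ev f p ℚ.+ ev f q
  ev-++ f p q = QS.Σ-++ p q

  ev-mono : ∀ f ν → ev f (mono ν) ≡ f ν
  ev-mono f ν = trans (ℚP.+-identityʳ _) (ℚP.*-identityˡ (f ν))

  ev-map : ∀ f c (φ : Mon → Mon) (g : ℚ × Mon → ℚ × Mon) → (∀ d b → g (d , b) ≡ (c ℚ.* d , φ b)) →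
           ∀ q → ev f (L.map g q) ≡ c ℚ.* ev (f ∘ φ) q
  ev-map f c φ g h q = trans (QS.Σ-map g q) (trans (QS.Σ-cong q λ { (d , b) →
      trans (cong (λ t → proj₁ t ℚ.* f (proj₂ t)) (h d b)) (ℚP.*-assoc c d (f (φ b))) })
    (sym (QS.Σ-*ˡ q c)))

  ev-⊗ : ∀ f p q → ev f (p ⊗ q) ≡ ev (λ a → ev (λ b → f (a ⊞ b)) q) p
  ev-⊗ f [] q = refl
  ev-⊗ f ((c , a) ∷ p) q = trans (QS.Σ-++ (L.map _ q) (p ⊗ q))
    (cong₂ ℚ._+_ (ev-map f c (a ⊞_) _ (λ _ _ → refl) q) (ev-⊗ f p q))

  ev-scale : ∀ f c p → ev f (scaleP rk 𝒢 c p) ≡ c ℚ.* ev f p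
  ev-scale f c p = ev-map f c id _ (λ _ _ → refl) p

  ev-neg : ∀ f p → ev f (negP rk 𝒢 p) ≡ ℚ.- ev f p
  ev-neg f p = trans (ev-scale f (ℚ.- 1ℚ) p) (neg-one (ev f p))
    where
    open +-*-Solver
    neg-one : ∀ x → (ℚ.- 1ℚ) ℚ.* x ≡ ℚ.- x
    neg-one = solve 1 (λ x → (:- con 1ℚ) :* x := :- x) refl

  ev-sumP : ∀ f ps → ev f (sumP rk 𝒢 ps) ≡ Σ ps (ev f)
  ev-sumP f [] = refl
  ev-sumP f (p ∷ ps) = trans (ev-++ f p (sumP rk 𝒢 ps)) (cong (ev f p ℚ.+_) (ev-sumP f ps))

  at : Mon → Mon → ℚ
  at μ ν = (ν ≟ᵥ μ) ▹ 1ℚ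

  coeff≡ev : ∀ p μ → coeff rk 𝒢 p μ ≡ ev (at μ) p
  coeff≡ev [] μ = refl
  coeff≡ev ((c , ν) ∷ p) μ with ν ≟ᵥ μ
  ... | yes _ = cong₂ ℚ._+_ (sym (ℚP.*-identityʳ c)) (coeff≡ev p μ)
  ... | no _ = trans (coeff≡ev p μ) (sym (trans (cong (ℚ._+ _) (ℚP.*-zeroʳ c)) (ℚP.+-identityˡ _)))

  ev-by-coeff : ∀ f D p → Unique D → (∀ t → t ∈ₗ p → proj₂ t ∈ₗ D) →
                ev f p ≡ Σ D (λ μ → coeff rk 𝒢 p μ ℚ.* f μ)
  ev-by-coeff f D p u h = sym (begin
    Σ D (λ μ → coeff rk 𝒢 p μ ℚ.* f μ)
      ≡⟨ QS.Σ-cong D (λ μ → trans (cong (ℚ._* f μ) (coeff≡ev p μ)) (QS.Σ-*ʳ p (f μ))) ⟩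
    Σ D (λ μ → Σ p (λ t → proj₁ t ℚ.* at μ (proj₂ t) ℚ.* f μ))
      ≡⟨ QS.Σ-swap D p ⟩
    Σ p (λ t → Σ D (λ μ → proj₁ t ℚ.* at μ (proj₂ t) ℚ.* f μ))
      ≡⟨ QS.Σ-cong∈ p (λ t t∈ → trans (QS.Σ-single D (proj₂ t) u (h t t∈) (off t)) (on t)) ⟩
    ev f p ∎)
    where
    open ≡-Reasoning
    off : ∀ t μ → μ ≢ proj₂ t → proj₁ t ℚ.* at μ (proj₂ t) ℚ.* f μ ≡ 0ℚ
    off t μ ne = trans (cong (λ z → proj₁ t ℚ.* z ℚ.* f μ) (QS.▹-no (proj₂ t ≟ᵥ μ) (≢-sym ne)))
      (trans (cong (ℚ._* f μ) (ℚP.*-zeroʳ (proj₁ t))) (ℚP.*-zeroˡ (f μ)))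
    on : ∀ t → proj₁ t ℚ.* at (proj₂ t) (proj₂ t) ℚ.* f (proj₂ t) ≡ proj₁ t ℚ.* f (proj₂ t)
    on t = cong (ℚ._* f (proj₂ t)) (trans (cong (proj₁ t ℚ.*_) (QS.▹-yes (proj₂ t ≟ᵥ proj₂ t) refl)) (ℚP.*-identityʳ (proj₁ t)))

  monomials : Pol → List Mon
  monomials p = L.deduplicate _≟ᵥ_ (L.map proj₂ p)

  ∈-monomials : ∀ p q t → t ∈ₗ p → proj₂ t ∈ₗ monomials (p ++ q)
  ∈-monomials p q t t∈ = ∈-deduplicate⁺ _≟ᵥ_ (∈-map⁺ proj₂ (∈-++⁺ˡ t∈))

  -- Both values are regrouped over one duplicate-free list of monomials, after which they depend on
  -- the coefficients only.
  ev-≈ : ∀ f {p q} → _≈P_ rk 𝒢 p q → ev f p ≡ ev f q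
  ev-≈ f {p} {q} h = trans (ev-by-coeff f D p u (∈-monomials p q))
    (trans (QS.Σ-cong D λ μ → cong (ℚ._* f μ) (h μ))
    (sym (ev-by-coeff f D q u λ t t∈ → ∈-deduplicate⁺ _≟ᵥ_ (∈-map⁺ proj₂ (∈-++⁺ʳ p t∈)))))
    where
    D = monomials (p ++ q)
    u : Unique D
    u = UniqueDec.deduplicate-! _≟ᵥ_ (L.map proj₂ (p ++ q))

  ev-var : ∀ f i → ev f (var rk 𝒢 i) ≡ f (unit i 1)
  ev-var f i = ev-mono f (unit i 1)

  product : List (Fin M) → Mon
  product = L.foldr (λ i ν → unit i 1 ⊞ ν) 𝟎

  ev-prod : ∀ f is → ev f (prodP rk 𝒢 (L.map (var rk 𝒢) is)) ≡ f (product is)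
  ev-prod f [] = ev-mono f 𝟎
  ev-prod f (i ∷ is) = trans (ev-⊗ f (var rk 𝒢 i) (prodP rk 𝒢 (L.map (var rk 𝒢) is)))
    (trans (ev-var (λ a → ev (λ b → f (a ⊞ b)) (prodP rk 𝒢 (L.map (var rk 𝒢) is))) i) (ev-prod (λ b → f (unit i 1 ⊞ b)) is))

  ysum : Fin M → Pol
  ysum j = sumP rk 𝒢 (L.map (var rk 𝒢) (filterᵇ (λ j' → G j ⊆ᵇ G j') (allFin M)))

  ev-ysum : ∀ f j → ev f (ysum j) ≡ Y j 1 (λ ν → f ν) 𝟎
  ev-ysum f j = trans (ev-sumP f (L.map (var rk 𝒢) (filterᵇ _ (allFin M))))
    (trans (QS.Σ-map (var rk 𝒢) (filterᵇ _ (allFin M))) (trans (QS.Σ-filterᵇ (λ j' → G j ⊆ᵇ G j') (allFin M))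
    (QS.Σ-cong (allFin M) λ h → QS.▹-cong (T? (G j ⊆ᵇ G h)) (G j ⊆? G h) (⊆ᵇ⁻ {A = G j} {G h}) (λ s → ⊆ᵇ⁺ {A = G j} {G h} s)
      λ _ → trans (ev-var f h) (cong f (sym (⊞-identityˡ (unit h 1)))))))

  ev-ypow : ∀ f ν j e → ev (λ b → f (ν ⊞ b)) (powP rk 𝒢 (ysum j) e) ≡ Y j e f ν
  ev-ypow f ν j zero = trans (ev-mono (λ b → f (ν ⊞ b)) 𝟎) (cong f (⊞-identityʳ ν))
  ev-ypow f ν j (suc e) = trans (ev-⊗ _ (ysum j) (powP rk 𝒢 (ysum j) e)) (trans (ev-ysum _ j)
    (QS.Σ-cong (allFin M) λ h → QS.▹-congʳ (G j ⊆? G h) λ _ →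
      trans (ev-cong (powP rk 𝒢 (ysum j) e) λ b → cong f (trans (cong (λ z → ν ⊞ (z ⊞ b)) (⊞-identityˡ (unit h 1))) (sym (⊞-assoc ν (unit h 1) b))))
        (ev-ypow f (ν ⊞ unit h 1) j e)))

  monoOf : Subset M → Mon
  monoOf S = product (members rk 𝒢 S)

  ev-gen : ∀ f ν S j → ev (λ b → f (ν ⊞ b)) (gen rk 𝒢 S j) ≡ Y j (rk (G j) ∸ rk (sup S j)) f (ν ⊞ monoOf S)
  ev-gen f ν S j = trans (ev-⊗ _ (prodP rk 𝒢 (L.map (var rk 𝒢) (members rk 𝒢 S))) (powP rk 𝒢 (ysum j) e)) (trans (ev-prod _ (members rk 𝒢 S))
    (trans (ev-cong (powP rk 𝒢 (ysum j) e) λ b → cong f (sym (⊞-assoc ν (monoOf S) b))) (ev-ypow f (ν ⊞ monoOf S) j e)))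
    where
    e = rk (G j) ∸ rk (sup S j)

  private module ℕS = MonoidSum ℕP.+-0-commutativeMonoid

  lookup-product : ∀ is i → V.lookup (product is) i ≡ ℕS.Σ is (λ h → (i Fin.≟ h) ℕS.▹ 1)
  lookup-product [] i = VP.lookup-replicate i 0
  lookup-product (h ∷ is) i = trans (lookup-⊞ (unit h 1) (product is) i) (cong₂ _+_ (go (i Fin.≟ h)) (lookup-product is i))
    where
    go : ∀ d → V.lookup (unit h 1) i ≡ d ℕS.▹ 1
    go (yes refl) = lookup-unit-≡ h 1
    go (no ne) = lookup-unit-≢ 1 ne

  lookup-monoOf : ∀ S i → V.lookup (monoOf S) i ≡ T? (elemᵇ i S) ℕS.▹ 1
  lookup-monoOf S i = trans (lookup-product (members rk 𝒢 S) i) (trans (ℕS.Σ-filterᵇ (λ i → elemᵇ i S) (allFin M))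
    (trans (ℕS.Σ-single (allFin M) i (UniqueP.allFin⁺ M) (∈-allFin i)
        λ h ne → ℕS.▹-ε (T? (elemᵇ h S)) λ _ → ℕS.▹-no (i Fin.≟ h) (≢-sym ne))
      (ℕS.▹-congʳ (T? (elemᵇ i S)) λ _ → ℕS.▹-yes (i Fin.≟ i) refl)))

  supp-monoOf : ∀ S {i} → i ∈ S → i ∈ supp (monoOf S)
  supp-monoOf S {i} h = supp⁺ (monoOf S) (ℕP.≤-reflexive (sym (trans (lookup-monoOf S i) (ℕS.▹-yes (T? (elemᵇ i S)) (elem⁺ h)))))

  -- Splits the squarefree part off x^ν: it is the product of variables in the generator with S =
  -- supp ν.
  monoOf-supp-≤ : ∀ ν → V.map ℕ.pred ν ⊞ monoOf (supp ν) ≡ ν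
  monoOf-supp-≤ ν = vec-ext λ i → trans (lookup-⊞ (V.map ℕ.pred ν) (monoOf (supp ν)) i)
    (trans (cong₂ _+_ (VP.lookup-map i ℕ.pred ν) (lookup-monoOf (supp ν) i)) (go i (V.lookup ν i) refl))
    where
    go : ∀ i x → V.lookup ν i ≡ x → ℕ.pred x + (T? (elemᵇ i (supp ν)) ℕS.▹ 1) ≡ x
    go i zero eq = ℕS.▹-no (T? (elemᵇ i (supp ν))) λ t → ℕP.<-irrefl (sym eq) (supp⁻ ν (elem⁻ t))
    go i (suc x) eq = trans (cong (x +_) (ℕS.▹-yes (T? (elemᵇ i (supp ν))) (elem⁺ (supp⁺ ν (subst (0 <_) (sym eq) (s≤s z≤n)))))) (ℕP.+-comm x 1)

  GenTerm : Set
  GenTerm = Pol × Subset M × Fin M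

  evGens : (Mon → ℚ) → List GenTerm → ℚ
  evGens f Ls = Σ Ls (λ t → ev f (proj₁ t ⊗ gen rk 𝒢 (proj₁ (proj₂ t)) (proj₂ (proj₂ t))))

  -- `g` stands for the pattern-matching function inside `InIdeal`, which is accessible only through
  -- its values.
  ev-combination : ∀ f (g : GenTerm → Pol) → (∀ q S j → g (q , S , j) ≡ q ⊗ gen rk 𝒢 S j) →
                   ∀ Ls → ev f (sumP rk 𝒢 (L.map g Ls)) ≡ evGens f Ls
  ev-combination f g h Ls = trans (ev-sumP f (L.map g Ls)) (trans (QS.Σ-map g Ls)
    (QS.Σ-cong Ls λ { (q , S , j) → cong (ev f) (h q S j) }))

  ev-in-ideal : ∀ f p (g : GenTerm → Pol) → (∀ q S j → g (q , S , j) ≡ q ⊗ gen rk 𝒢 S j) →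
                ∀ Ls → (∀ μ → coeff rk 𝒢 p μ ≡ coeff rk 𝒢 (sumP rk 𝒢 (L.map g Ls)) μ) → ev f p ≡ evGens f Ls
  ev-in-ideal f p g h Ls eq = trans (ev-≈ f {p} {sumP rk 𝒢 (L.map g Ls)} eq) (ev-combination f g h Ls)

  -- Each monomial multiple of a generator is x^ν y_j^e with S inside the support of ν; hence e is
  -- at least `dd j ν`.
  ideal-annihilated : ∀ σ p → InIdeal rk 𝒢 p → ev (Dual.ℓ σ) p ≡ 0ℚ
  ideal-annihilated σ p (Ls , eq) = trans (ev-in-ideal ℓ p _ (λ _ _ _ → refl) Ls eq) (
    (QS.Σ-ε Ls λ { (q , S , j) _ → trans (ev-⊗ ℓ q (gen rk 𝒢 S j)) (QS.Σ-ε q λ t _ →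
      trans (cong (proj₁ t ℚ.*_) (trans (ev-gen ℓ (proj₂ t) S j)
        (ℓ-annihilates (proj₂ t ⊞ monoOf S) j _ (bound (proj₂ t) S j)))) (ℚP.*-zeroʳ (proj₁ t))) }))
    where
    open Dual σ
    bound : ∀ a S j → dd j (a ⊞ monoOf S) ≤ rk (G j) ∸ rk (sup S j)
    bound a S j = ℕP.∸-monoʳ-≤ (rk (G j)) (IsPolymatroid.monotone pm _ _
      (sup-least {S} {j} (sup-flat (supp (a ⊞ monoOf S)) j) λ i i∈ lt →
        sup-upper {supp (a ⊞ monoOf S)} (supp-⊞ʳ a (monoOf S) (supp-monoOf S i∈)) lt))

  -- Spanning and independence in degree i.

  module Basis (i : ℕ) (B : List Mon) (uB : Unique B)
               (B⁺ : ∀ ν → Std ν → V.sum ν ≡ i → ν ∈ₗ B) (B⁻ : ∀ ν → ν ∈ₗ B → Std ν × V.sum ν ≡ i) where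

    d : ℕ
    d = length B

    β : Fin d → Mon
    β = L.lookup B

    combo : (Mon → ℚ) → (Fin d → ℚ) → ℚ
    combo f c = Σ (allFin d) (λ k → c k ℚ.* f (β k))

    -- r vanishes modulo the ideal and the span of B; the equality of polynomials is
    -- tested on all linear functionals.
    Null : Pol → Set
    Null r = ∃ λ (c : Fin d → ℚ) → ∃ λ (Ls : List GenTerm) → ∀ f → ev f r ≡ combo f c ℚ.+ evGens f Ls

    null-≃ : ∀ r s → (∀ f → ev f r ≡ ev f s) → Null r → Null s
    null-≃ r s h (c , Ls , e) = c , Ls , λ f → trans (sym (h f)) (e f)

    null-0 : ∀ {r} → (∀ f → ev f r ≡ 0ℚ) → Null r
    null-0 h = (λ _ → 0ℚ) , [] , λ f → trans (h f) (sym (trans (ℚP.+-identityʳ (combo f λ _ → 0ℚ)) (QS.Σ-ε (allFin d) λ k _ → ℚP.*-zeroˡ (f (β k)))))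

    null-++ : ∀ {r s} → Null r → Null s → Null (r ++ s)
    null-++ {r} {s} (c , Ls , e) (c' , Ls' , e') = (λ k → c k ℚ.+ c' k) , Ls ++ Ls' , λ f →
      trans (ev-++ f r s) (trans (cong₂ ℚ._+_ (e f) (e' f)) (trans (QS.interchange (combo f c) (evGens f Ls) (combo f c') (evGens f Ls'))
        (cong₂ ℚ._+_ (sym (trans (QS.Σ-cong (allFin d) λ k → ℚP.*-distribʳ-+ (f (β k)) (c k) (c' k)) (QS.Σ-∙ (allFin d)))) (sym (QS.Σ-++ Ls Ls')))))

    null-scale : ∀ {r} a → Null r → Null (scaleP rk 𝒢 a r)
    null-scale {r} a (c , Ls , e) = (λ k → a ℚ.* c k) , L.map (λ t → scaleP rk 𝒢 a (proj₁ t) , proj₂ t) Ls , λ f →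
      trans (ev-scale f a r) (trans (cong (a ℚ.*_) (e f)) (trans (ℚP.*-distribˡ-+ a _ _) (cong₂ ℚ._+_
        (trans (QS.Σ-*ˡ (allFin d) a) (QS.Σ-cong (allFin d) λ k → sym (ℚP.*-assoc a (c k) (f (β k)))))
        (trans (QS.Σ-*ˡ Ls a) (trans (QS.Σ-cong Ls λ { (q , S , j) →
          sym (trans (ev-⊗ f (scaleP rk 𝒢 a q) (gen rk 𝒢 S j)) (trans (ev-scale (λ x → ev (λ b → f (x ⊞ b)) (gen rk 𝒢 S j)) a q) (cong (a ℚ.*_) (sym (ev-⊗ f q (gen rk 𝒢 S j)))))) })
          (sym (QS.Σ-map _ Ls)))))))

    infix 4 _~_
    _~_ : Pol → Pol → Set
    p ~ q = Null (p ++ negP rk 𝒢 q)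

    ev-diff : ∀ f p q → ev f (p ++ negP rk 𝒢 q) ≡ ev f p ℚ.- ev f q
    ev-diff f p q = trans (ev-++ f p (negP rk 𝒢 q)) (cong (ev f p ℚ.+_) (ev-neg f q))

    ≃⇒~ : ∀ {p q} → (∀ f → ev f p ≡ ev f q) → p ~ q
    ≃⇒~ {p} {q} h = null-0 {p ++ negP rk 𝒢 q} λ f → trans (ev-diff f p q) (trans (cong (ℚ._- ev f q) (h f)) (ℚP.+-inverseʳ (ev f q)))

    null⇒~ : ∀ {p} → Null p → p ~ []
    null⇒~ {p} = null-≃ p (p ++ negP rk 𝒢 []) λ f → sym (trans (ev-diff f p []) (ℚP.+-identityʳ _))

    ~⇒null : ∀ {p} → p ~ [] → Null p
    ~⇒null {p} = null-≃ (p ++ negP rk 𝒢 []) p λ f → trans (ev-diff f p []) (ℚP.+-identityʳ _)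

    open +-*-Solver using (solve; _:=_; _:+_; _:-_; _:*_; :-_; con)

    ~-sym : ∀ {p q} → p ~ q → q ~ p
    ~-sym {p} {q} h = null-≃ (negP rk 𝒢 (p ++ negP rk 𝒢 q)) (q ++ negP rk 𝒢 p) (λ f → trans (ev-neg f (p ++ negP rk 𝒢 q)) (trans (cong ℚ.-_ (ev-diff f p q))
        (trans (lemma (ev f p) (ev f q)) (sym (ev-diff f q p))))) (null-scale {p ++ negP rk 𝒢 q} (ℚ.- 1ℚ) h)
      where
      lemma : ∀ x y → ℚ.- (x ℚ.- y) ≡ y ℚ.- x
      lemma = solve 2 (λ x y → :- (x :- y) := y :- x) refl

    ~-trans : ∀ {p q r} → p ~ q → q ~ r → p ~ r
    ~-trans {p} {q} {r} h k = null-≃ ((p ++ negP rk 𝒢 q) ++ (q ++ negP rk 𝒢 r)) (p ++ negP rk 𝒢 r) (λ f → trans (ev-++ f (p ++ negP rk 𝒢 q) (q ++ negP rk 𝒢 r)) (trans (cong₂ ℚ._+_ (ev-diff f p q) (ev-diff f q r))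
        (trans (lemma (ev f p) (ev f q) (ev f r)) (sym (ev-diff f p r))))) (null-++ {p ++ negP rk 𝒢 q} {q ++ negP rk 𝒢 r} h k)
      where
      lemma : ∀ x y z → (x ℚ.- y) ℚ.+ (y ℚ.- z) ≡ x ℚ.- z
      lemma = solve 3 (λ x y z → (x :- y) :+ (y :- z) := x :- z) refl

    ~-cong : ∀ {p q r s} → p ~ q → r ~ s → p ++ r ~ q ++ s
    ~-cong {p} {q} {r} {s} h k = null-≃ ((p ++ negP rk 𝒢 q) ++ (r ++ negP rk 𝒢 s)) ((p ++ r) ++ negP rk 𝒢 (q ++ s)) (λ f → trans (ev-++ f (p ++ negP rk 𝒢 q) (r ++ negP rk 𝒢 s)) (trans (cong₂ ℚ._+_ (ev-diff f p q) (ev-diff f r s))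
        (trans (lemma (ev f p) (ev f q) (ev f r) (ev f s)) (sym (trans (ev-diff f (p ++ r) (q ++ s)) (cong₂ ℚ._-_ (ev-++ f p r) (ev-++ f q s)))))))
        (null-++ {p ++ negP rk 𝒢 q} {r ++ negP rk 𝒢 s} h k)
      where
      lemma : ∀ x y z w → (x ℚ.- y) ℚ.+ (z ℚ.- w) ≡ (x ℚ.+ z) ℚ.- (y ℚ.+ w)
      lemma = solve 4 (λ x y z w → (x :- y) :+ (z :- w) := (x :+ z) :- (y :+ w)) refl

    -- Polynomials modulo the ideal and the span of B, packaged as a value monoid for `Y`, so that
    -- `Y-lead` applies to the map `mono` itself.
    quotient : CommutativeMonoid 0ℓ 0ℓ
    quotient = record
      { Carrier = Pol ; _≈_ = _~_ ; _∙_ = _++_ ; ε = []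
      ; isCommutativeMonoid = record
        { isMonoid = record
          { isSemigroup = record
            { isMagma = record
              { isEquivalence = record
                { refl = λ {p} → ≃⇒~ {p} {p} λ _ → refl
                ; sym = λ {p} {q} → ~-sym {p} {q}
                ; trans = λ {p} {q} {r} → ~-trans {p} {q} {r} }
              ; ∙-cong = λ {p} {q} {r} {s} → ~-cong {p} {q} {r} {s} }
            ; assoc = λ p q r → ≃⇒~ {(p ++ q) ++ r} {p ++ (q ++ r)} λ f → trans (ev-++ f (p ++ q) r) (trans (cong (ℚ._+ ev f r) (ev-++ f p q))
                (trans (ℚP.+-assoc (ev f p) (ev f q) (ev f r)) (sym (trans (ev-++ f p (q ++ r)) (cong (ev f p ℚ.+_) (ev-++ f q r)))))) }
          ; identity = (λ p → ≃⇒~ {p} {p} λ _ → refl) ,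
              λ p → ≃⇒~ {p ++ []} {p} λ f → trans (ev-++ f p []) (ℚP.+-identityʳ _) }
        ; comm = λ p q → ≃⇒~ {p ++ q} {q ++ p} λ f → trans (ev-++ f p q) (trans (ℚP.+-comm (ev f p) (ev f q)) (sym (ev-++ f q p))) } }

    private
      module QV = Values quotient
      module QM = MonoidSum quotient

    ev-Y : ∀ f j e ν → ev f (QV.Y j e mono ν) ≡ Y j e f ν
    ev-Y f j zero ν = ev-mono f ν
    ev-Y f j (suc e) ν = trans (ev-Σ (allFin M) _) (QS.Σ-cong (allFin M) λ h → trans (ev-▹ (G j ⊆? G h)) (QS.▹-congʳ (G j ⊆? G h) λ _ → ev-Y f j e (ν ⊞ unit h 1)))
      where
      ev-Σ : ∀ (hs : List (Fin M)) g → ev f (QM.Σ hs g) ≡ Σ hs (λ h → ev f (g h))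
      ev-Σ [] g = refl
      ev-Σ (h ∷ hs) g = trans (ev-++ f (g h) (QM.Σ hs g)) (cong (ev f (g h) ℚ.+_) (ev-Σ hs g))
      ev-▹ : ∀ {P : Set} (dec : Dec P) {x} → ev f (dec QM.▹ x) ≡ dec ▹ ev f x
      ev-▹ (yes _) = refl
      ev-▹ (no _) = refl

    -- A monomial times a single generator, the one with S = supp ν, after the squarefree part of
    -- x^ν has been split off.
    relation~0 : ∀ ν j → QV.Y j (dd j ν) mono ν ~ []
    relation~0 ν j = null⇒~ {QV.Y j (dd j ν) mono ν} ((λ _ → 0ℚ) , (mono (V.map ℕ.pred ν) , supp ν , j) ∷ [] , λ f →
      trans (ev-Y f j (dd j ν) ν) (sym (trans (cong₂ ℚ._+_ (QS.Σ-ε (allFin d) λ k _ → ℚP.*-zeroˡ (f (β k))) (ℚP.+-identityʳ (ev f (mono (V.map ℕ.pred ν) ⊗ gen rk 𝒢 (supp ν) j))))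
        (trans (ℚP.+-identityˡ (ev f (mono (V.map ℕ.pred ν) ⊗ gen rk 𝒢 (supp ν) j))) (trans (ev-⊗ f (mono (V.map ℕ.pred ν)) (gen rk 𝒢 (supp ν) j))
        (trans (ev-mono (λ a → ev (λ b → f (a ⊞ b)) (gen rk 𝒢 (supp ν) j)) (V.map ℕ.pred ν)) (trans (ev-gen f (V.map ℕ.pred ν) (supp ν) j) (cong (Y j (dd j ν) f) (monoOf-supp-≤ ν)))))))))

    std-null : ∀ μ → Std μ → V.sum μ ≡ i → Null (mono μ)
    std-null μ std deg = (λ k → (k Fin.≟ k₀) ▹ 1ℚ) , [] , λ f → trans (ev-mono f μ) (sym (trans (ℚP.+-identityʳ _)
      (trans (QS.Σ-single (allFin d) k₀ (UniqueP.allFin⁺ d) (∈-allFin k₀)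
          λ k ne → trans (cong (ℚ._* f (β k)) (QS.▹-no (k Fin.≟ k₀) ne)) (ℚP.*-zeroˡ (f (β k))))
        (trans (cong (ℚ._* f (β k₀)) (QS.▹-yes (k₀ Fin.≟ k₀) refl)) (trans (ℚP.*-identityˡ (f (β k₀))) (cong f (sym (lookup-index μ∈))))))))
      where
      μ∈ = B⁺ μ std deg
      k₀ = Any.index μ∈

    -- Straightening by induction on weight: a nonstandard μ leads a multiple of a generator whose
    -- other monomials are lighter and of the same degree.
    mono-null : ∀ w μ → W μ < w → V.sum μ ≡ i → mono μ ~ []
    mono-null (suc w) μ (s≤s le) deg with violation? μ
    ... | no ¬v = null⇒~ {mono μ} (std-null μ (λ j → ℕP.≰⇒> λ v → ¬v (j , v)) deg)
    ... | yes (j , v) = ~-trans {mono μ} {QV.Y j e mono ν} {[]}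
        (~-sym {QV.Y j e mono ν} {mono μ} (subst (λ z → QV.Y j e mono ν ~ mono z) ν+e≡μ (QV.Y-lead j e ν lower)))
        (subst (λ z → QV.Y j z mono ν ~ []) dd≡ (relation~0 ν j))
      where
      a = V.lookup μ j
      e = dd j μ
      -- Only e of the factors x_j become y_j. The exponent demanded at the remaining monomial is
      -- again e, because x_j itself does not count towards sup at j.
      ν = drop j μ ⊞ unit j (a ∸ e)
      ν+e≡μ : ν ⊞ unit j e ≡ μ
      ν+e≡μ = trans (⊞-assoc (drop j μ) (unit j (a ∸ e)) (unit j e)) (trans (cong (drop j μ ⊞_) (trans (unit-+ j (a ∸ e) e) (cong (unit j) (ℕP.m∸n+n≡m v)))) (drop-⊞-unit j μ))
      dd≡ : dd j ν ≡ e
      dd≡ = ℕP.≤-antisym (ℕP.≤-trans (dd-⊞ (drop j μ) (unit j (a ∸ e))) (dd-drop j μ)) (subst (λ z → dd j z ≤ dd j ν) ν+e≡μ (dd-⊞ ν (unit j e)))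
      deg-ν : V.sum ν + e ≡ i
      deg-ν = trans (cong (V.sum ν +_) (sym (sum-unit j e))) (trans (sym (sum-⊞ ν (unit j e))) (trans (cong V.sum ν+e≡μ) deg))
      W-ν : W ν + e * wt j ≡ W μ
      W-ν = trans (cong (W ν +_) (sym (W-unit j e))) (trans (sym (W-⊞ ν (unit j e))) (cong W ν+e≡μ))
      lower : ∀ τ → V.sum τ ≡ e → W τ < e * wt j → mono (ν ⊞ τ) ~ []
      lower τ dτ lt = mono-null w (ν ⊞ τ)
        (ℕP.<-≤-trans (ℕP.≤-<-trans (ℕP.≤-reflexive (W-⊞ ν τ)) (ℕP.<-≤-trans (ℕP.+-monoʳ-< (W ν) lt) (ℕP.≤-reflexive W-ν))) le)
        (trans (sum-⊞ ν τ) (trans (cong (V.sum ν +_) dτ) deg-ν))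

    homogeneous-null : ∀ p → Homogeneous rk 𝒢 i p → Null p
    homogeneous-null p hom = null-≃ (expand D) p (λ f → trans (ev-expand f D) (sym (ev-by-coeff f D p u λ t t∈ → ∈-deduplicate⁺ _≟ᵥ_ (∈-map⁺ proj₂ t∈)))) (expand-null D)
      where
      D = monomials p
      u : Unique D
      u = UniqueDec.deduplicate-! _≟ᵥ_ (L.map proj₂ p)
      expand : List Mon → Pol
      expand [] = []
      expand (μ ∷ D) = scaleP rk 𝒢 (coeff rk 𝒢 p μ) (mono μ) ++ expand D
      ev-expand : ∀ f D → ev f (expand D) ≡ Σ D (λ μ → coeff rk 𝒢 p μ ℚ.* f μ)
      ev-expand f [] = refl
      ev-expand f (μ ∷ D) = trans (ev-++ f (scaleP rk 𝒢 (coeff rk 𝒢 p μ) (mono μ)) (expand D))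
        (cong₂ ℚ._+_ (trans (ev-scale f (coeff rk 𝒢 p μ) (mono μ)) (cong (coeff rk 𝒢 p μ ℚ.*_) (ev-mono f μ))) (ev-expand f D))
      expand-null : ∀ D → Null (expand D)
      expand-null [] = null-0 {[]} λ _ → refl
      expand-null (μ ∷ D) = null-++ {scaleP rk 𝒢 (coeff rk 𝒢 p μ) (mono μ)} {expand D} (term (coeff rk 𝒢 p μ ℚP.≟ 0ℚ)) (expand-null D)
        where
        -- Homogeneity says nothing about a listed monomial whose terms cancel; its contribution is
        -- zero instead.
        term : Dec (coeff rk 𝒢 p μ ≡ 0ℚ) → Null (scaleP rk 𝒢 (coeff rk 𝒢 p μ) (mono μ))
        term (yes z) = null-0 {scaleP rk 𝒢 (coeff rk 𝒢 p μ) (mono μ)} λ f → trans (ev-scale f (coeff rk 𝒢 p μ) (mono μ)) (trans (cong (ℚ._* ev f (mono μ)) z) (ℚP.*-zeroˡ (ev f (mono μ))))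
        term (no nz) = null-scale {mono μ} (coeff rk 𝒢 p μ) (~⇒null {mono μ} (mono-null (suc (W μ)) μ (ℕP.n<1+n _) (hom μ nz)))

    basis : Fin d → Pol
    basis k = mono (β k)

    ev-lincomb : ∀ f c → ev f (lincomb rk 𝒢 c basis) ≡ combo f c
    ev-lincomb f c = trans (ev-sumP f (L.map _ (allFin d))) (trans (QS.Σ-map _ (allFin d))
      (QS.Σ-cong (allFin d) λ k → trans (ev-scale f (c k) (basis k)) (cong (c k ℚ.*_) (ev-mono f (β k)))))

    in-ideal : ∀ p Ls → (∀ f → ev f p ≡ evGens f Ls) → InIdeal rk 𝒢 p
    in-ideal p Ls h = Ls , λ μ → trans (coeff≡ev p μ) (trans (h (at μ))
      (trans (sym (ev-combination (at μ) _ (λ _ _ _ → refl) Ls)) (sym (coeff≡ev (sumP rk 𝒢 (L.map _ Ls)) μ))))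

    chow-dim : ChowDim rk 𝒢 i d
    chow-dim = basis , homogeneous , spanning , independent
      where
      homogeneous : ∀ k → Homogeneous rk 𝒢 i (basis k)
      homogeneous k μ nz with β k ≟ᵥ μ
      ... | yes refl = proj₂ (B⁻ (β k) (∈-lookup k))
      ... | no _ = ⊥-elim (nz refl)
      spanning : ∀ p → Homogeneous rk 𝒢 i p → ∃ λ c → InIdeal rk 𝒢 (_+P_ rk 𝒢 p (negP rk 𝒢 (lincomb rk 𝒢 c basis)))
      spanning p hom with homogeneous-null p hom
      ... | c , Ls , e = c , in-ideal (p ++ negP rk 𝒢 (lincomb rk 𝒢 c basis)) Ls λ f → trans (ev-diff f p (lincomb rk 𝒢 c basis))
          (trans (cong₂ ℚ._-_ (e f) (ev-lincomb f c)) (lemma (combo f c) (evGens f Ls)))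
        where
        lemma : ∀ x y → (x ℚ.+ y) ℚ.- x ≡ y
        lemma = solve 2 (λ x y → (x :+ y) :- x := y) refl
      independent : ∀ c → InIdeal rk 𝒢 (lincomb rk 𝒢 c basis) → ∀ k → c k ≡ 0ℚ
      independent c inI k = trans (sym (trans (QS.Σ-single (allFin d) k (UniqueP.allFin⁺ d) (∈-allFin k) off)
          (trans (cong (c k ℚ.*_) (trans (value k) (QS.▹-yes (VP.≡-dec ℕP._≟_ (β k) (β k)) refl))) (ℚP.*-identityʳ (c k)))))
          (trans (sym (ev-lincomb ℓ c)) (ideal-annihilated (β k) (lincomb rk 𝒢 c basis) inI))
        where
        open Dual (β k)
        value : ∀ h → ℓ (β h) ≡ δ (β h)
        value h = ℓ-std (β h) (proj₁ (B⁻ (β h) (∈-lookup h)))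
        off : ∀ h → h ≢ k → c h ℚ.* ℓ (β h) ≡ 0ℚ
        off h ne = trans (cong (c h ℚ.*_) (trans (value h) (QS.▹-no (VP.≡-dec ℕP._≟_ (β h) (β k)) (ne ∘ lookup-inj uB h k)))) (ℚP.*-zeroʳ (c h))

-- Integer polynomials

open import Data.Integer using (+_)

module ZS = RingSum ℤP.+-*-commutativeRing

-- A coefficient list is identified with the functional f ↦ Σ aₖ f(k), which turns the ring
-- laws of Polyℤ into exchanges of summation.
pair : (ℕ → ℤ) → Polyℤ → ℤ
pair f [] = + 0
pair f (a ∷ p) = a ℤ.* f 0 ℤ.+ pair (f ∘ suc) p

pair-cong : ∀ {f g} p → (∀ k → f k ≡ g k) → pair f p ≡ pair g p
pair-cong [] h = refl
pair-cong (a ∷ p) h = cong₂ ℤ._+_ (cong (a ℤ.*_) (h 0)) (pair-cong p (h ∘ suc))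

pair-⊕ : ∀ f p q → pair f (p ⊕ q) ≡ pair f p ℤ.+ pair f q
pair-⊕ f [] q = sym (ℤP.+-identityˡ _)
pair-⊕ f (a ∷ p) [] = sym (ℤP.+-identityʳ _)
pair-⊕ f (a ∷ p) (b ∷ q) = trans (cong (λ z → (a ℤ.+ b) ℤ.* f 0 ℤ.+ z) (pair-⊕ (f ∘ suc) p q)) (lemma a b (f 0) _ _)
  where
  lemma : ∀ a b x y z → (a ℤ.+ b) ℤ.* x ℤ.+ (y ℤ.+ z) ≡ (a ℤ.* x ℤ.+ y) ℤ.+ (b ℤ.* x ℤ.+ z)
  lemma = ℤRing.solve-∀

pair-scale : ∀ f a p → pair f (L.map (a ℤ.*_) p) ≡ a ℤ.* pair f p
pair-scale f a [] = sym (ℤP.*-zeroʳ a)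
pair-scale f a (b ∷ p) = trans (cong₂ ℤ._+_ (ℤP.*-assoc a b (f 0)) (pair-scale (f ∘ suc) a p)) (sym (ℤP.*-distribˡ-+ a _ _))

pair-+ : ∀ f g p → pair (λ k → f k ℤ.+ g k) p ≡ pair f p ℤ.+ pair g p
pair-+ f g [] = refl
pair-+ f g (a ∷ p) = trans (cong (λ z → a ℤ.* (f 0 ℤ.+ g 0) ℤ.+ z) (pair-+ (f ∘ suc) (g ∘ suc) p)) (lemma a (f 0) (g 0) _ _)
  where
  lemma : ∀ a x y z w → a ℤ.* (x ℤ.+ y) ℤ.+ (z ℤ.+ w) ≡ (a ℤ.* x ℤ.+ z) ℤ.+ (a ℤ.* y ℤ.+ w)
  lemma = ℤRing.solve-∀

pair-* : ∀ c f p → pair (λ k → c ℤ.* f k) p ≡ c ℤ.* pair f p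
pair-* c f [] = sym (ℤP.*-zeroʳ c)
pair-* c f (a ∷ p) = trans (cong (λ z → a ℤ.* (c ℤ.* f 0) ℤ.+ z) (pair-* c (f ∘ suc) p)) (lemma c a (f 0) _)
  where
  lemma : ∀ c a x y → a ℤ.* (c ℤ.* x) ℤ.+ c ℤ.* y ≡ c ℤ.* (a ℤ.* x ℤ.+ y)
  lemma = ℤRing.solve-∀

pair-0 : ∀ p → pair (λ _ → + 0) p ≡ + 0
pair-0 [] = refl
pair-0 (a ∷ p) = trans (cong₂ ℤ._+_ (ℤP.*-zeroʳ a) (pair-0 p)) refl

pair-⊛ : ∀ f p q → pair f (p ⊛ q) ≡ pair (λ i → pair (λ j → f (i ℕ.+ j)) q) p
pair-⊛ f [] q = refl
pair-⊛ f (a ∷ p) q = trans (pair-⊕ f (L.map (a ℤ.*_) q) (+ 0 ∷ (p ⊛ q)))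
  (cong₂ ℤ._+_ (pair-scale f a q) (trans (ℤP.+-identityˡ _) (pair-⊛ (f ∘ suc) p q)))

pair-swap : ∀ (F : ℕ → ℕ → ℤ) p q → pair (λ i → pair (F i) q) p ≡ pair (λ j → pair (λ i → F i j) p) q
pair-swap F [] q = sym (pair-0 q)
pair-swap F (a ∷ p) q = trans (cong₂ ℤ._+_ (sym (pair-* a (F 0) q)) (pair-swap (F ∘ suc) p q))
  (sym (pair-+ (λ j → a ℤ.* F 0 j) (λ j → pair (λ i → F (suc i) j) p) q))

infix 4 _≃_
-- Agreement under all functionals ignores trailing zeros of coefficient lists. The record lets the
-- two polynomials be inferred from the type.
record _≃_ (p q : Polyℤ) : Set where
  constructor ext
  field
    pair≡ : ∀ f → pair f p ≡ pair f q

open _≃_ public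

oneℤ : Polyℤ
oneℤ = + 1 ∷ []

pair-one : ∀ f → pair f oneℤ ≡ f 0
pair-one f = trans (ℤP.+-identityʳ _) (ℤP.*-identityˡ (f 0))

polyRing : CommutativeRing 0ℓ 0ℓ
polyRing = record
  { Carrier = Polyℤ ; _≈_ = _≃_ ; _+_ = _⊕_ ; _*_ = _⊛_ ; -_ = L.map (ℤ.- (+ 1) ℤ.*_) ; 0# = [] ; 1# = oneℤ
  ; isCommutativeRing = record
    { isRing = record
      { +-isAbelianGroup = record
        { isGroup = record
          { isMonoid = record
            { isSemigroup = record
              { isMagma = record
                { isEquivalence = record { refl = ext λ _ → refl ; sym = λ h → ext λ f → sym (pair≡ h f) ; trans = λ h k → ext λ f → trans (pair≡ h f) (pair≡ k f) }
                ; ∙-cong = λ {p} {q} {r} {s} h k → ext λ f → trans (pair-⊕ f p r) (trans (cong₂ ℤ._+_ (pair≡ h f) (pair≡ k f)) (sym (pair-⊕ f q s))) }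
              ; assoc = λ p q r → ext λ f → trans (pair-⊕ f (p ⊕ q) r) (trans (cong (ℤ._+ pair f r) (pair-⊕ f p q))
                  (trans (ℤP.+-assoc (pair f p) (pair f q) (pair f r)) (sym (trans (pair-⊕ f p (q ⊕ r)) (cong (λ z → pair f p ℤ.+ z) (pair-⊕ f q r)))))) }
            ; identity = (λ p → ext λ f → refl) , λ p → ext λ f → trans (pair-⊕ f p []) (ℤP.+-identityʳ _) }
          ; inverse = (λ p → ext λ f → trans (pair-⊕ f (L.map (ℤ.- (+ 1) ℤ.*_) p) p) (trans (cong (ℤ._+ pair f p) (pair-scale f (ℤ.- (+ 1)) p)) (invˡ (pair f p)))) ,
                      (λ p → ext λ f → trans (pair-⊕ f p (L.map (ℤ.- (+ 1) ℤ.*_) p)) (trans (cong (λ z → pair f p ℤ.+ z) (pair-scale f (ℤ.- (+ 1)) p)) (invʳ (pair f p))))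
          ; ⁻¹-cong = λ {p} {q} h → ext λ f → trans (pair-scale f (ℤ.- (+ 1)) p) (trans (cong (ℤ.- (+ 1) ℤ.*_) (pair≡ h f)) (sym (pair-scale f (ℤ.- (+ 1)) q))) }
        ; comm = λ p q → ext λ f → trans (pair-⊕ f p q) (trans (ℤP.+-comm (pair f p) (pair f q)) (sym (pair-⊕ f q p))) }
      ; *-cong = λ {p} {q} {r} {s} h k → ext λ f → trans (pair-⊛ f p r) (trans (pair≡ h _) (trans (pair-cong q λ i → pair≡ k _) (sym (pair-⊛ f q s))))
      ; *-assoc = λ p q r → ext λ f → trans (pair-⊛ f (p ⊛ q) r) (trans (pair-⊛ _ p q)
          (sym (trans (pair-⊛ f p (q ⊛ r)) (pair-cong p λ i → trans (pair-⊛ (λ j → f (i ℕ.+ j)) q r)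
            (pair-cong q λ j → pair-cong r λ k → cong f (sym (ℕP.+-assoc i j k)))))))
      ; *-identity = (λ p → ext λ f → trans (pair-⊛ f oneℤ p) (pair-one λ i → pair (λ j → f (i ℕ.+ j)) p)) ,
          λ p → ext λ f → trans (pair-⊛ f p oneℤ) (pair-cong p λ i → trans (pair-one λ j → f (i ℕ.+ j)) (cong f (ℕP.+-identityʳ i)))
      ; distrib = (λ p q r → ext λ f → trans (pair-⊛ f p (q ⊕ r)) (trans (pair-cong p λ i → pair-⊕ (λ j → f (i ℕ.+ j)) q r)
            (trans (pair-+ _ _ p) (sym (trans (pair-⊕ f (p ⊛ q) (p ⊛ r)) (cong₂ ℤ._+_ (pair-⊛ f p q) (pair-⊛ f p r))))))) ,
          λ p q r → ext λ f → trans (pair-⊛ f (q ⊕ r) p) (trans (pair-⊕ _ q r) (sym (trans (pair-⊕ f (q ⊛ p) (r ⊛ p)) (cong₂ ℤ._+_ (pair-⊛ f q p) (pair-⊛ f r p)))))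
      }
    ; *-comm = λ p q → ext λ f → trans (pair-⊛ f p q) (trans (pair-swap (λ i j → f (i ℕ.+ j)) p q)
        (trans (pair-cong q λ j → pair-cong p λ i → cong f (ℕP.+-comm i j)) (sym (pair-⊛ f q p)))) } }
  where
  invˡ : ∀ x → (ℤ.- (+ 1)) ℤ.* x ℤ.+ x ≡ + 0
  invˡ = ℤRing.solve-∀
  invʳ : ∀ x → x ℤ.+ (ℤ.- (+ 1)) ℤ.* x ≡ + 0
  invʳ = ℤRing.solve-∀

module PS = RingSum polyRing

sumPolyℤ≃Σ : ∀ {A : Set} (g : A → Polyℤ) xs → sumPolyℤ (L.map g xs) ≃ PS.Σ xs g
sumPolyℤ≃Σ g [] = ext λ _ → refl
sumPolyℤ≃Σ g (x ∷ xs) = PS.+-congˡ (sumPolyℤ≃Σ g xs)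

prodPolyℤ≃Π : ∀ {A : Set} (g : A → Polyℤ) xs → prodPolyℤ (L.map g xs) ≃ PS.Π xs g
prodPolyℤ≃Π g [] = ext λ _ → refl
prodPolyℤ≃Π g (x ∷ xs) = PS.*-congˡ {g x} (prodPolyℤ≃Π g xs)

pair-Σ : ∀ {A : Set} f (xs : List A) g → pair f (PS.Σ xs g) ≡ ZS.Σ xs (λ x → pair f (g x))
pair-Σ f [] g = refl
pair-Σ f (x ∷ xs) g = trans (pair-⊕ f (g x) (PS.Σ xs g)) (cong (λ z → pair f (g x) ℤ.+ z) (pair-Σ f xs g))

pair-▹ : ∀ f {P : Set} (d : Dec P) p → pair f (d PS.▹ p) ≡ d ZS.▹ pair f p
pair-▹ f (yes _) p = refl
pair-▹ f (no _) p = refl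

pair-mono : ∀ f c k → pair f (monoℤ c k) ≡ c ℤ.* f k
pair-mono f c zero = ℤP.+-identityʳ _
pair-mono f c (suc k) = trans (ℤP.+-identityˡ _) (pair-mono (f ∘ suc) c k)

coeffℤ≡pair : ∀ p i → coeffℤ p i ≡ pair (λ k → (k ℕP.≟ i) ZS.▹ + 1) p
coeffℤ≡pair [] i = refl
coeffℤ≡pair (a ∷ p) zero = sym (trans (cong₂ ℤ._+_ (ℤP.*-identityʳ a) (trans (pair-cong p λ k → ZS.▹-no (suc k ℕP.≟ 0) {+ 1} λ ()) (pair-0 p))) (ℤP.+-identityʳ a))
coeffℤ≡pair (a ∷ p) (suc i) = trans (coeffℤ≡pair p i) (sym (trans (cong₂ ℤ._+_ (ℤP.*-zeroʳ a) (pair-cong p λ k →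
    ZS.▹-cong (suc k ℕP.≟ suc i) (k ℕP.≟ i) ℕP.suc-injective (cong suc) λ _ → refl)) (ℤP.+-identityˡ _)))

-- The value of f on (x^k - 1)/(x - 1) = 1 + x + ... + x^(k-1).
prefix : (ℕ → ℤ) → ℕ → ℤ
prefix f zero = + 0
prefix f (suc k) = f 0 ℤ.+ prefix (f ∘ suc) k

sumℤ≡pair : ∀ p c → sumℤ p ℤ.* c ≡ pair (λ _ → c) p
sumℤ≡pair [] c = refl
sumℤ≡pair (a ∷ p) c = trans (ℤP.*-distribʳ-+ c a (sumℤ p)) (cong (λ z → a ℤ.* c ℤ.+ z) (sumℤ≡pair p c))

-- `divXm1` discards the remainder p(1), so it is linear and sends x^k to (x^k - 1)/(x - 1) whether
-- or not the division of p is exact.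
pair-divXm1 : ∀ f p → pair f (divXm1 p) ≡ pair (prefix f) p
pair-divXm1 f [] = refl
pair-divXm1 f (a ∷ []) = sym (trans (ℤP.+-identityʳ (a ℤ.* + 0)) (ℤP.*-zeroʳ a))
pair-divXm1 f (a ∷ b ∷ p) = begin
  (b ℤ.+ sumℤ p) ℤ.* f 0 ℤ.+ pair (f ∘ suc) (divXm1 (b ∷ p))
    ≡⟨ cong₂ ℤ._+_ (sumℤ≡pair (b ∷ p) (f 0)) (pair-divXm1 (f ∘ suc) (b ∷ p)) ⟩
  pair (λ _ → f 0) (b ∷ p) ℤ.+ pair (prefix (f ∘ suc)) (b ∷ p)
    ≡⟨ pair-+ (λ _ → f 0) (prefix (f ∘ suc)) (b ∷ p) ⟨
  pair (λ k → prefix f (suc k)) (b ∷ p)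
    ≡⟨ ℤP.+-identityˡ _ ⟨
  + 0 ℤ.+ pair (λ k → prefix f (suc k)) (b ∷ p)
    ≡⟨ cong (ℤ._+ pair (λ k → prefix f (suc k)) (b ∷ p)) (ℤP.*-zeroʳ a) ⟨
  pair (prefix f) (a ∷ b ∷ p) ∎
  where open ≡-Reasoning

pair-redCharPoly : ∀ {n} f E (r : Subset n → ℕ) →
  pair f (redCharPoly E r) ≡ ZS.Σ (flatsOf E r) (λ A → mobius E r A ℤ.* prefix f (r E ∸ r A))
pair-redCharPoly f E r = trans (pair-divXm1 f (charPoly E r)) (trans (pair≡ (sumPolyℤ≃Σ _ (flatsOf E r)) (prefix f))
  (trans (pair-Σ (prefix f) (flatsOf E r) _) (ZS.Σ-cong (flatsOf E r) λ A → pair-mono (prefix f) (mobius E r A) (r E ∸ r A))))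

sumℤ≡Σ : ∀ {A : Set} (g : A → ℤ) xs → sumℤ (L.map g xs) ≡ ZS.Σ xs g
sumℤ≡Σ g [] = refl
sumℤ≡Σ g (x ∷ xs) = cong (λ z → g x ℤ.+ z) (sumℤ≡Σ g xs)

-- The Möbius function of a set function.

module Mobius {n : ℕ} (E : Subset n) (r : Subset n → ℕ) where

  private FL = flatsOf E r

  -- The recursion passes to strictly smaller sets, so any fuel exceeding |A| gives the same value.
  fuel-stable : ∀ k k' A → ∣ A ∣ ≤ k → ∣ A ∣ ≤ k' → mobiusFuel (suc k) FL A ≡ mobiusFuel (suc k') FL A
  fuel-stable k k' A le le' with A == ⊥
  ... | true = refl
  ... | false = cong ℤ.-_ (trans (sumℤ≡Σ (mobiusFuel k FL) below) (trans (ZS.Σ-cong∈ below (λ A' h → step k k' A' le le'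
      (⊏⇒∣<∣ (⊂ᵇ⁻ {A = A'} {A} (proj₂ (∈-filterᵇ⁻ (_⊂ᵇ A) {FL} h)))))) (sym (sumℤ≡Σ (mobiusFuel k' FL) below))))
    where
    below = filterᵇ (_⊂ᵇ A) FL
    step : ∀ k k' A' → ∣ A ∣ ≤ k → ∣ A ∣ ≤ k' → ∣ A' ∣ < ∣ A ∣ → mobiusFuel k FL A' ≡ mobiusFuel k' FL A'
    step zero k' A' le le' lt = ⊥-elim (ℕP.n≮0 (ℕP.<-≤-trans lt le))
    step (suc k) zero A' le le' lt = ⊥-elim (ℕP.n≮0 (ℕP.<-≤-trans lt le'))
    step (suc k) (suc k') A' le le' lt = fuel-stable k k' A' (ℕP.≤-pred (ℕP.<-≤-trans lt le)) (ℕP.≤-pred (ℕP.<-≤-trans lt le'))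

  mobius-⊥ : mobius E r ⊥ ≡ + 1
  mobius-⊥ with _==_ {n} ⊥ ⊥ in eq
  ... | true = refl
  ... | false = ⊥-elim (subst T eq (==⁺ {n} {⊥} refl))

  mobius-rec : ∀ A → A ≢ ⊥ → mobius E r A ≡ ℤ.- ZS.Σ (filterᵇ (_⊂ᵇ A) FL) (mobius E r)
  mobius-rec A ne with A == ⊥ in eq
  ... | true = ⊥-elim (ne (==⁻ {A = A} {⊥} (subst T (sym eq) _)))
  ... | false = cong ℤ.-_ (trans (sumℤ≡Σ (mobiusFuel n FL) below) (ZS.Σ-cong∈ below λ A' h →
      step (ℕP.<-≤-trans (⊏⇒∣<∣ (⊂ᵇ⁻ {A = A'} {A} (proj₂ (∈-filterᵇ⁻ (_⊂ᵇ A) {FL} h)))) (∣p∣≤n A))))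
    where
    below = filterᵇ (_⊂ᵇ A) FL
    step : ∀ {k A'} → ∣ A' ∣ < k → mobiusFuel k FL A' ≡ mobiusFuel (suc k) FL A'
    step {suc k} {A'} (s≤s lt) = fuel-stable k (suc k) A' lt (ℕP.m≤n⇒m≤1+n lt)

  flatIn? : ∀ A → Dec (T (isFlatIn E r A))
  flatIn? A = T? (isFlatIn E r A)

  mobius-sum : ∀ B → T (isFlatIn E r B) → B ≢ ⊥ →
               ZS.Σ (allSubsets n) (λ A → (flatIn? A ×-dec (A ⊆? B)) ZS.▹ mobius E r A) ≡ + 0
  mobius-sum B fB ne = begin
    ZS.Σ S (λ A → (flatIn? A ×-dec (A ⊆? B)) ZS.▹ μ A)
      ≡⟨ ZS.Σ-cong S (λ A → part A (A ≟ₛ B)) ⟩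
    ZS.Σ S (λ A → (((A ≟ₛ B) ZS.▹ μ A) ℤ.+ (flatIn? A ZS.▹ (T? (A ⊂ᵇ B) ZS.▹ μ A))))
      ≡⟨ ZS.Σ-∙ S ⟩
    ZS.Σ S (λ A → (A ≟ₛ B) ZS.▹ μ A) ℤ.+ ZS.Σ S (λ A → flatIn? A ZS.▹ (T? (A ⊂ᵇ B) ZS.▹ μ A))
      ≡⟨ cong₂ ℤ._+_ (trans (ZS.Σ-single S B (allSubsets-unique n) (allSubsets-complete B) λ A ne → ZS.▹-no (A ≟ₛ B) ne) (ZS.▹-yes (B ≟ₛ B) refl))
           (trans (sym (ZS.Σ-filterᵇ (isFlatIn E r) S)) (sym (ZS.Σ-filterᵇ (_⊂ᵇ B) FL))) ⟩
    μ B ℤ.+ ZS.Σ (filterᵇ (_⊂ᵇ B) FL) μ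
      ≡⟨ cong (ℤ._+ ZS.Σ (filterᵇ (_⊂ᵇ B) FL) μ) (mobius-rec B ne) ⟩
    (ℤ.- ZS.Σ (filterᵇ (_⊂ᵇ B) FL) μ) ℤ.+ ZS.Σ (filterᵇ (_⊂ᵇ B) FL) μ
      ≡⟨ ℤP.+-inverseˡ (ZS.Σ (filterᵇ (_⊂ᵇ B) FL) μ) ⟩
    + 0 ∎
    where
    open ≡-Reasoning
    S = allSubsets n
    μ = mobius E r
    part : ∀ A → Dec (A ≡ B) → (flatIn? A ×-dec (A ⊆? B)) ZS.▹ μ A ≡ ((A ≟ₛ B) ZS.▹ μ A) ℤ.+ (flatIn? A ZS.▹ (T? (A ⊂ᵇ B) ZS.▹ μ A))
    part A (yes refl) = trans (ZS.▹-yes (flatIn? A ×-dec (A ⊆? A)) (fB , id)) (sym (trans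
      (cong₂ ℤ._+_ (ZS.▹-yes (A ≟ₛ A) refl) (ZS.▹-ε (flatIn? A) λ _ → ZS.▹-no (T? (A ⊂ᵇ A)) λ t → proj₂ (⊂ᵇ⁻ {A = A} {A} t) refl)) (ℤP.+-identityʳ _)))
    part A (no A≢B) = trans (ZS.▹-× (flatIn? A) (A ⊆? B)) (trans (ZS.▹-congʳ (flatIn? A) λ _ →
        ZS.▹-cong (A ⊆? B) (T? (A ⊂ᵇ B)) (λ s → ⊂ᵇ⁺ {A = A} {B} (s , A≢B)) (λ t → proj₁ (⊂ᵇ⁻ {A = A} {B} t)) λ _ → refl)
      (sym (trans (cong (ℤ._+ (flatIn? A ZS.▹ (T? (A ⊂ᵇ B) ZS.▹ μ A))) (ZS.▹-no (A ≟ₛ B) A≢B)) (ℤP.+-identityˡ _))))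

-- Reduced characteristic polynomials of minors

∈─⁻ : ∀ {n} (A B : Subset n) {e} → e ∈ A ─ B → e ∈ A × e ∉ B
∈─⁻ A B {e} h = p─q⊆p A B h , λ e∈B → ∉⊥ (subst (e ∈_) (p─p≡⊥ B) (mono h e∈B))
  where
  p─p≡⊥ : ∀ {n} (B : Subset n) → B ─ B ≡ ⊥
  p─p≡⊥ V.[] = refl
  p─p≡⊥ (true V.∷ B) = cong (false V.∷_) (p─p≡⊥ B)
  p─p≡⊥ (false V.∷ B) = cong (false V.∷_) (p─p≡⊥ B)
  mono : ∀ {n} {A B : Subset n} {e} → e ∈ A ─ B → e ∈ B → e ∈ B ─ B
  mono {A = _ V.∷ A} {true V.∷ B} {zero} () q
  mono {A = _ V.∷ A} {true V.∷ B} {suc e} (V.there h) (V.there q) = V.there (mono h q)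
  mono {A = _ V.∷ A} {false V.∷ B} {suc e} (V.there h) (V.there q) = V.there (mono h q)

module Minors {n : ℕ} (rk : Subset n → ℕ) (pm : IsPolymatroid rk) (loopless : Loopless rk)
              (Gt : Subset n) (flGt : IsFlat rk Gt) where
  open IsPolymatroid pm
  open Polymatroid rk pm loopless

  module _ (F : Subset n) (F⊆Gt : F ⊆ Gt) where

    E = minorGround Gt F
    r = minorRk rk F

    flatIn-⊆ : ∀ A → T (isFlatIn E r A) → A ⊆ E
    flatIn-⊆ A t = ⊆ᵇ⁻ {A = A} {E} (proj₁ (T-∧⁻ t))

    flatIn-disjoint : ∀ A → T (isFlatIn E r A) → ∀ {e} → e ∈ A → e ∉ F
    flatIn-disjoint A t e∈ = proj₂ (∈─⁻ Gt F (flatIn-⊆ A t e∈))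

    -- For e in Gt the test in `isFlatIn` applies; for e outside Gt the closure of A ∪ F stays
    -- inside the flat Gt. With `flat⇒flatIn` this identifies the flats of the minor with the flats
    -- between F and Gt.
    flatIn⇒flat : ∀ A → T (isFlatIn E r A) → Flat (A ∪ F)
    flatIn⇒flat A t e e∉ with e ∈? Gt
    ... | no e∉Gt = ℕP.≤∧≢⇒< (monotone _ _ (p⊆p∪q ⁅ e ⁆)) λ eq → e∉Gt (cl-least flGt (∪-least (p─q⊆p Gt F ∘ flatIn-⊆ A t) F⊆Gt) (∈cl⁺ {A ∪ F} (sym eq)))
    ... | yes e∈Gt = subst (λ Z → rk (A ∪ F) < rk Z) shuffle (ℕP.≰⇒> λ le → ℕP.<⇒≱ lt (ℕP.∸-monoˡ-≤ (rk F) le))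
      where
      shuffle : (A ∪ ⁅ e ⁆) ∪ F ≡ (A ∪ F) ∪ ⁅ e ⁆
      shuffle = trans (∪-assoc A ⁅ e ⁆ F) (trans (cong (A ∪_) (∪-comm ⁅ e ⁆ F)) (sym (∪-assoc A F ⁅ e ⁆)))
      lt : r A < r (A ∪ ⁅ e ⁆)
      lt = ℕP.<ᵇ⇒< _ _ (T-or (T-imp⁻ (all-elim _ (allFin n) (proj₂ (T-∧⁻ {A ⊆ᵇ E} t)) (∈-allFin e)) (elem⁺ {A = E} (x∈p∧x∉q⇒x∈p─q e∈Gt (e∉ ∘ q⊆p∪q A F)))))
        where
        T-or : T (elemᵇ e A ∨ (r A <ᵇ r (A ∪ ⁅ e ⁆))) → T (r A <ᵇ r (A ∪ ⁅ e ⁆))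
        T-or t with elemᵇ e A in eq
        ... | true = ⊥-elim (e∉ (p⊆p∪q F (elem⁻ {A = A} (subst T (sym eq) _))))
        ... | false = t

    restore : ∀ {B} → F ⊆ B → (B ─ F) ∪ F ≡ B
    restore {B} F⊆B = ⊆-antisym (∪-least (p─q⊆p B F) F⊆B) λ {e} e∈B → cases e e∈B (e ∈? F)
      where
      cases : ∀ e → e ∈ B → Dec (e ∈ F) → e ∈ (B ─ F) ∪ F
      cases e e∈B (yes p) = q⊆p∪q (B ─ F) F p
      cases e e∈B (no ¬p) = p⊆p∪q F (x∈p∧x∉q⇒x∈p─q e∈B ¬p)

    flat⇒flatIn : ∀ {B} → Flat B → F ⊆ B → B ⊆ Gt → T (isFlatIn E r (B ─ F))
    flat⇒flatIn {B} fl F⊆B B⊆Gt = T-∧⁺ (⊆ᵇ⁺ {A = B ─ F} {E} λ e∈ → let (p , q) = ∈─⁻ B F e∈ in x∈p∧x∉q⇒x∈p─q (B⊆Gt p) q)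
      (all-intro _ (allFin n) λ e _ → T-imp⁺ λ t → or e (elem⁻ {A = E} t))
      where
      or : ∀ e → e ∈ E → T (elemᵇ e (B ─ F) ∨ (r (B ─ F) <ᵇ r ((B ─ F) ∪ ⁅ e ⁆)))
      or e e∈E with elemᵇ e (B ─ F) in eq
      ... | true = _
      ... | false = ℕP.<⇒<ᵇ (subst (λ Z → rk Z ∸ rk F < r ((B ─ F) ∪ ⁅ e ⁆)) (sym (restore F⊆B))
          (ℕP.<-≤-trans (ℕP.∸-monoˡ-< (fl e e∉B) (monotone _ _ F⊆B)) (ℕP.∸-monoˡ-≤ (rk F) (monotone _ _ sub))))
        where
        e∉B : e ∉ B
        e∉B e∈B = subst T eq (elem⁺ {A = B ─ F} (x∈p∧x∉q⇒x∈p─q e∈B (proj₂ (∈─⁻ Gt F e∈E))))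
        sub : B ∪ ⁅ e ⁆ ⊆ ((B ─ F) ∪ ⁅ e ⁆) ∪ F
        sub = ∪-least (∪-least (p⊆p∪q F ∘ p⊆p∪q ⁅ e ⁆) (q⊆p∪q _ F) ∘ subst (_ ∈_) (sym (restore F⊆B))) (p⊆p∪q F ∘ q⊆p∪q (B ─ F) ⁅ e ⁆)

    corank : ∀ A → r E ∸ r A ≡ rk Gt ∸ rk (A ∪ F)
    corank A = trans (cong (λ Z → rk Z ∸ rk F ∸ r A) (restore F⊆Gt)) (trans (ℕP.∸-+-assoc (rk Gt) (rk F) (r A))
      (cong (rk Gt ∸_) (ℕP.m+[n∸m]≡n (monotone F (A ∪ F) (q⊆p∪q A F)))))

  X : (ℕ → ℤ) → Subset n → ℤ
  X f F = pair f (redCharPoly (minorGround Gt F) (minorRk rk F))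

  Between : Subset n → Subset n → Set
  Between F F' = Flat F' × F ⊆ F' × F' ⊆ Gt

  between? : ∀ F F' → Dec (Between F F')
  between? F F' = flat? F' ×-dec ((F ⊆? F') ×-dec (F' ⊆? Gt))

  private S = allSubsets n

  -- Möbius inversion gives Σ χ̄ (M|Gt / F') = 1 + x + … + x^(r−1) over the flats F ⊆ F' ⊆ Gt,
  -- r = rk Gt − rk F, proved by induction from the top since mobius is defined from the bottom.
  module Inversion (f : ℕ → ℤ) where
    u : Subset n → ℤ
    u F = prefix f (rk Gt ∸ rk F)

    sum-above : ∀ k F → n ∸ ∣ F ∣ < k → Flat F → F ⊆ Gt → ZS.Σ S (λ F' → between? F F' ZS.▹ X f F') ≡ u F
    sum-above (suc k) F (s≤s le) fl F⊆Gt = begin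
      ZS.Σ S (λ F' → between? F F' ZS.▹ X f F')
        ≡⟨ ZS.Σ-cong S (λ F' → part F' (F' ≟ₛ F)) ⟩
      ZS.Σ S (λ F' → ((F' ≟ₛ F) ZS.▹ X f F) ℤ.+ (between? F F' ZS.▹ (¬? (F' ≟ₛ F) ZS.▹ X f F')))
        ≡⟨ ZS.Σ-∙ S ⟩
      ZS.Σ S (λ F' → (F' ≟ₛ F) ZS.▹ X f F) ℤ.+ rest
        ≡⟨ cong (ℤ._+ rest) (trans (ZS.Σ-single S F (allSubsets-unique n) (allSubsets-complete F) λ A ne → ZS.▹-no (A ≟ₛ F) ne) (ZS.▹-yes (F ≟ₛ F) refl)) ⟩
      X f F ℤ.+ rest
        ≡⟨ cong (ℤ._+ rest) X-expand ⟩
      (u F ℤ.+ ZS.Σ S (λ F' → between? F F' ZS.▹ (X f F' ℤ.* K F'))) ℤ.+ rest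
        ≡⟨ ℤP.+-assoc (u F) (ZS.Σ S (λ F' → between? F F' ZS.▹ (X f F' ℤ.* K F'))) rest ⟩
      u F ℤ.+ (ZS.Σ S (λ F' → between? F F' ZS.▹ (X f F' ℤ.* K F')) ℤ.+ rest)
        ≡⟨ cong (λ z → u F ℤ.+ z) (trans (sym (ZS.Σ-∙ S)) (ZS.Σ-ε S λ F' _ → trans (sym (ZS.▹-∙ (between? F F'))) (ZS.▹-ε (between? F F') (cancel F' (F' ≟ₛ F))))) ⟩
      u F ℤ.+ + 0
        ≡⟨ ℤP.+-identityʳ (u F) ⟩
      u F ∎
      where
      open ≡-Reasoning
      open module Mb = Mobius (minorGround Gt F) (minorRk rk F) using (flatIn?; mobius-⊥; mobius-sum)
      mob : Subset n → ℤ
      mob = mobius (minorGround Gt F) (minorRk rk F)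
      rest = ZS.Σ S (λ F' → between? F F' ZS.▹ (¬? (F' ≟ₛ F) ZS.▹ X f F'))
      -- The coefficient of X f F' in X f F - u F once every u (A ∪ F) with A nonempty has been
      -- expanded by induction: a Möbius sum over nonempty A, equal to -1 at flats strictly above F
      -- and to 0 at F. Hence everything except u F cancels.
      K : Subset n → ℤ
      K F' = ZS.Σ S (λ A → flatIn? A ZS.▹ (¬? (A ≟ₛ ⊥) ZS.▹ (((A ∪ F) ⊆? F') ZS.▹ mob A)))
      part : ∀ F' → Dec (F' ≡ F) → between? F F' ZS.▹ X f F' ≡ ((F' ≟ₛ F) ZS.▹ X f F) ℤ.+ (between? F F' ZS.▹ (¬? (F' ≟ₛ F) ZS.▹ X f F'))
      part F' (yes refl) = trans (ZS.▹-yes (between? F F') (fl , id , F⊆Gt)) (sym (trans (cong₂ ℤ._+_ (ZS.▹-yes (F' ≟ₛ F') refl)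
        (ZS.▹-ε (between? F F') λ _ → ZS.▹-no (¬? (F' ≟ₛ F')) λ h → h refl)) (ℤP.+-identityʳ (X f F))))
      part F' (no ne) = sym (trans (cong₂ ℤ._+_ (ZS.▹-no (F' ≟ₛ F) ne) (ZS.▹-congʳ (between? F F') λ _ → ZS.▹-yes (¬? (F' ≟ₛ F)) ne)) (ℤP.+-identityˡ _))
      flatIn-⊥ : T (isFlatIn (minorGround Gt F) (minorRk rk F) ⊥)
      flatIn-⊥ = subst (T ∘ isFlatIn (minorGround Gt F) (minorRk rk F)) (⊆-antisym (λ e∈ → let (p , q) = ∈─⁻ F F e∈ in ⊥-elim (q p)) (⊆-min _)) (flat⇒flatIn F F⊆Gt fl id F⊆Gt)
      ⊥∪F : ⊥ ∪ F ≡ F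
      ⊥∪F = ∪-identityˡ F
      Kterm : Subset n → Subset n → ℤ
      Kterm F' A = flatIn? A ZS.▹ (¬? (A ≟ₛ ⊥) ZS.▹ (((A ∪ F) ⊆? F') ZS.▹ mob A))
      K-self : K F ≡ + 0
      K-self = ZS.Σ-ε S λ A _ → ZS.▹-ε (flatIn? A) λ t → ZS.▹-ε (¬? (A ≟ₛ ⊥)) λ ne → ZS.▹-no ((A ∪ F) ⊆? F) λ s →
        let (e , e∈) = ≢⊥⇒nonempty ne in flatIn-disjoint F F⊆Gt A t e∈ (s (p⊆p∪q F e∈))
      K-above : ∀ F' → Between F F' → F' ≢ F → + 1 ℤ.+ K F' ≡ + 0
      K-above F' (flF' , F⊆F' , F'⊆Gt) ne = trans (sym (trans (trans (ZS.Σ-cong S (λ A → split A (A ≟ₛ ⊥))) (ZS.Σ-∙ S))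
          (cong (ℤ._+ K F') (trans (ZS.Σ-single S ⊥ (allSubsets-unique n) (allSubsets-complete ⊥) (λ A ne → ZS.▹-no (A ≟ₛ ⊥) ne)) (ZS.▹-yes (_≟ₛ_ {n} ⊥ ⊥) refl)))))
          (mobius-sum (F' ─ F) (flat⇒flatIn F F⊆Gt flF' F⊆F' F'⊆Gt) B≢⊥)
        where
        B≢⊥ : F' ─ F ≢ ⊥
        B≢⊥ eq = ne (⊆-antisym (λ {e} e∈ → decidable-stable (e ∈? F) λ e∉F → ∉⊥ (subst (e ∈_) eq (x∈p∧x∉q⇒x∈p─q e∈ e∉F))) F⊆F')
        split : ∀ A → Dec (A ≡ ⊥) → (flatIn? A ×-dec (A ⊆? (F' ─ F))) ZS.▹ mob A ≡ ((A ≟ₛ ⊥) ZS.▹ + 1) ℤ.+ Kterm F' A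
        split A (yes refl) = trans (ZS.▹-yes (flatIn? A ×-dec (A ⊆? (F' ─ F))) (flatIn-⊥ , ⊆-min _)) (trans mobius-⊥ (sym (trans (cong₂ ℤ._+_ (ZS.▹-yes (A ≟ₛ A) refl)
          (ZS.▹-ε (flatIn? A) λ _ → ZS.▹-no (¬? (A ≟ₛ A)) λ h → h refl)) refl)))
        split A (no A≢⊥) = trans (ZS.▹-× (flatIn? A) (A ⊆? (F' ─ F))) (trans (ZS.▹-congʳ (flatIn? A) λ t → trans
            (ZS.▹-cong (A ⊆? (F' ─ F)) ((A ∪ F) ⊆? F') (λ s → ∪-least (p─q⊆p F' F ∘ s) F⊆F')
              (λ s e∈ → x∈p∧x∉q⇒x∈p─q (s (p⊆p∪q F e∈)) (flatIn-disjoint F F⊆Gt A t e∈)) λ _ → refl)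
            (sym (ZS.▹-yes (¬? (A ≟ₛ ⊥)) A≢⊥)))
          (sym (trans (cong (ℤ._+ Kterm F' A) (ZS.▹-no (A ≟ₛ ⊥) A≢⊥)) (ℤP.+-identityˡ (Kterm F' A)))))
      cancel : ∀ F' → Dec (F' ≡ F) → Between F F' → X f F' ℤ.* K F' ℤ.+ (¬? (F' ≟ₛ F) ZS.▹ X f F') ≡ + 0
      cancel F' (yes refl) _ = trans (cong₂ ℤ._+_ (trans (cong (λ z → X f F' ℤ.* z) K-self) (ℤP.*-zeroʳ (X f F'))) (ZS.▹-no (¬? (F' ≟ₛ F')) λ h → h refl)) refl
      cancel F' (no ne) b = trans (cong (λ z → X f F' ℤ.* K F' ℤ.+ z) (ZS.▹-yes (¬? (F' ≟ₛ F)) ne))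
        (trans (factor (X f F') (K F')) (trans (cong (λ z → X f F' ℤ.* z) (K-above F' b ne)) (ℤP.*-zeroʳ (X f F'))))
        where
        factor : ∀ x k → x ℤ.* k ℤ.+ x ≡ x ℤ.* (+ 1 ℤ.+ k)
        factor = ℤRing.solve-∀
      Uterm : Subset n → ℤ
      Uterm A = flatIn? A ZS.▹ (¬? (A ≟ₛ ⊥) ZS.▹ (mob A ℤ.* u (A ∪ F)))
      X-expand : X f F ≡ u F ℤ.+ ZS.Σ S (λ F' → between? F F' ZS.▹ (X f F' ℤ.* K F'))
      X-expand = begin
        X f F
          ≡⟨ pair-redCharPoly f (minorGround Gt F) (minorRk rk F) ⟩
        ZS.Σ (flatsOf (minorGround Gt F) (minorRk rk F)) (λ A → mob A ℤ.* prefix f (minorRk rk F (minorGround Gt F) ∸ minorRk rk F A))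
          ≡⟨ ZS.Σ-filterᵇ (isFlatIn (minorGround Gt F) (minorRk rk F)) S ⟩
        ZS.Σ S (λ A → flatIn? A ZS.▹ (mob A ℤ.* prefix f (minorRk rk F (minorGround Gt F) ∸ minorRk rk F A)))
          ≡⟨ ZS.Σ-cong S (λ A → ZS.▹-congʳ (flatIn? A) λ _ → cong (λ k → mob A ℤ.* prefix f k) (corank F F⊆Gt A)) ⟩
        ZS.Σ S (λ A → flatIn? A ZS.▹ (mob A ℤ.* u (A ∪ F)))
          ≡⟨ ZS.Σ-cong S (λ A → sep A (A ≟ₛ ⊥)) ⟩
        ZS.Σ S (λ A → ((A ≟ₛ ⊥) ZS.▹ u F) ℤ.+ Uterm A)
          ≡⟨ ZS.Σ-∙ S ⟩
        ZS.Σ S (λ A → (A ≟ₛ ⊥) ZS.▹ u F) ℤ.+ ZS.Σ S Uterm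
          ≡⟨ cong₂ ℤ._+_ (trans (ZS.Σ-single S ⊥ (allSubsets-unique n) (allSubsets-complete ⊥) (λ A ne → ZS.▹-no (A ≟ₛ ⊥) ne)) (ZS.▹-yes (_≟ₛ_ {n} ⊥ ⊥) refl))
               (trans (ZS.Σ-cong S expandU) (trans (ZS.Σ-swap S S) (ZS.Σ-cong S collect))) ⟩
        u F ℤ.+ ZS.Σ S (λ F' → between? F F' ZS.▹ (X f F' ℤ.* K F')) ∎
        where
        sep : ∀ A → Dec (A ≡ ⊥) → flatIn? A ZS.▹ (mob A ℤ.* u (A ∪ F)) ≡ ((A ≟ₛ ⊥) ZS.▹ u F) ℤ.+ Uterm A
        sep A (yes refl) = trans (ZS.▹-yes (flatIn? A) flatIn-⊥) (trans (cong₂ ℤ._*_ mobius-⊥ (cong u ⊥∪F)) (trans (ℤP.*-identityˡ (u F))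
          (sym (trans (cong₂ ℤ._+_ (ZS.▹-yes (A ≟ₛ A) refl) (ZS.▹-ε (flatIn? A) λ _ → ZS.▹-no (¬? (A ≟ₛ A)) λ h → h refl)) (ℤP.+-identityʳ (u F))))))
        sep A (no ne) = sym (trans (cong₂ ℤ._+_ (ZS.▹-no (A ≟ₛ ⊥) ne) (ZS.▹-congʳ (flatIn? A) λ _ → ZS.▹-yes (¬? (A ≟ₛ ⊥)) ne)) (ℤP.+-identityˡ _))
        term : Subset n → Subset n → ℤ
        term A F' = between? F F' ZS.▹ (X f F' ℤ.* Kterm F' A)
        expandU : ∀ A → Uterm A ≡ ZS.Σ S (term A)
        expandU A = trans (ZS.▹-congʳ (flatIn? A) λ t → trans (ZS.▹-congʳ (¬? (A ≟ₛ ⊥)) λ ne → trans (cong (λ z → mob A ℤ.* z) (sym (ih t ne)))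
            (ZS.Σ-*ˡ S (mob A))) (ZS.Σ-▹ (¬? (A ≟ₛ ⊥)) S)) (trans (ZS.Σ-▹ (flatIn? A) S) (ZS.Σ-cong S λ F' →
              push F'))
          where
          ih : T (isFlatIn (minorGround Gt F) (minorRk rk F) A) → A ≢ ⊥ → ZS.Σ S (λ F' → between? (A ∪ F) F' ZS.▹ X f F') ≡ u (A ∪ F)
          ih t ne = sum-above k (A ∪ F) (ℕP.<-≤-trans (ℕP.∸-monoʳ-< {n} (⊏⇒∣<∣ F⊏) (∣p∣≤n (A ∪ F))) le) (flatIn⇒flat F F⊆Gt A t)
              (∪-least (p─q⊆p Gt F ∘ flatIn-⊆ F F⊆Gt A t) F⊆Gt)
            where
            F⊏ : F ⊏ A ∪ F
            F⊏ = q⊆p∪q A F , λ eq → let (e , e∈) = ≢⊥⇒nonempty ne in flatIn-disjoint F F⊆Gt A t e∈ (subst (e ∈_) (sym eq) (p⊆p∪q F e∈))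
          push : ∀ F' → flatIn? A ZS.▹ (¬? (A ≟ₛ ⊥) ZS.▹ (mob A ℤ.* (between? (A ∪ F) F' ZS.▹ X f F'))) ≡ term A F'
          push F' = begin
            flatIn? A ZS.▹ (¬? (A ≟ₛ ⊥) ZS.▹ (mob A ℤ.* (between? (A ∪ F) F' ZS.▹ X f F')))
              ≡⟨ ZS.▹-congʳ (flatIn? A) (λ _ → ZS.▹-congʳ (¬? (A ≟ₛ ⊥)) λ _ → trans (ZS.▹-*ʳ (between? (A ∪ F) F') {mob A} {X f F'})
                   (trans (ZS.▹-cong (between? (A ∪ F) F') (between? F F' ×-dec ((A ∪ F) ⊆? F'))
                     (λ { (a , b , c) → (a , b ∘ q⊆p∪q A F , c) , b }) (λ { ((a , _ , c) , b) → a , b , c }) λ _ → ℤP.*-comm (mob A) (X f F'))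
                     (ZS.▹-× (between? F F') ((A ∪ F) ⊆? F')))) ⟩
            flatIn? A ZS.▹ (¬? (A ≟ₛ ⊥) ZS.▹ (between? F F' ZS.▹ (((A ∪ F) ⊆? F') ZS.▹ (X f F' ℤ.* mob A))))
              ≡⟨ trans (ZS.▹-congʳ (flatIn? A) λ _ → ZS.▹-swap (¬? (A ≟ₛ ⊥)) (between? F F')) (ZS.▹-swap (flatIn? A) (between? F F')) ⟩
            between? F F' ZS.▹ (flatIn? A ZS.▹ (¬? (A ≟ₛ ⊥) ZS.▹ (((A ∪ F) ⊆? F') ZS.▹ (X f F' ℤ.* mob A))))
              ≡⟨ ZS.▹-congʳ (between? F F') (λ _ → sym (trans (ZS.▹-*ʳ (flatIn? A) {X f F'} {¬? (A ≟ₛ ⊥) ZS.▹ (((A ∪ F) ⊆? F') ZS.▹ mob A)}) (ZS.▹-congʳ (flatIn? A) λ _ →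
                   trans (ZS.▹-*ʳ (¬? (A ≟ₛ ⊥)) {X f F'} {((A ∪ F) ⊆? F') ZS.▹ mob A}) (ZS.▹-congʳ (¬? (A ≟ₛ ⊥)) λ _ → ZS.▹-*ʳ ((A ∪ F) ⊆? F') {X f F'} {mob A})))) ⟩
            term A F' ∎
        collect : ∀ F' → ZS.Σ S (λ A → term A F') ≡ between? F F' ZS.▹ (X f F' ℤ.* K F')
        collect F' = trans (sym (ZS.Σ-▹ (between? F F') S)) (ZS.▹-congʳ (between? F F') λ _ → sym (ZS.Σ-*ˡ S (X f F')))

    sum-between : ∀ F → Flat F → F ⊆ Gt → ZS.Σ S (λ F' → between? F F' ZS.▹ X f F') ≡ prefix f (rk Gt ∸ rk F)
    sum-between F = sum-above (suc (n ∸ ∣ F ∣)) F ℕP.≤-refl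

  -- In `sum-between` at F = Gt this is the only summand, and the right side is an empty geometric
  -- sum. It removes the top flat from the recursion for nested sums.
  X-top : ∀ f → X f Gt ≡ + 0
  X-top f = trans (sym (trans (ZS.Σ-single S Gt (allSubsets-unique n) (allSubsets-complete Gt) λ F' ne →
        ZS.▹-no (between? Gt F') λ { (_ , a , b) → ne (⊆-antisym b a) }) (ZS.▹-yes (between? Gt Gt) (flGt , id , id))))
      (trans (Inversion.sum-between f Gt flGt id) (cong (prefix f) (ℕP.n∸n≡0 (rk Gt))))

-- Sums over subsets

module SubsetSum {c ℓ} (R : CommutativeMonoid c ℓ) where
  open MonoidSum R

  Σ-suc : ∀ m (f : Subset (suc m) → Carrier) →
          Σ (allSubsets (suc m)) f ≈ Σ (allSubsets m) (f ∘ (inside ∷_)) ∙ Σ (allSubsets m) (f ∘ (outside ∷_))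
  Σ-suc m f = ≈-trans (Σ-++ (L.map (inside ∷_) (allSubsets m)) (L.map (outside ∷_) (allSubsets m)))
    (∙-cong (Σ-map (inside ∷_) (allSubsets m)) (Σ-map (outside ∷_) (allSubsets m)))

  Σ-insert : ∀ {m} (g : Fin m) (f : Subset m → Carrier) →
             Σ (allSubsets m) f ≈ Σ (allSubsets m) (λ N → ¬? (g ∈? N) ▹ (f N ∙ f (N ∪ ⁅ g ⁆)))
  Σ-insert {suc m} zero f = begin
    Σ (allSubsets (suc m)) f ≈⟨ Σ-suc m f ⟩
    Σ (allSubsets m) (f ∘ (inside ∷_)) ∙ Σ (allSubsets m) (f ∘ (outside ∷_)) ≈⟨ comm _ _ ⟩
    Σ (allSubsets m) (f ∘ (outside ∷_)) ∙ Σ (allSubsets m) (f ∘ (inside ∷_)) ≈⟨ Σ-∙ (allSubsets m) ⟨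
    Σ (allSubsets m) (λ N → f (outside ∷ N) ∙ f (inside ∷ N)) ≈⟨ Σ-cong (allSubsets m) (λ N →
      ≈-sym (≈-trans (▹-yes (¬? (zero ∈? (outside ∷ N))) λ ()) (∙-congˡ (≈-reflexive (cong (λ Z → f (inside ∷ Z)) (∪-identityʳ N)))))) ⟩
    Σ (allSubsets m) (h ∘ (outside ∷_)) ≈⟨ identityˡ _ ⟨
    ε ∙ Σ (allSubsets m) (h ∘ (outside ∷_)) ≈⟨ ∙-congʳ (Σ-ε (allSubsets m) λ N _ → ▹-no (¬? (zero ∈? (inside ∷ N))) {f (inside ∷ N) ∙ f ((inside ∷ N) ∪ ⁅ zero ⁆)} λ k → k here) ⟨
    Σ (allSubsets m) (h ∘ (inside ∷_)) ∙ Σ (allSubsets m) (h ∘ (outside ∷_)) ≈⟨ Σ-suc m h ⟨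
    Σ (allSubsets (suc m)) h ∎
    where
    h : Subset (suc m) → Carrier
    h N = ¬? (zero ∈? N) ▹ (f N ∙ f (N ∪ ⁅ zero ⁆))
  Σ-insert {suc m} (suc g) f = begin
    Σ (allSubsets (suc m)) f ≈⟨ Σ-suc m f ⟩
    Σ (allSubsets m) (f ∘ (inside ∷_)) ∙ Σ (allSubsets m) (f ∘ (outside ∷_))
      ≈⟨ ∙-cong (≈-trans (Σ-insert g _) (Σ-cong (allSubsets m) (half inside λ _ → refl))) (≈-trans (Σ-insert g _) (Σ-cong (allSubsets m) (half outside λ _ → refl))) ⟩
    Σ (allSubsets m) (h ∘ (inside ∷_)) ∙ Σ (allSubsets m) (h ∘ (outside ∷_)) ≈⟨ Σ-suc m h ⟨
    Σ (allSubsets (suc m)) h ∎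
    where
    h : Subset (suc m) → Carrier
    h N = ¬? (suc g ∈? N) ▹ (f N ∙ f (N ∪ ⁅ suc g ⁆))
    half : ∀ s → (∀ N → s ∷ (N ∪ ⁅ g ⁆) ≡ (s ∷ N) ∪ ⁅ suc g ⁆) → ∀ N →
           ¬? (g ∈? N) ▹ (f (s ∷ N) ∙ f (s ∷ (N ∪ ⁅ g ⁆))) ≈ h (s ∷ N)
    half s eq N = ▹-cong (¬? (g ∈? N)) (¬? (suc g ∈? (s ∷ N))) (λ k → k ∘ drop-there) (λ k → k ∘ there)
      λ _ → ∙-congˡ (≈-reflexive (cong f (eq N)))

  -- By disjointness N corresponds to the pair (N ∩ A, N ∩ B); the proof goes through the triple sum
  -- over N = N₁ ∪ N₂.
  Σ-∪ : ∀ {m} (A B : Subset m) → (∀ {i} → i ∈ A → i ∉ B) → ∀ (f : Subset m → Carrier) →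
        Σ (allSubsets m) (λ N → (N ⊆? (A ∪ B)) ▹ f N) ≈
        Σ (allSubsets m) (λ N₁ → Σ (allSubsets m) (λ N₂ → ((N₁ ⊆? A) ×-dec (N₂ ⊆? B)) ▹ f (N₁ ∪ N₂)))
  Σ-∪ {m} A B disj f = begin
    Σ S (λ N → (N ⊆? (A ∪ B)) ▹ f N)
      ≈⟨ Σ-cong S (λ N → fibre N (N ⊆? (A ∪ B))) ⟩
    Σ S (λ N → Σ S (λ N₁ → Σ S (λ N₂ → ((N₁ ⊆? A) ×-dec (N₂ ⊆? B)) ▹ ((N ≟ₛ (N₁ ∪ N₂)) ▹ f N))))
      ≈⟨ ≈-trans (Σ-swap S S) (Σ-cong S λ N₁ → Σ-swap S S) ⟩
    Σ S (λ N₁ → Σ S (λ N₂ → Σ S (λ N → ((N₁ ⊆? A) ×-dec (N₂ ⊆? B)) ▹ ((N ≟ₛ (N₁ ∪ N₂)) ▹ f N))))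
      ≈⟨ Σ-cong S (λ N₁ → Σ-cong S λ N₂ → ≈-trans (≈-sym (Σ-▹ ((N₁ ⊆? A) ×-dec (N₂ ⊆? B)) S)) (▹-congʳ ((N₁ ⊆? A) ×-dec (N₂ ⊆? B)) λ _ →
           ≈-trans (Σ-single S (N₁ ∪ N₂) (allSubsets-unique m) (allSubsets-complete (N₁ ∪ N₂)) λ N ne → ▹-no (N ≟ₛ (N₁ ∪ N₂)) ne) (▹-yes ((N₁ ∪ N₂) ≟ₛ (N₁ ∪ N₂)) refl))) ⟩
    Σ S (λ N₁ → Σ S (λ N₂ → ((N₁ ⊆? A) ×-dec (N₂ ⊆? B)) ▹ f (N₁ ∪ N₂))) ∎
    where
    S = allSubsets m
    term : Subset m → Subset m → Subset m → Carrier
    term N N₁ N₂ = ((N₁ ⊆? A) ×-dec (N₂ ⊆? B)) ▹ ((N ≟ₛ (N₁ ∪ N₂)) ▹ f N)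
    partˡ : ∀ {N₁ N₂} → N₁ ⊆ A → N₂ ⊆ B → (N₁ ∪ N₂) ∩ A ≡ N₁
    partˡ {N₁} {N₂} s t = ⊆-antisym
      (λ e → let (p , q) = x∈p∩q⁻ (N₁ ∪ N₂) A e in [ id , (λ r → ⊥-elim (disj q (t r))) ]′ (x∈p∪q⁻ N₁ N₂ p))
      (λ e → x∈p∩q⁺ (p⊆p∪q N₂ e , s e))
    partʳ : ∀ {N₁ N₂} → N₁ ⊆ A → N₂ ⊆ B → (N₁ ∪ N₂) ∩ B ≡ N₂
    partʳ {N₁} {N₂} s t = ⊆-antisym
      (λ e → let (p , q) = x∈p∩q⁻ (N₁ ∪ N₂) B e in [ (λ r → ⊥-elim (disj (s r) q)) , id ]′ (x∈p∪q⁻ N₁ N₂ p))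
      (λ e → x∈p∩q⁺ (q⊆p∪q N₁ N₂ e , t e))
    fibre : ∀ N (d : Dec (N ⊆ A ∪ B)) → d ▹ f N ≈ Σ S (λ N₁ → Σ S (term N N₁))
    fibre N (no N⊈) = ≈-sym (Σ-ε S λ N₁ _ → Σ-ε S λ N₂ _ → ▹-ε ((N₁ ⊆? A) ×-dec (N₂ ⊆? B)) λ { (s , t) →
      ▹-no (N ≟ₛ (N₁ ∪ N₂)) λ { refl → N⊈ (∪-least (p⊆p∪q B ∘ s) (q⊆p∪q A B ∘ t)) } })
    fibre N (yes N⊆) = ≈-sym (≈-trans
      (Σ-single S (N ∩ A) (allSubsets-unique m) (allSubsets-complete (N ∩ A)) λ N₁ ne → Σ-ε S λ N₂ _ →
        ▹-ε ((N₁ ⊆? A) ×-dec (N₂ ⊆? B)) λ { (s , t) → ▹-no (N ≟ₛ (N₁ ∪ N₂)) λ { refl → ne (≡.sym (partˡ s t)) } })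
      (≈-trans (Σ-single S (N ∩ B) (allSubsets-unique m) (allSubsets-complete (N ∩ B)) λ N₂ ne →
        ▹-ε (((N ∩ A) ⊆? A) ×-dec (N₂ ⊆? B)) λ { (s , t) → ▹-no (N ≟ₛ ((N ∩ A) ∪ N₂)) λ eq → ne (≡.sym (≡.trans (cong (_∩ B) eq) (partʳ {N ∩ A} {N₂} s t))) })
      (≈-trans (▹-yes (((N ∩ A) ⊆? A) ×-dec ((N ∩ B) ⊆? B)) (p∩q⊆q N A , p∩q⊆q N B))
        (▹-yes (N ≟ₛ ((N ∩ A) ∪ (N ∩ B))) (⊆-antisym
          (λ e → [ (λ a → p⊆p∪q (N ∩ B) (x∈p∩q⁺ (e , a))) , (λ b → q⊆p∪q (N ∩ A) (N ∩ B) (x∈p∩q⁺ (e , b))) ]′ (x∈p∪q⁻ A B (N⊆ e)))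
          (∪-least (p∩q⊆p N A) (p∩q⊆p N B)))))))

-- The recursion for sums over nested sets

open PS renaming (_+_ to _+ᴾ_; _*_ to _*ᴾ_)

module Recursion {n : ℕ} (rk : Subset n → ℕ) (pm : IsPolymatroid rk) (loopless : Loopless rk)
                 (𝒢 : List (Subset n)) (bs : IsBuildingSet rk 𝒢) where
  open IsPolymatroid pm using (monotone)
  open BuildingSet rk pm loopless 𝒢 bs
  open SubsetSum (CommutativeRing.+-commutativeMonoid polyRing) using (Σ-insert; Σ-∪)

  private
    SM = allSubsets M
    Sn = allSubsets n

  Below : Subset n → Subset M → Set
  Below F N = ∀ i → i ∈ N → G i ⊆ F

  below? : ∀ F N → Dec (Below F N)
  below? F N = FinP.all? λ i → (i ∈? N) →-dec (G i ⊆? F)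

  sup-mono : ∀ {N N'} j → N ⊆ N' → sup N j ⊆ sup N' j
  sup-mono {N} {N'} j s = sup-least {N} {j} (sup-flat N' j) λ i i∈ → sup-upper {N'} (s i∈)

  nest-mono : ∀ {N N'} → N ⊆ N' → Nest N' → Nest N
  nest-mono s nest j h = nest j (sup-mono j s ∘ h)

  sup-⊆flat : ∀ {F N} j → Flat F → Below F N → sup N j ⊆ F
  sup-⊆flat {N = N} j fl b = sup-least {N} {j} fl λ i i∈ _ → b i i∈

  vR : Subset n → Fin M → Polyℤ
  vR s j = redCharPoly (minorGround (G j) s) (minorRk rk s)

  -- The sum of x^k over 0 < k < rk (G j) − rk s, the contribution of G j to a monomial basis.
  vH : Subset n → Fin M → Polyℤ
  vH s j = + 0 ∷ L.replicate (rk (G j) ∸ rk s ∸ 1) (+ 1)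

  pair-replicate : ∀ f d → pair f (L.replicate d (+ 1)) ≡ prefix f d
  pair-replicate f zero = refl
  pair-replicate f (suc d) = cong₂ ℤ._+_ (ℤP.*-identityˡ (f 0)) (pair-replicate (f ∘ suc) d)

  -- Möbius inversion for the geometric sum of length d = rk (G g) - rk s. Properness of s makes d
  -- positive; at d = 0 the left side would be 1 and the right side 0.
  1+vH : ∀ {s g} → Flat s → s ⊆ G g → ¬ (G g ⊆ s) →
         1# +ᴾ vH s g ≈ Σ Sn (λ F → (flat? F ×-dec ((s ⊆? F) ×-dec (F ⊆? G g))) ▹ vR F g)
  1+vH {s} {g} fl s⊆g g⊈s = ext λ f → trans (pair-⊕ f oneℤ (vH s g)) (trans (geometric f (rk (G g) ∸ rk s) (ℕP.m<n⇒0<n∸m rk<))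
      (sym (trans (pair-Σ f Sn _) (trans (ZS.Σ-cong Sn λ F → pair-▹ f (Minors.between? rk pm loopless (G g) (G-flat g) s F) (vR F g))
        (Minors.Inversion.sum-between rk pm loopless (G g) (G-flat g) f s fl s⊆g)))))
    where
    rk< : rk s < rk (G g)
    rk< = ℕP.≰⇒> λ le → g⊈s (flat-rk fl s⊆g le)
    geometric : ∀ f d → 0 < d → pair f oneℤ ℤ.+ pair f (+ 0 ∷ L.replicate (d ∸ 1) (+ 1)) ≡ prefix f d
    geometric f (suc d) _ = cong₂ ℤ._+_ (pair-one f) (trans (ℤP.+-identityˡ _) (pair-replicate (f ∘ suc) d))

  vR-top : ∀ g → vR (G g) g ≈ 0#
  vR-top g = ext λ f → Minors.X-top rk pm loopless (G g) (G-flat g) f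

  module Weighted (v : Subset n → Fin M → Polyℤ) where

    factor : Subset M → Fin M → Polyℤ
    factor N j = (j ∈? N) ▸ v (sup N j) j

    weight : Subset M → Polyℤ
    weight N = Π (allFin M) (factor N)

    weight-* : ∀ N N₁ N₂ → (∀ j → factor N j ≈ factor N₁ j *ᴾ factor N₂ j) → weight N ≈ weight N₁ *ᴾ weight N₂
    weight-* N N₁ N₂ h = ≈-trans (Π-cong (allFin M) h) (Π-* (allFin M))

    module Insert (g : Fin M) (N : Subset M) (g∉N : g ∉ N) (below : Below (G g) N) where

      -- G g contributes to sup only at flats strictly above it, and G j is not one of these.
      sup-insert : ∀ j → G j ⊆ G g → sup (N ∪ ⁅ g ⁆) j ≡ sup N j
      sup-insert j j⊆g = ⊆-antisym
        (sup-least {N ∪ ⁅ g ⁆} {j} (sup-flat N j) λ i i∈ lt → [ (λ p → sup-upper {N} p lt) ,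
          (λ q → ⊥-elim (proj₂ lt (⊆-antisym (proj₁ lt) (subst (λ z → G j ⊆ G z) (sym (x∈⁅y⁆⇒x≡y g q)) j⊆g)))) ]′ (x∈p∪q⁻ N ⁅ g ⁆ i∈))
        (sup-mono {N} {N ∪ ⁅ g ⁆} j (p⊆p∪q ⁅ g ⁆))

      below-insert : Below (G g) (N ∪ ⁅ g ⁆)
      below-insert i i∈ = [ below i , (λ q → subst (λ z → G z ⊆ G g) (sym (x∈⁅y⁆⇒x≡y g q)) id) ]′ (x∈p∪q⁻ N ⁅ g ⁆ i∈)

      nest-insert : Nest N → Nest (N ∪ ⁅ g ⁆)
      nest-insert nest j h = nest j (subst (G j ⊆_) (sup-insert j (sup-⊆flat {N = N ∪ ⁅ g ⁆} j (G-flat g) below-insert ∘ h)) h)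

      weight-insert : weight (N ∪ ⁅ g ⁆) ≈ weight N *ᴾ v (sup N g) g
      weight-insert = ≈-trans (Π-cong (allFin M) step) (≈-trans (Π-* (allFin M))
          (*-congˡ {weight N} (≈-trans (Π-single (allFin M) g (UniqueP.allFin⁺ M) (∈-allFin g) λ j ne → ▸-no (j Fin.≟ g) ne) (▸-yes (g Fin.≟ g) refl))))
        where
        step : ∀ j → factor (N ∪ ⁅ g ⁆) j ≈ factor N j *ᴾ ((j Fin.≟ g) ▸ v (sup N g) g)
        step j = go (j ∈? N) (j Fin.≟ g)
          where
          go : Dec (j ∈ N) → Dec (j ≡ g) → factor (N ∪ ⁅ g ⁆) j ≈ factor N j *ᴾ ((j Fin.≟ g) ▸ v (sup N g) g)
          go (yes j∈) (yes refl) = ⊥-elim (g∉N j∈)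
          go (yes j∈) (no ne) = ≈-trans (▸-yes (j ∈? (N ∪ ⁅ g ⁆)) (p⊆p∪q ⁅ g ⁆ j∈)) (≈-trans (≈-reflexive (cong (λ z → v z j) (sup-insert j (below j j∈))))
            (≈-sym (≈-trans (*-cong (▸-yes (j ∈? N) j∈) (▸-no (j Fin.≟ g) ne)) (*-identityʳ _))))
          go (no j∉) (yes refl) = ≈-trans (▸-yes (j ∈? (N ∪ ⁅ j ⁆)) (q⊆p∪q N ⁅ j ⁆ (x∈⁅x⁆ j))) (≈-trans (≈-reflexive (cong (λ z → v z j) (sup-insert j id)))
            (≈-sym (≈-trans (*-cong (▸-no (j ∈? N) j∉) (▸-yes (j Fin.≟ j) refl)) (*-identityˡ _))))
          go (no j∉) (no ne) = ≈-trans (▸-no (j ∈? (N ∪ ⁅ g ⁆)) λ p → [ j∉ , ne ∘ x∈⁅y⁆⇒x≡y g ]′ (x∈p∪q⁻ N ⁅ g ⁆ p))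
            (≈-sym (≈-trans (*-cong (▸-no (j ∈? N) j∉) (▸-no (j Fin.≟ g) ne)) (*-identityˡ _)))

    -- C says which nested sets belong to F: all sets of flats inside F for the Hilbert sum, those
    -- with join F for the sum of the theorem.
    module Conditioned (C : Subset n → Subset M → Set) (C? : ∀ F N → Dec (C F N)) where

      φ : Subset n → Subset M → Polyℤ
      φ F N = (nest? N ×-dec C? F N) ▹ weight N

      Φ : Subset n → Polyℤ
      Φ F = Σ SM (φ F)

      module Multiplicative (C-below : ∀ {F N} → Flat F → C F N → Below F N) {F : Subset n} (flF : Flat F) (sp : Split F)
          (C-split⁺ : ∀ N₁ N₂ → Below (G (Split.g sp)) N₁ → Below (Split.F' sp) N₂ → C F (N₁ ∪ N₂) → C (G (Split.g sp)) N₁ × C (Split.F' sp) N₂)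
          (C-split⁻ : ∀ {N₁ N₂} → C (G (Split.g sp)) N₁ → C (Split.F' sp) N₂ → C F (N₁ ∪ N₂)) where
        open Split sp

        A B : Subset M
        A = V.tabulate (λ i → G i ⊆ᵇ G g)
        B = V.tabulate (λ i → G i ⊆ᵇ F')

        A⁺ : ∀ {i} → G i ⊆ G g → i ∈ A
        A⁺ {i} s = ∈-tabulateᵇ⁺ (λ i → G i ⊆ᵇ G g) (⊆ᵇ⁺ {A = G i} {G g} s)
        A⁻ : ∀ {i} → i ∈ A → G i ⊆ G g
        A⁻ {i} h = ⊆ᵇ⁻ {A = G i} {G g} (∈-tabulateᵇ⁻ (λ i → G i ⊆ᵇ G g) h)
        B⁺ : ∀ {i} → G i ⊆ F' → i ∈ B
        B⁺ {i} s = ∈-tabulateᵇ⁺ (λ i → G i ⊆ᵇ F') (⊆ᵇ⁺ {A = G i} {F'} s)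
        B⁻ : ∀ {i} → i ∈ B → G i ⊆ F'
        B⁻ {i} h = ⊆ᵇ⁻ {A = G i} {F'} (∈-tabulateᵇ⁻ (λ i → G i ⊆ᵇ F') h)

        apart : ∀ {i X} → G i ⊆ X → (∀ {e} → e ∈ G i → e ∉ X) → Absurd
        apart {i} s d = let (e , e∈) = G-nonempty i in d e∈ (s e∈)

        AB-disjoint : ∀ {i} → i ∈ A → i ∉ B
        AB-disjoint i∈A i∈B = apart (B⁻ i∈B) λ e∈ → disjoint (A⁻ i∈A e∈)

        module Two (N₁ N₂ : Subset M) (b₁ : Below (G g) N₁) (b₂ : Below F' N₂) where
          N = N₁ ∪ N₂

          -- A member of N₂ is nonempty and lies in F', so it cannot lie below G j ⊆ G g, which is
          -- disjoint from F'.
          supˡ : ∀ j → G j ⊆ G g → sup N j ≡ sup N₁ j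
          supˡ j j⊆ = ⊆-antisym (sup-least {N} {j} (sup-flat N₁ j) λ i i∈ lt →
              [ (λ p → sup-upper {N₁} p lt) , (λ q → ⊥-elim (apart (b₂ i q) λ e∈ → disjoint (j⊆ (proj₁ lt e∈)))) ]′ (x∈p∪q⁻ N₁ N₂ i∈))
            (sup-mono {N₁} {N} j (p⊆p∪q N₂))

          supʳ : ∀ j → G j ⊆ F' → sup N j ≡ sup N₂ j
          supʳ j j⊆ = ⊆-antisym (sup-least {N} {j} (sup-flat N₂ j) λ i i∈ lt →
              [ (λ p → ⊥-elim (apart (b₁ i p) λ e∈ e∈g → disjoint e∈g (j⊆ (proj₁ lt e∈)))) , (λ q → sup-upper {N₂} q lt) ]′ (x∈p∪q⁻ N₁ N₂ i∈))
            (sup-mono {N₂} {N} j (q⊆p∪q N₁ N₂))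

          nest-∪ : Nest N₁ → Nest N₂ → Nest N
          nest-∪ n₁ n₂ j h = go (covers (sup-⊆flat {N = N} j flF below ∘ h))
            where
            below : Below F N
            below i i∈ with x∈p∪q⁻ N₁ N₂ i∈
            ... | inj₁ p = g⊆F ∘ b₁ i p
            ... | inj₂ q = F'⊆F ∘ b₂ i q
            go : G j ⊆ G g ⊎ G j ⊆ F' → Absurd
            go (inj₁ s) = n₁ j (subst (G j ⊆_) (supˡ j s) h)
            go (inj₂ s) = n₂ j (subst (G j ⊆_) (supʳ j s) h)

          weight-∪ : weight N ≈ weight N₁ *ᴾ weight N₂
          weight-∪ = weight-* N N₁ N₂ λ j → go j (j ∈? N₁) (j ∈? N₂)
            where
            go : ∀ j → Dec (j ∈ N₁) → Dec (j ∈ N₂) → factor N j ≈ factor N₁ j *ᴾ factor N₂ j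
            go j (yes p) (yes q) = ⊥-elim (apart (b₂ j q) λ e∈ → disjoint (b₁ j p e∈))
            go j (yes p) (no ¬q) = ≈-trans (▸-yes (j ∈? N) (p⊆p∪q N₂ p)) (≈-trans (≈-reflexive (cong (λ z → v z j) (supˡ j (b₁ j p))))
              (≈-sym (≈-trans (*-cong (▸-yes (j ∈? N₁) p) (▸-no (j ∈? N₂) ¬q)) (*-identityʳ _))))
            go j (no ¬p) (yes q) = ≈-trans (▸-yes (j ∈? N) (q⊆p∪q N₁ N₂ q)) (≈-trans (≈-reflexive (cong (λ z → v z j) (supʳ j (b₂ j q))))
              (≈-sym (≈-trans (*-cong (▸-no (j ∈? N₁) ¬p) (▸-yes (j ∈? N₂) q)) (*-identityˡ _))))
            go j (no ¬p) (no ¬q) = ≈-trans (▸-no (j ∈? N) λ r → [ ¬p , ¬q ]′ (x∈p∪q⁻ N₁ N₂ r))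
              (≈-sym (≈-trans (*-cong (▸-no (j ∈? N₁) ¬p) (▸-no (j ∈? N₂) ¬q)) (*-identityˡ _)))

          φ-∪ : φ F N ≈ φ (G g) N₁ *ᴾ φ F' N₂
          φ-∪ = ≈-sym (≈-trans (▹-*ˡ d₁ {weight N₁} {φ F' N₂}) (≈-trans (▹-congʳ d₁ λ _ → ▹-*ʳ d₂ {weight N₁} {weight N₂}) (≈-trans (≈-sym (▹-× d₁ d₂))
            (▹-cong (d₁ ×-dec d₂) (nest? N ×-dec C? F N) (λ { ((n₁ , c₁) , (n₂ , c₂)) → nest-∪ n₁ n₂ , C-split⁻ c₁ c₂ })
              (λ { (nN , c) → let (c₁ , c₂) = C-split⁺ N₁ N₂ b₁ b₂ c in (nest-mono {N₁} {N} (p⊆p∪q N₂) nN , c₁) , (nest-mono {N₂} {N} (q⊆p∪q N₁ N₂) nN , c₂) })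
              λ _ → ≈-sym weight-∪))))
            where
            d₁ = nest? N₁ ×-dec C? (G g) N₁
            d₂ = nest? N₂ ×-dec C? F' N₂

        restrict : ∀ N (d : Dec (N ⊆ A ∪ B)) → φ F N ≈ d ▹ φ F N
        restrict N (yes _) = ≈-refl
        restrict N (no ¬s) = ▹-no (nest? N ×-dec C? F N) λ { (_ , c) → ¬s λ {i} i∈ → go i (covers (C-below flF c i i∈)) }
          where
          go : ∀ i → G i ⊆ G g ⊎ G i ⊆ F' → i ∈ A ∪ B
          go i (inj₁ s) = p⊆p∪q B (A⁺ s)
          go i (inj₂ s) = q⊆p∪q A B (B⁺ s)

        pairs : ∀ N₁ N₂ (d : Dec (N₁ ⊆ A × N₂ ⊆ B)) → d ▹ φ F (N₁ ∪ N₂) ≈ φ (G g) N₁ *ᴾ φ F' N₂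
        pairs N₁ N₂ (yes (s , t)) = Two.φ-∪ N₁ N₂ (λ i → A⁻ ∘ s) (λ i → B⁻ ∘ t)
        pairs N₁ N₂ (no ¬st) with below? (G g) N₁
        ... | no ¬b = ≈-sym (≈-trans (*-congʳ (▹-no (nest? N₁ ×-dec C? (G g) N₁) λ { (_ , c) → ¬b (C-below (G-flat g) c) })) (zeroˡ (φ F' N₂)))
        ... | yes b = ≈-sym (≈-trans (*-congˡ {φ (G g) N₁} (▹-no (nest? N₂ ×-dec C? F' N₂) λ { (_ , c) →
                ¬st ((λ {i} i∈ → A⁺ (b i i∈)) , (λ {i} i∈ → B⁺ (C-below F'-flat c i i∈))) })) (zeroʳ (φ (G g) N₁)))

        Φ-split : Φ F ≈ Φ (G g) *ᴾ Φ F'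
        Φ-split = begin
          Φ F
            ≈⟨ Σ-cong SM (λ N → restrict N (N ⊆? (A ∪ B))) ⟩
          Σ SM (λ N → (N ⊆? (A ∪ B)) ▹ φ F N)
            ≈⟨ Σ-∪ A B AB-disjoint (φ F) ⟩
          Σ SM (λ N₁ → Σ SM (λ N₂ → ((N₁ ⊆? A) ×-dec (N₂ ⊆? B)) ▹ φ F (N₁ ∪ N₂)))
            ≈⟨ Σ-cong SM (λ N₁ → Σ-cong SM λ N₂ → pairs N₁ N₂ ((N₁ ⊆? A) ×-dec (N₂ ⊆? B))) ⟩
          Σ SM (λ N₁ → Σ SM (λ N₂ → φ (G g) N₁ *ᴾ φ F' N₂))
            ≈⟨ Σ-cong SM (λ N₁ → ≈-sym (Σ-*ˡ SM (φ (G g) N₁))) ⟩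
          Σ SM (λ N₁ → φ (G g) N₁ *ᴾ Φ F')
            ≈⟨ Σ-*ʳ SM (Φ F') ⟨
          Φ (G g) *ᴾ Φ F' ∎

      -- D is what remains of the condition on N when g is taken out and a flat F is chosen:
      -- `sup N g ⊆ F` for the Hilbert sum, `⋁ N ≡ F` for the other. `expand` writes the
      -- contribution of N and N ∪ ⁅ g ⁆ as a sum over F, and exchanging the sums leaves Φ F. At F =
      -- G g the factor `vR` is 0, so `D⁺` and `D⁻` may assume F ≢ G g.
      module Recursive (g : Fin M) (D : Subset n → Subset M → Set) (D? : ∀ F N → Dec (D F N))
          (expand : ∀ N → g ∉ N → φ (G g) N +ᴾ φ (G g) (N ∪ ⁅ g ⁆) ≈
             (nest? N ×-dec below? (G g) N) ▹ (weight N *ᴾ Σ Sn (λ F → (flat? F ×-dec (F ⊆? G g)) ▹ (D? F N ▹ vR F g))))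
          (D⁺ : ∀ F N → Flat F → F ⊆ G g → F ≢ G g → g ∉ N → Nest N → Below (G g) N → D F N → C F N)
          (D⁻ : ∀ F N → Flat F → F ⊆ G g → F ≢ G g → Nest N → C F N → g ∉ N × Below (G g) N × D F N) where

        Φ-rec : Φ (G g) ≈ Σ Sn (λ F → (flat? F ×-dec (F ⊆? G g)) ▹ (vR F g *ᴾ (¬? (F ≟ₛ G g) ▹ Φ F)))
        Φ-rec = begin
          Φ (G g)
            ≈⟨ Σ-insert g (φ (G g)) ⟩
          Σ SM (λ N → ¬? (g ∈? N) ▹ (φ (G g) N +ᴾ φ (G g) (N ∪ ⁅ g ⁆)))
            ≈⟨ Σ-cong SM inner ⟩
          Σ SM (λ N → Σ Sn (λ F → (flat? F ×-dec (F ⊆? G g)) ▹ (vR F g *ᴾ term F N)))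
            ≈⟨ Σ-swap SM Sn ⟩
          Σ Sn (λ F → Σ SM (λ N → (flat? F ×-dec (F ⊆? G g)) ▹ (vR F g *ᴾ term F N)))
            ≈⟨ Σ-cong Sn (λ F → ≈-trans (≈-sym (Σ-▹ (flat? F ×-dec (F ⊆? G g)) SM)) (▹-congʳ (flat? F ×-dec (F ⊆? G g)) λ { (fl , s) →
                 ≈-trans (≈-sym (Σ-*ˡ SM (vR F g))) (collect F fl s (F ≟ₛ G g)) })) ⟩
          Σ Sn (λ F → (flat? F ×-dec (F ⊆? G g)) ▹ (vR F g *ᴾ (¬? (F ≟ₛ G g) ▹ Φ F))) ∎
          where
          term : Subset n → Subset M → Polyℤ
          term F N = ¬? (g ∈? N) ▹ ((nest? N ×-dec below? (G g) N) ▹ (D? F N ▹ weight N))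
          inner : ∀ N → ¬? (g ∈? N) ▹ (φ (G g) N +ᴾ φ (G g) (N ∪ ⁅ g ⁆)) ≈ Σ Sn (λ F → (flat? F ×-dec (F ⊆? G g)) ▹ (vR F g *ᴾ term F N))
          inner N = ≈-trans (▹-congʳ d₁ λ g∉ → ≈-trans (expand N g∉) (▹-congʳ d₂ λ _ → Σ-*ˡ Sn (weight N)))
              (≈-trans (▹-congʳ d₁ λ _ → Σ-▹ d₂ Sn) (≈-trans (Σ-▹ d₁ Sn) (Σ-cong Sn λ F → begin
                d₁ ▹ (d₂ ▹ (weight N *ᴾ (d F ▹ (D? F N ▹ vR F g))))
                  ≈⟨ ▹-congʳ d₁ (λ _ → ▹-congʳ d₂ λ _ → ≈-trans (▹-*ʳ (d F) {weight N} {D? F N ▹ vR F g}) (▹-congʳ (d F) λ _ → ≈-trans (▹-*ʳ (D? F N) {weight N} {vR F g}) (▹-congʳ (D? F N) λ _ → *-comm (weight N) (vR F g)))) ⟩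
                d₁ ▹ (d₂ ▹ (d F ▹ (D? F N ▹ (vR F g *ᴾ weight N))))
                  ≈⟨ ≈-trans (▹-congʳ d₁ λ _ → ▹-swap d₂ (d F)) (▹-swap d₁ (d F)) ⟩
                d F ▹ (d₁ ▹ (d₂ ▹ (D? F N ▹ (vR F g *ᴾ weight N))))
                  ≈⟨ ▹-congʳ (d F) (λ _ → ≈-sym (≈-trans (▹-*ʳ d₁ {vR F g} {d₂ ▹ (D? F N ▹ weight N)}) (▹-congʳ d₁ λ _ → ≈-trans (▹-*ʳ d₂ {vR F g} {D? F N ▹ weight N}) (▹-congʳ d₂ λ _ → ▹-*ʳ (D? F N) {vR F g} {weight N})))) ⟩
                d F ▹ (vR F g *ᴾ term F N) ∎)))
            where
            d₁ = ¬? (g ∈? N)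
            d₂ = nest? N ×-dec below? (G g) N
            d : ∀ F → Dec (Flat F × F ⊆ G g)
            d F = flat? F ×-dec (F ⊆? G g)
          collect : ∀ F → Flat F → F ⊆ G g → Dec (F ≡ G g) → vR F g *ᴾ Σ SM (term F) ≈ vR F g *ᴾ (¬? (F ≟ₛ G g) ▹ Φ F)
          collect F fl s (yes eq) = ≈-trans (*-congʳ vR0) (≈-trans (zeroˡ (Σ SM (term F))) (≈-sym (≈-trans (*-congʳ vR0) (zeroˡ (¬? (F ≟ₛ G g) ▹ Φ F)))))
            where
            vR0 : vR F g ≈ 0#
            vR0 = ≈-trans (≈-reflexive (cong (λ z → vR z g) eq)) (vR-top g)
          collect F fl s (no ne) = *-congˡ {vR F g} (≈-trans (Σ-cong SM λ N → ≈-trans (≈-trans (▹-congʳ (¬? (g ∈? N)) λ _ →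
                ≈-sym (▹-× (nest? N ×-dec below? (G g) N) (D? F N))) (≈-sym (▹-× (¬? (g ∈? N)) ((nest? N ×-dec below? (G g) N) ×-dec D? F N))))
              (▹-cong (¬? (g ∈? N) ×-dec ((nest? N ×-dec below? (G g) N) ×-dec D? F N)) (nest? N ×-dec C? F N)
                (λ { (g∉ , (nN , b) , dd) → nN , D⁺ F N fl s ne g∉ nN b dd })
                (λ { (nN , c) → let (g∉ , b , dd) = D⁻ F N fl s ne nN c in g∉ , (nN , b) , dd }) λ _ → ≈-refl))
              (≈-sym (▹-yes (¬? (F ≟ₛ G g)) ne)))

  insert⊇ : ∀ (N : Subset M) g {i} → i ∈ N → i ∈ N ∪ ⁅ g ⁆
  insert⊇ N g = p⊆p∪q ⁅ g ⁆

  g∈insert : ∀ (N : Subset M) g → g ∈ N ∪ ⁅ g ⁆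
  g∈insert N g = q⊆p∪q N ⁅ g ⁆ (x∈⁅x⁆ g)

  -- The Hilbert sum and the sum of the theorem.

  module WH = Weighted vH
  module WR = Weighted vR
  module H = WH.Conditioned Below below?
  module R = WR.Conditioned (λ F N → ⋁ N ≡ F) (λ F N → ⋁ N ≟ₛ F)

  below-⋁ : ∀ {F N} → ⋁ N ≡ F → Below F N
  below-⋁ {N = N} refl i i∈ = ⋁-upper {N} i∈

  not-member : ∀ {N : Subset M} {g} → g ∉ N → ∀ i → i ∈ N → i ≢ g
  not-member g∉ i i∈ refl = g∉ i∈

  module HSplit {F : Subset n} (flF : Flat F) (sp : Split F) where
    open Split sp
    open H.Multiplicative (λ _ c → c) flF sp (λ _ _ b₁ b₂ _ → b₁ , b₂)
      (λ {N₁} {N₂} b₁ b₂ i i∈ → [ (λ p → g⊆F {_} ∘ b₁ i p) , (λ q → F'⊆F {_} ∘ b₂ i q) ]′ (x∈p∪q⁻ N₁ N₂ i∈)) public using (Φ-split)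

  module RSplit {F : Subset n} (flF : Flat F) (sp : Split F) where
    open Split sp
    split⁺ : ∀ N₁ N₂ → Below (G g) N₁ → Below F' N₂ → ⋁ (N₁ ∪ N₂) ≡ F → ⋁ N₁ ≡ G g × ⋁ N₂ ≡ F'
    split⁺ N₁ N₂ b₁ b₂ refl =
      let (s , t) = tight (⋁-flat N₁) (⋁-flat N₂) (⋁-least {N₁} (G-flat g) b₁) (⋁-least {N₂} F'-flat b₂) cover in
      ⊆-antisym (⋁-least {N₁} (G-flat g) b₁) s , ⊆-antisym (⋁-least {N₂} F'-flat b₂) t
      where
      member : ∀ i → i ∈ N₁ ∪ N₂ → G i ⊆ cl (⋁ N₁ ∪ ⋁ N₂)
      member i i∈ with x∈p∪q⁻ N₁ N₂ i∈
      ... | inj₁ p = cl-ext ∘ p⊆p∪q (⋁ N₂) ∘ ⋁-upper {N₁} p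
      ... | inj₂ q = cl-ext ∘ q⊆p∪q (⋁ N₁) (⋁ N₂) ∘ ⋁-upper {N₂} q
      cover : ⋁ (N₁ ∪ N₂) ⊆ cl (⋁ N₁ ∪ ⋁ N₂)
      cover = ⋁-least {N₁ ∪ N₂} (cl-flat _) member
    split⁻ : ∀ {N₁ N₂} → ⋁ N₁ ≡ G g → ⋁ N₂ ≡ F' → ⋁ (N₁ ∪ N₂) ≡ F
    split⁻ {N₁} {N₂} e₁ e₂ = ⊆-antisym (⋁-least {N₁ ∪ N₂} flF member)
        (generates (⋁-flat (N₁ ∪ N₂))
          (subst (_⊆ ⋁ (N₁ ∪ N₂)) e₁ (⋁-least {N₁} (⋁-flat (N₁ ∪ N₂)) λ i i∈ → ⋁-upper {N₁ ∪ N₂} (p⊆p∪q N₂ i∈)))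
          (subst (_⊆ ⋁ (N₁ ∪ N₂)) e₂ (⋁-least {N₂} (⋁-flat (N₁ ∪ N₂)) λ i i∈ → ⋁-upper {N₁ ∪ N₂} (q⊆p∪q N₁ N₂ i∈))))
      where
      member : ∀ i → i ∈ N₁ ∪ N₂ → G i ⊆ F
      member i i∈ with x∈p∪q⁻ N₁ N₂ i∈
      ... | inj₁ p = g⊆F ∘ subst (G i ⊆_) e₁ (⋁-upper {N₁} p)
      ... | inj₂ q = F'⊆F ∘ subst (G i ⊆_) e₂ (⋁-upper {N₂} q)
    open R.Multiplicative (λ _ → below-⋁) flF sp split⁺ (λ {N₁} {N₂} → split⁻ {N₁} {N₂}) public using (Φ-split)

  module Rec (g : Fin M) where

    dN : ∀ N → Dec (Nest N × Below (G g) N)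
    dN N = nest? N ×-dec below? (G g) N

    -- Leaving g out contributes the factor 1, putting it in the factor `vH (sup N g) g`; `1+vH`
    -- turns their sum into reduced characteristic polynomials.
    H-expand : ∀ N → g ∉ N → H.φ (G g) N +ᴾ H.φ (G g) (N ∪ ⁅ g ⁆) ≈
               dN N ▹ (WH.weight N *ᴾ Σ Sn (λ F → (flat? F ×-dec (F ⊆? G g)) ▹ ((sup N g ⊆? F) ▹ vR F g)))
    H-expand N g∉ = begin
      H.φ (G g) N +ᴾ H.φ (G g) (N ∪ ⁅ g ⁆)
        ≈⟨ +-cong (▹-congʳ (dN N) λ _ → ≈-sym (*-identityʳ (WH.weight N)))
             (▹-cong (nest? (N ∪ ⁅ g ⁆) ×-dec below? (G g) (N ∪ ⁅ g ⁆)) (dN N)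
               (λ { (nN , b) → nest-mono {N} {N ∪ ⁅ g ⁆} (insert⊇ N g) nN , λ i i∈ → b i (insert⊇ N g i∈) })
               (λ { (nN , b) → WH.Insert.nest-insert g N g∉ b nN , WH.Insert.below-insert g N g∉ b })
               (λ { (_ , b) → WH.Insert.weight-insert g N g∉ (λ i i∈ → b i (insert⊇ N g i∈)) })) ⟩
      (dN N ▹ (WH.weight N *ᴾ 1#)) +ᴾ (dN N ▹ (WH.weight N *ᴾ vH (sup N g) g))
        ≈⟨ ▹-∙ (dN N) ⟨
      dN N ▹ (WH.weight N *ᴾ 1# +ᴾ WH.weight N *ᴾ vH (sup N g) g)
        ≈⟨ ▹-congʳ (dN N) (λ { (nN , b) → ≈-trans (≈-sym (distribˡ (WH.weight N) 1# (vH (sup N g) g)))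
             (*-congˡ {WH.weight N} (≈-trans (1+vH (sup-flat N g) (sup⊆ {N} {g}) (nN g)) (Σ-cong Sn λ F → ≈-trans
               (▹-cong (flat? F ×-dec ((sup N g ⊆? F) ×-dec (F ⊆? G g))) ((flat? F ×-dec (F ⊆? G g)) ×-dec (sup N g ⊆? F))
                 (λ { (x , y , z) → (x , z) , y }) (λ { ((x , z) , y) → x , y , z }) λ _ → ≈-refl)
               (▹-× (flat? F ×-dec (F ⊆? G g)) (sup N g ⊆? F))))) }) ⟩
      dN N ▹ (WH.weight N *ᴾ Σ Sn (λ F → (flat? F ×-dec (F ⊆? G g)) ▹ ((sup N g ⊆? F) ▹ vR F g))) ∎

    open H.Recursive g (λ F N → sup N g ⊆ F) (λ F N → sup N g ⊆? F) H-expand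
      (λ F N _ _ _ g∉ _ b s i i∈ → s {_} ∘ sup-upper {N} i∈ (⊆⇒⊏ (not-member {N} g∉ i i∈) (b i i∈)))
      (λ F N fl F⊆ ne _ b → (λ g∈ → ne (⊆-antisym F⊆ (b g g∈))) , (λ i i∈ → F⊆ {_} ∘ b i i∈) , sup-⊆flat {N = N} g fl b)
      public renaming (Φ-rec to H-rec)

    sup≡⋁ : ∀ N → g ∉ N → Below (G g) N → sup N g ≡ ⋁ N
    sup≡⋁ N g∉ b = ⊆-antisym (sup-least {N} {g} (⋁-flat N) λ i i∈ _ → ⋁-upper {N} i∈)
      (⋁-least {N} (sup-flat N g) λ i i∈ → sup-upper {N} i∈ (⊆⇒⊏ (not-member {N} g∉ i i∈) (b i i∈)))

    -- A nested N without g cannot have join G g, since then G g ⊆ sup N g. Only N ∪ ⁅ g ⁆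
    -- contributes, through the single flat F = ⋁ N = sup N g.
    R-expand : ∀ N → g ∉ N → R.φ (G g) N +ᴾ R.φ (G g) (N ∪ ⁅ g ⁆) ≈
               dN N ▹ (WR.weight N *ᴾ Σ Sn (λ F → (flat? F ×-dec (F ⊆? G g)) ▹ ((⋁ N ≟ₛ F) ▹ vR F g)))
    R-expand N g∉ = begin
      R.φ (G g) N +ᴾ R.φ (G g) (N ∪ ⁅ g ⁆)
        ≈⟨ +-cong (▹-no (nest? N ×-dec (⋁ N ≟ₛ G g)) λ { (nN , e) → nN g (subst (G g ⊆_) (sym (sup≡⋁ N g∉ (below-⋁ {N = N} e))) (subst (_⊆ ⋁ N) e id)) })
             (▹-cong (nest? (N ∪ ⁅ g ⁆) ×-dec (⋁ (N ∪ ⁅ g ⁆) ≟ₛ G g)) (dN N)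
               (λ { (nN , e) → nest-mono {N} {N ∪ ⁅ g ⁆} (insert⊇ N g) nN , λ i i∈ → below-⋁ {N = N ∪ ⁅ g ⁆} e i (insert⊇ N g i∈) })
               (λ { (nN , b) → WR.Insert.nest-insert g N g∉ b nN ,
                    ⊆-antisym (⋁-least {N ∪ ⁅ g ⁆} (G-flat g) (WR.Insert.below-insert g N g∉ b)) (⋁-upper {N ∪ ⁅ g ⁆} (g∈insert N g)) })
               (λ { (_ , e) → WR.Insert.weight-insert g N g∉ (λ i i∈ → below-⋁ {N = N ∪ ⁅ g ⁆} e i (insert⊇ N g i∈)) })) ⟩
      0# +ᴾ (dN N ▹ (WR.weight N *ᴾ vR (sup N g) g))
        ≈⟨ +-identityˡ _ ⟩
      dN N ▹ (WR.weight N *ᴾ vR (sup N g) g)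
        ≈⟨ ▹-congʳ (dN N) (λ { (nN , b) → *-congˡ {WR.weight N} (≈-sym (≈-trans
             (Σ-single Sn (⋁ N) (allSubsets-unique n) (allSubsets-complete (⋁ N)) λ F ne → ▹-ε (flat? F ×-dec (F ⊆? G g)) λ _ → ▹-no (⋁ N ≟ₛ F) (≢-sym ne))
             (≈-trans (▹-yes (flat? (⋁ N) ×-dec (⋁ N ⊆? G g)) (⋁-flat N , ⋁-least {N} (G-flat g) b)) (≈-trans (▹-yes (⋁ N ≟ₛ ⋁ N) refl)
               (≈-reflexive (cong (λ z → vR z g) (sym (sup≡⋁ N g∉ b)))))))) }) ⟩
      dN N ▹ (WR.weight N *ᴾ Σ Sn (λ F → (flat? F ×-dec (F ⊆? G g)) ▹ ((⋁ N ≟ₛ F) ▹ vR F g))) ∎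

    open R.Recursive g (λ F N → ⋁ N ≡ F) (λ F N → ⋁ N ≟ₛ F) R-expand
      (λ F N _ _ _ _ _ _ e → e)
      (λ F N fl F⊆ ne _ e → (λ g∈ → ne (⊆-antisym F⊆ (below-⋁ {N = N} e g g∈))) , (λ i i∈ → F⊆ {_} ∘ below-⋁ {N = N} e i i∈) , e)
      public renaming (Φ-rec to R-rec)

  -- Members of 𝒢 are nonempty, so a set N that counts has no elements and both weights are 1.
  Φ-⊥ : H.Φ ⊥ ≈ R.Φ ⊥
  Φ-⊥ = Σ-cong SM λ N → ▹-cong (nest? N ×-dec below? ⊥ N) (nest? N ×-dec (⋁ N ≟ₛ ⊥))
    (λ { (nN , b) → nN , ⊆-antisym (⋁-least {N} loopless b) (⊆-min _) })
    (λ { (nN , e) → nN , below-⋁ {N = N} e })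
    (λ { (_ , b) → Π-cong (allFin M) λ j → let j∉ = λ j∈ → let (e , e∈) = G-nonempty j in ∉⊥ (b j j∈ e∈) in
      ≈-trans (▸-no (j ∈? N) j∉) (≈-sym (▸-no (j ∈? N) j∉)) })

  -- Strong induction on |F|: for F in 𝒢 the two recursions have the same coefficients `vR`, and
  -- every other nonempty flat splits into two smaller ones.
  HΦ≈RΦ : ∀ k F → ∣ F ∣ < k → Flat F → H.Φ F ≈ R.Φ F
  HΦ≈RΦ (suc k) F (s≤s le) fl with F ≟ₛ ⊥
  ... | yes refl = Φ-⊥
  ... | no ne with any? (λ l → G l ≟ₛ F)
  ... | yes (g , refl) = ≈-trans (Rec.H-rec g) (≈-trans (Σ-cong Sn λ K → ▹-congʳ (flat? K ×-dec (K ⊆? G g)) λ { (flK , s) →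
        *-congˡ {vR K g} (▹-congʳ (¬? (K ≟ₛ G g)) λ K≢ → HΦ≈RΦ k K (ℕP.<-≤-trans (⊏⇒∣<∣ (s , K≢)) le) flK) }) (≈-sym (Rec.R-rec g)))
  ... | no F∉ = ≈-trans (HSplit.Φ-split fl sp) (≈-trans (*-cong
        (HΦ≈RΦ k (G g) (ℕP.<-≤-trans (⊏⇒∣<∣ (g⊆F , λ e → F∉ (g , e))) le) (G-flat g))
        (HΦ≈RΦ k F' (ℕP.<-≤-trans (⊏⇒∣<∣ (F'⊆F , λ e → let (x , x∈) = G-nonempty g in disjoint x∈ (subst (x ∈_) (sym e) (g⊆F x∈)))) le) F'-flat))
        (≈-sym (RSplit.Φ-split fl sp)))
    where
    sp = split fl ne
    open Split sp

-- Counting standard monomials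

range : ℕ → List ℕ
range zero = []
range (suc K) = 0 ∷ L.map suc (range K)

∈-range : ∀ {k K} → k < K → k ∈ₗ range K
∈-range {zero} (s≤s _) = here refl
∈-range {suc k} (s≤s lt) = there (∈-map⁺ suc (∈-range lt))

range-unique : ∀ K → Unique (range K)
range-unique zero = []
range-unique (suc K) = AllP.map⁺ (All.tabulate λ _ ()) ∷ UniqueP.map⁺ ℕP.suc-injective (range-unique K)

grid : ℕ → ∀ m → List (Vec ℕ m)
grid K zero = [] ∷ []
grid K (suc m) = L.cartesianProductWith _∷_ (range K) (grid K m)

∈-grid : ∀ {K m} (ν : Vec ℕ m) → (∀ j → V.lookup ν j < K) → ν ∈ₗ grid K m
∈-grid [] h = here refl
∈-grid (x ∷ ν) h = ∈-cartesianProductWith⁺ _∷_ (∈-range (h zero)) (∈-grid ν (h ∘ suc))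

grid-unique : ∀ K m → Unique (grid K m)
grid-unique K zero = [] ∷ []
grid-unique K (suc m) = UniqueP.cartesianProductWith⁺ _∷_ (λ { refl → refl , refl }) (range-unique K) (grid-unique K m)

Σ-product : ∀ {A B C : Set} (h : A → B → C) xs ys {f} →
            Σ (L.cartesianProductWith h xs ys) f ≈ Σ xs (λ x → Σ ys (λ y → f (h x y)))
Σ-product h [] ys = ≈-refl
Σ-product h (x ∷ xs) ys = ≈-trans (Σ-++ (L.map (h x) ys) (L.cartesianProductWith h xs ys)) (+-cong (Σ-map (h x) ys) (Σ-product h xs ys))

Π-suc : ∀ {m} (f : Fin (suc m) → Polyℤ) → Π (allFin (suc m)) f ≈ f zero *ᴾ Π (allFin m) (f ∘ suc)
Π-suc {m} f = *-congˡ {f zero} (≈-trans (≈-reflexive (cong (λ xs → Π xs f) (sym (LP.map-tabulate id suc)))) (Π-map suc (allFin m)))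

Π-Σ : ∀ K {m} (t : Fin m → ℕ → Polyℤ) →
      Π (allFin m) (λ j → Σ (range K) (t j)) ≈ Σ (grid K m) (λ ν → Π (allFin m) (λ j → t j (V.lookup ν j)))
Π-Σ K {zero} t = ≈-sym (+-identityʳ 1#)
Π-Σ K {suc m} t = begin
  Π (allFin (suc m)) (λ j → Σ (range K) (t j))
    ≈⟨ Π-suc (λ j → Σ (range K) (t j)) ⟩
  Σ (range K) (t zero) *ᴾ Π (allFin m) (λ j → Σ (range K) (t (suc j)))
    ≈⟨ *-congˡ {Σ (range K) (t zero)} (Π-Σ K (t ∘ suc)) ⟩
  Σ (range K) (t zero) *ᴾ Σ (grid K m) (λ ν → Π (allFin m) (λ j → t (suc j) (V.lookup ν j)))
    ≈⟨ Σ-*ʳ (range K) _ ⟩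
  Σ (range K) (λ x → t zero x *ᴾ Σ (grid K m) (λ ν → Π (allFin m) (λ j → t (suc j) (V.lookup ν j))))
    ≈⟨ Σ-cong (range K) (λ x → ≈-trans (Σ-*ˡ (grid K m) (t zero x)) (Σ-cong (grid K m) λ ν → ≈-sym (Π-suc λ j → t j (V.lookup (x ∷ ν) j)))) ⟩
  Σ (range K) (λ x → Σ (grid K m) (λ ν → Π (allFin (suc m)) (λ j → t j (V.lookup (x ∷ ν) j))))
    ≈⟨ Σ-product _∷_ (range K) (grid K m) ⟨
  Σ (grid K (suc m)) (λ ν → Π (allFin (suc m)) (λ j → t j (V.lookup ν j))) ∎

infix 8 x^_
x^_ : ℕ → Polyℤ
x^ k = monoℤ (+ 1) k

pair-x^ : ∀ f k → pair f (x^ k) ≡ f k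
pair-x^ f k = trans (pair-mono f (+ 1) k) (ℤP.*-identityˡ (f k))

x^-+ : ∀ a b → x^ a *ᴾ x^ b ≈ x^ (a ℕ.+ b)
x^-+ a b = ext λ f → trans (pair-⊛ f (x^ a) (x^ b)) (trans (pair-x^ _ a) (trans (pair-x^ _ b) (sym (pair-x^ f (a ℕ.+ b)))))

Π-x^ : ∀ {m} (ν : Vec ℕ m) → Π (allFin m) (λ j → x^ (V.lookup ν j)) ≈ x^ (V.sum ν)
Π-x^ [] = ≈-refl
Π-x^ (a ∷ ν) = ≈-trans (Π-suc λ j → x^ (V.lookup (a ∷ ν) j)) (≈-trans (*-congˡ {x^ a} (Π-x^ ν)) (x^-+ a (V.sum ν)))

Σ-prefix : ∀ f K d → d ≤ K → ZS.Σ (range K) (λ k → (k ℕP.<? d) ZS.▹ f k) ≡ prefix f d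
Σ-prefix f zero .zero z≤n = refl
Σ-prefix f (suc K) zero _ = ZS.Σ-ε (range (suc K)) λ k _ → ZS.▹-no (k ℕP.<? 0) {f k} λ ()
Σ-prefix f (suc K) (suc d) (s≤s le) = cong₂ ℤ._+_ (ZS.▹-yes (0 ℕP.<? suc d) {f 0} (s≤s z≤n))
  (trans (ZS.Σ-map ℕ.suc (range K)) (trans (ZS.Σ-cong (range K) λ k → ZS.▹-cong (suc k ℕP.<? suc d) (k ℕP.<? d) ℕP.≤-pred s≤s λ _ → refl)
    (Σ-prefix (f ∘ suc) K d le)))

pair-Σ▹x^ : ∀ {P : ℕ → Set} (P? : ∀ k → Dec (P k)) f K →
            pair f (Σ (range K) (λ k → P? k ▹ x^ k)) ≡ ZS.Σ (range K) (λ k → P? k ZS.▹ f k)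
pair-Σ▹x^ P? f K = trans (pair-Σ f (range K) _) (ZS.Σ-cong (range K) λ k → trans (pair-▹ f (P? k) (x^ k)) (ZS.▹-congʳ (P? k) λ _ → pair-x^ f k))

length-filter : ∀ {A : Set} {P : A → Set} (P? : ∀ x → Dec (P x)) xs → + length (L.filter P? xs) ≡ ZS.Σ xs (λ x → P? x ZS.▹ + 1)
length-filter P? [] = refl
length-filter P? (x ∷ xs) with P? x
... | yes _ = cong (λ z → + 1 ℤ.+ z) (length-filter P? xs)
... | no _ = trans (length-filter P? xs) (sym (ℤP.+-identityˡ _))

module Hilbert {n : ℕ} (rk : Subset n → ℕ) (pm : IsPolymatroid rk) (loopless : Loopless rk)
               (𝒢 : List (Subset n)) (bs : IsBuildingSet rk 𝒢) where
  open IsPolymatroid pm using (monotone)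
  open BuildingSet rk pm loopless 𝒢 bs
  open Functionals rk pm loopless 𝒢 bs using (Std; dd)
  open Recursion rk pm loopless 𝒢 bs

  private SM = allSubsets M

  ⊤-flat : Flat ⊤
  ⊤-flat e e∉ = ⊥-elim (e∉ ∈⊤)

  nestedSum≈RΦ : nestedSum rk 𝒢 ≈ R.Φ ⊤
  nestedSum≈RΦ = ≈-trans (sumPolyℤ≃Σ _ (filterᵇ selected SM)) (≈-trans (Σ-filterᵇ selected SM) (Σ-cong SM λ S →
    ▹-cong (T? (selected S)) (nest? S ×-dec (⋁ S ≟ₛ ⊤))
      (λ t → let (a , b) = T-∧⁻ {isNested rk 𝒢 S} t in isNested⇒Nest S a , ==⁻ {A = ⋁ S} {⊤} b)
      (λ { (a , b) → T-∧⁺ (Nest⇒isNested S a) (==⁺ {A = ⋁ S} {⊤} b) })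
      λ _ → ≈-trans (prodPolyℤ≃Π _ (members rk 𝒢 S)) (≈-trans (Π-filterᵇ (λ i → elemᵇ i S) (allFin M))
        (Π-cong (allFin M) λ j → ▸-cong (T? (elemᵇ j S)) (j ∈? S) (elem⁻ {A = S}) (elem⁺ {A = S}) λ _ → ≈-refl))))
    where
    selected : Subset M → Bool
    selected S = isNested rk 𝒢 S B.∧ isSpanning rk 𝒢 S

  -- Bounds every exponent of a standard monomial, so that all of these lie in the finite
  -- `grid K M`.
  K : ℕ
  K = rk ⊤

  gap : Subset M → Fin M → ℕ
  gap N j = rk (G j) ∸ rk (sup N j)

  gap≤K : ∀ N j → gap N j ≤ K
  gap≤K N j = ℕP.≤-trans (ℕP.m∸n≤m (rk (G j)) (rk (sup N j))) (monotone _ _ (⊆-max _))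

  -- The exponent k is allowed at j in a standard monomial with support N.
  Fits : Subset M → Fin M → ℕ → Set
  Fits N j k = k < gap N j × (j ∈ N → 0 < k) × (0 < k → j ∈ N)

  fits? : ∀ N j k → Dec (Fits N j k)
  fits? N j k = (k ℕP.<? gap N j) ×-dec (((j ∈? N) →-dec (0 ℕP.<? k)) ×-dec ((0 ℕP.<? k) →-dec (j ∈? N)))

  column : Subset M → Fin M → Polyℤ
  column N j = Σ (range K) (λ k → fits? N j k ▹ x^ k)

  column-∈ : ∀ {N j} → j ∈ N → column N j ≈ vH (sup N j) j
  column-∈ {N} {j} j∈ = ext λ f → trans (pair-Σ▹x^ (fits? N j) f K) (trans (go f K (gap≤K N j))
      (sym (trans (ℤP.+-identityˡ _) (pair-replicate (f ∘ suc) (gap N j ∸ 1)))))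
    where
    go : ∀ f K → gap N j ≤ K → ZS.Σ (range K) (λ k → fits? N j k ZS.▹ f k) ≡ prefix (f ∘ suc) (gap N j ∸ 1)
    go f zero le = sym (cong (λ d → prefix (f ∘ suc) (d ∸ 1)) (ℕP.n≤0⇒n≡0 le))
    go f (suc K) le = trans (cong₂ ℤ._+_ (ZS.▹-no (fits? N j 0) {f 0} λ { (_ , h , _) → ℕP.<-irrefl refl (h j∈) })
        (trans (ZS.Σ-map ℕ.suc (range K)) (trans (ZS.Σ-cong (range K) λ k → ZS.▹-cong (fits? N j (suc k)) (k ℕP.<? (gap N j ∸ 1))
            (λ { (lt , _) → shift lt }) (λ lt → unshift lt , (λ _ → s≤s z≤n) , λ _ → j∈) λ _ → refl)
          (Σ-prefix (f ∘ suc) K (gap N j ∸ 1) (ℕP.∸-monoˡ-≤ 1 le))))) (ℤP.+-identityˡ _)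
      where
      shift : ∀ {k d} → suc k < d → k < d ∸ 1
      shift {d = suc d} (s≤s lt) = lt
      unshift : ∀ {k d} → k < d ∸ 1 → suc k < d
      unshift {d = suc d} lt = s≤s lt

  -- Outside the support only the exponent 0 is allowed, and only while the gap is positive.
  column-∉ : ∀ {N j} → j ∉ N → 0 < gap N j → column N j ≈ 1#
  column-∉ {N} {j} j∉ pos = go K (ℕP.<-≤-trans pos (gap≤K N j))
    where
    go : ∀ K → 0 < K → Σ (range K) (λ k → fits? N j k ▹ x^ k) ≈ 1#
    go (suc K) _ = ≈-trans (+-cong (▹-yes (fits? N j 0) {x^ 0} (pos , (λ j∈ → ⊥-elim (j∉ j∈)) , λ ()))
      (≈-trans (Σ-map ℕ.suc (range K)) (Σ-ε (range K) λ k _ → ▹-no (fits? N j (suc k)) {x^ (suc k)} λ { (_ , _ , h) → j∉ (h (s≤s z≤n)) }))) (+-identityʳ _)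

  column-0 : ∀ {N j} → gap N j ≡ 0 → column N j ≈ 0#
  column-0 {N} {j} eq = Σ-ε (range K) λ k _ → ▹-no (fits? N j k) {x^ k} λ { (lt , _) → ℕP.n≮0 (subst (k <_) eq lt) }

  -- A set that is not nested has some j with gap 0, whose empty column makes the product 0. So the
  -- nestedness condition is absorbed, and the product can be expanded over exponent vectors for
  -- every N.
  nest-columns : ∀ N → (d : Dec (Nest N)) → H.φ ⊤ N ≈ Π (allFin M) (column N)
  nest-columns N (yes nN) = ≈-trans (▹-yes (nest? N ×-dec below? ⊤ N) (nN , λ _ _ → ⊆-max _)) (Π-cong (allFin M) λ j → ≈-sym (go j (j ∈? N)))
    where
    pos : ∀ j → 0 < gap N j
    pos j = ℕP.m<n⇒0<n∸m (ℕP.≰⇒> λ le → nN j (flat-rk (sup-flat N j) (sup⊆ {N} {j}) le))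
    go : ∀ j → Dec (j ∈ N) → column N j ≈ WH.factor N j
    go j (yes j∈) = ≈-trans (column-∈ j∈) (≈-sym (▸-yes (j ∈? N) j∈))
    go j (no j∉) = ≈-trans (column-∉ j∉ (pos j)) (≈-sym (▸-no (j ∈? N) j∉))
  nest-columns N (no ¬n) = ≈-trans (▹-no (nest? N ×-dec below? ⊤ N) (¬n ∘ proj₁))
      (≈-sym (let (j , s) = FinP.¬∀⟶∃¬ M (λ j → ¬ (G j ⊆ sup N j)) (λ j → ¬? (G j ⊆? sup N j)) ¬n in
        Π-zero (allFin M) j (∈-allFin j) (column-0 {N} {j} (ℕP.m≤n⇒m∸n≡0 (monotone _ _ (decidable-stable (G j ⊆? sup N j) s))))))

  std? : ∀ ν → Dec (Std ν)
  std? ν = FinP.all? λ j → V.lookup ν j ℕP.<? dd j ν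

  allFit? : ∀ N (ν : Vec ℕ M) → Dec (∀ j → Fits N j (V.lookup ν j))
  allFit? N ν = FinP.all? λ j → fits? N j (V.lookup ν j)

  fits⇒supp : ∀ N ν → (∀ j → Fits N j (V.lookup ν j)) → N ≡ supp ν
  fits⇒supp N ν h = ⊆-antisym (λ {j} j∈ → supp⁺ ν (proj₁ (proj₂ (h j)) j∈)) (λ {j} j∈ → proj₂ (proj₂ (h j)) (supp⁻ ν j∈))

  Π-fits : ∀ N ν (d : Dec (∀ j → Fits N j (V.lookup ν j))) →
           Π (allFin M) (λ j → fits? N j (V.lookup ν j) ▹ x^ (V.lookup ν j)) ≈ d ▹ x^ (V.sum ν)
  Π-fits N ν (yes h) = ≈-trans (Π-cong (allFin M) λ j → ▹-yes (fits? N j (V.lookup ν j)) (h j)) (Π-x^ ν)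
  Π-fits N ν (no ¬h) = let (j , ¬f) = FinP.¬∀⟶∃¬ M (λ j → Fits N j (V.lookup ν j)) (λ j → fits? N j (V.lookup ν j)) ¬h in
    Π-zero (allFin M) j (∈-allFin j) (▹-no (fits? N j (V.lookup ν j)) ¬f)

  -- An exponent vector can fit only one N, its support, and fits it exactly when it is standard; so
  -- exchanging the sums leaves one term for each standard monomial.
  HΦ≈std : H.Φ ⊤ ≈ Σ (grid K M) (λ ν → std? ν ▹ x^ (V.sum ν))
  HΦ≈std = begin
    H.Φ ⊤
      ≈⟨ Σ-cong SM (λ N → ≈-trans (nest-columns N (nest? N)) (Π-Σ K (λ j k → fits? N j k ▹ x^ k))) ⟩
    Σ SM (λ N → Σ (grid K M) (λ ν → Π (allFin M) (λ j → fits? N j (V.lookup ν j) ▹ x^ (V.lookup ν j))))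
      ≈⟨ Σ-swap SM (grid K M) ⟩
    Σ (grid K M) (λ ν → Σ SM (λ N → Π (allFin M) (λ j → fits? N j (V.lookup ν j) ▹ x^ (V.lookup ν j))))
      ≈⟨ Σ-cong (grid K M) (λ ν → ≈-trans (Σ-cong SM λ N → Π-fits N ν (allFit? N ν))
           (≈-trans (Σ-single SM (supp ν) (allSubsets-unique M) (allSubsets-complete (supp ν)) λ N ne → ▹-no (allFit? N ν) λ h → ne (fits⇒supp N ν h))
             (▹-cong (allFit? (supp ν) ν) (std? ν) (λ h j → proj₁ (h j)) (λ s j → s j , supp⁻ ν , supp⁺ ν) λ _ → ≈-refl))) ⟩
    Σ (grid K M) (λ ν → std? ν ▹ x^ (V.sum ν)) ∎

  module _ (i : ℕ) where
    inBasis? : ∀ ν → Dec (Std ν × V.sum ν ≡ i)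
    inBasis? ν = std? ν ×-dec (V.sum ν ℕP.≟ i)

    basis : List (Vec ℕ M)
    basis = L.filter inBasis? (grid K M)

    basis-complete : ∀ ν → Std ν → V.sum ν ≡ i → ν ∈ₗ basis
    basis-complete ν s d = ∈-filter⁺ inBasis? (∈-grid ν λ j → ℕP.<-≤-trans (s j) (gap≤K (supp ν) j)) (s , d)

    basis-sound : ∀ ν → ν ∈ₗ basis → Std ν × V.sum ν ≡ i
    basis-sound ν h = proj₂ (∈-filter⁻ inBasis? {xs = grid K M} h)

    count : + length basis ≡ coeffℤ (nestedSum rk 𝒢) i
    count = trans (length-filter inBasis? (grid K M)) (sym (trans (coeffℤ≡pair (nestedSum rk 𝒢) i)
      (trans (pair≡ (≈-trans nestedSum≈RΦ (≈-trans (≈-sym (HΦ≈RΦ _ ⊤ (ℕP.n<1+n _) ⊤-flat)) HΦ≈std)) δ)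
      (trans (pair-Σ δ (grid K M) _) (ZS.Σ-cong (grid K M) λ ν → trans (pair-▹ δ (std? ν) (x^ (V.sum ν)))
        (trans (ZS.▹-congʳ (std? ν) λ _ → pair-x^ δ (V.sum ν)) (sym (ZS.▹-× (std? ν) (V.sum ν ℕP.≟ i)))))))))
      where
      δ : ℕ → ℤ
      δ k = (k ℕP.≟ i) ZS.▹ + 1

    chow-dim : ∃ λ d → ChowDim rk 𝒢 i d × (+ d ≡ coeffℤ (nestedSum rk 𝒢) i)
    chow-dim = length basis ,
      ChowRing.Basis.chow-dim rk pm loopless 𝒢 bs i basis (UniqueP.filter⁺ inBasis? (grid-unique K M)) basis-complete basis-sound ,
      count

theorem1p3 : (n : ℕ) (rk : Subset n → ℕ) (𝒢 : List (Subset n)) →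
    0 < n → IsPolymatroid rk → Loopless rk → IsBuildingSet rk 𝒢 →
    ∀ (i : ℕ) → ∃ λ (d : ℕ) → ChowDim rk 𝒢 i d × (+ d ≡ coeffℤ (nestedSum rk 𝒢) i)
theorem1p3 n rk 𝒢 _ pm loopless bs i = Hilbert.chow-dim rk pm loopless 𝒢 bs i
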